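{- Let $r\geq 4$ and let $\mathcal{H}$ be an $(r-2)$-reducible $r$-tree with $\sigma(\mathcal{H})=t+1$. Let $E_1,\dots,E_m$ be a tree-defining ordering of $\mathcal{H}$ and $S$ a minimum cross-cut of $\mathcal{H}$. Let $w$ be the vertex of $S$ that is included last in this ordering (i.e. the vertex of $S$ whose first containing edge has the largest index), and let $\mathcal{H}_w$ be the subgraph of $\mathcal{H}$ consisting of all edges containing $w$. Suppose $\mathcal{H}_w$ is the linear star $\mathcal{L}^r_p$. Then there is a positive integer $n_1$ such that for all $n\geq n_1$, $$\mathrm{ex}(n,\mathcal{H})\leq\binom{n}{r}-\binom{n-t}{r}+\mathrm{ex}(n-t,\mathcal{L}^r_p).$$
   Context: An $r$-tree is an $r$-uniform hypergraph whose edges can be ordered $E_1,\dots,E_m$ (a tree-defining ordering) so that for each $i>1$ there is $\alpha(i)<i$ with $E_i\cap\bigcup_{j<i}E_j\subseteq E_{\alpha(i)}$. It is $k$-reducible if each edge contains at least $k$ vertices of degree $1$. A cross-cut is a vertex set meeting each edge in exactly one vertex; $\sigma(\mathcal{H})$ is the minimum size of a cross-cut, and a minimum cross-cut is one of that size. $\mathcal{L}^r_p$ is the $r$-uniform linear star: $p$ edges of size $r$ pairwise intersecting in exactly one common vertex. $\mathrm{ex}(n,\mathcal{G})$ is the maximum number of edges of an $n$-vertex $r$-uniform hypergraph not containing $\mathcal{G}$. -}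

module Defs where

open import Data.Nat using (ℕ; zero; suc; _+_; _*_; _∸_; _≤_; _<_; _≡ᵇ_; _≤ᵇ_; _<ᵇ_)
open import Data.Bool using (Bool; true; false; if_then_else_; _∧_; _∨_)
open import Data.Fin using (Fin; toℕ) renaming (zero to fzero; suc to fsuc)
open import Data.Fin.Subset using (Subset; _∈_; _∩_; ∣_∣; ⁅_⁆)
open import Data.Vec using (lookup; tabulate)
open import Data.Product using (Σ; ∃; ∃-syntax; _×_)
open import Relation.Nullary using (¬_)
open import Relation.Binary.PropositionalEquality using (_≡_; _≢_)
open import Function.Definitions using (Injective)

-- An (ordered) hypergraph on vertex set Fin V: edges E₀,…,E_{m-1}, each a subset.
-- For the tree H the order of the edges is the given tree-defining ordering.
record Hypergraph (V : ℕ) : Set where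
  field
    m    : ℕ
    edge : Fin m → Subset V
open Hypergraph public

count : ∀ {m} → (Fin m → Bool) → ℕ
count {zero}  f = 0
count {suc m} f = (if f fzero then 1 else 0) + count (λ i → f (fsuc i))

module _ {V : ℕ} (H : Hypergraph V) where

  Uniform : ℕ → Set
  Uniform r = ∀ i → ∣ edge H i ∣ ≡ r

  Simple : Set
  Simple = Injective _≡_ _≡_ (edge H)

  degree : Fin V → ℕ
  degree x = count (λ i → lookup (edge H i) x)

  IsTreeOrdering : Set
  IsTreeOrdering =
    ∀ (i : Fin (m H)) → 0 < toℕ i →
      ∃[ a ] (toℕ a < toℕ i) ×
        (∀ x → x ∈ edge H i → (∃[ j ] (toℕ j < toℕ i) × x ∈ edge H j) → x ∈ edge H a)

  Reducible : ℕ → Set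
  Reducible k = ∀ i → k ≤ count (λ x → lookup (edge H i) x ∧ (degree x ≡ᵇ 1))

  CrossCut : Subset V → Set
  CrossCut S = ∀ i → ∣ edge H i ∩ S ∣ ≡ 1

  -- minimum cross-cut (its size is σ(H))
  MinCrossCut : Subset V → Set
  MinCrossCut S = CrossCut S × (∀ S' → CrossCut S' → ∣ S ∣ ≤ ∣ S' ∣)

  FirstEdge : Fin V → Fin (m H) → Set
  FirstEdge x i = x ∈ edge H i × (∀ j → x ∈ edge H j → toℕ i ≤ toℕ j)

  IncludedLast : Subset V → Fin V → Set
  IncludedLast S w =
    w ∈ S × ∃[ i ] FirstEdge w i ×
      (∀ y → y ∈ S → ∀ j → FirstEdge y j → toℕ j ≤ toℕ i)

  -- H_w (the edges containing w) is the linear star L^r_p (H being r-uniform):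
  -- exactly p edges contain w and any two of them meet exactly in {w}
  StarIsLinear : Fin V → ℕ → Set
  StarIsLinear w p =
    degree w ≡ p ×
    (∀ i j → i ≢ j → w ∈ edge H i → w ∈ edge H j → edge H i ∩ edge H j ≡ ⁅ w ⁆)

-- The linear star L^r_p (r ≥ 1): vertices 0,…,p(r-1); centre 0;
-- edge i (i < p) = {0} ∪ {x : i(r-1) < x ≤ (i+1)(r-1)}.
LinearStar : (r p : ℕ) → Hypergraph (suc (p * (r ∸ 1)))
LinearStar r p = record
  { m    = p
  ; edge = λ i → tabulate (λ x →
      (toℕ x ≡ᵇ 0) ∨ ((toℕ i * (r ∸ 1) <ᵇ toℕ x) ∧ (toℕ x ≤ᵇ (suc (toℕ i)) * (r ∸ 1))))
  }

Contains : ∀ {n v} → Hypergraph n → Hypergraph v → Set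
Contains {n} {v} F G =
  Σ (Fin v → Fin n) λ φ → Injective _≡_ _≡_ φ ×
  Σ (Fin (m G) → Fin (m F)) λ ψ → Injective _≡_ _≡_ ψ ×
    (∀ i → (∀ y → y ∈ edge G i → φ y ∈ edge F (ψ i)) ×
           (∀ x → x ∈ edge F (ψ i) → ∃[ y ] y ∈ edge G i × φ y ≡ x))

Free : ∀ {v} (r n : ℕ) → Hypergraph v → Hypergraph n → Set
Free r n G F = Uniform F r × Simple F × ¬ Contains F G

IsEx : ∀ {v} (r n : ℕ) → Hypergraph v → ℕ → Set
IsEx r n G e =
  (∃[ F ] Free r n G F × m F ≡ e) ×
  (∀ (F : Hypergraph n) → Free r n G F → m F ≤ e)

{-# OPTIONS --safe #-}
-- Call {a, b, c} rich if the edges through it cannot be blocked by |V(H)| further vertices. A graph of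
-- large minimum degree whose edges are rich pairs, or form rich triples with |S| fixed centres, contains
-- H: the tree order embeds greedily the at most two shared vertices of each edge off S, and private
-- vertices are filled in by richness. So in an H-free F rich pairs are sparse. A delta-system argument
-- shows that all but O(n^(r-2)) edges have a dominating vertex c, one for which {c, u, w} is rich for all
-- u, w in the edge. By sparseness most dominating vertices lie in a bounded set, and few pairs u, w
-- are rich with more than t of them; if F has as many edges as the vertices of a t-set L would cover,
-- almost every (r-1)-set has exactly t of them, the same for all its pairs, and averaging produces one L
-- that is rich with almost all pairs.
--
-- Let Q be the graph of the poor pairs outside L. A linear star outside L containing an edge
-- that has a pair of non-adjacent vertices of low Q-degree extends to H, since w is included last and the
-- star of w touches the rest of H in at most two vertices of its first edge. Each pair of Q forces about
-- n^(r-3) tuples through L to be absent from F, whereas the edges outside L that are cliques of the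
-- enlarged graph Q are, again by the greedy embedding, at most a constant times the number of its
-- (r-1)-cliques, which is o(|Q| n^(r-3)) because |Q| = o(n^2) and r ≥ 4. The remaining edges outside L
-- contain no linear star.
module Submission where

open import Defs
open import Data.Nat
open import Data.Nat.Properties
open import Data.Nat.Combinatorics using (_C_; nCk+nC[k+1]≡[n+1]C[k+1])
open import Data.Nat.Tactic.RingSolver using (solve-∀)
open import Data.Bool using (Bool; true; false; if_then_else_; _∧_; _∨_) renaming (T to True)
import Data.Bool.Properties as Bool
open import Data.Fin using (Fin; toℕ; fromℕ<; inject≤; punchOut; punchIn) renaming (zero to fzero; suc to fsuc)
import Data.Fin.Properties as Fin
open import Data.Fin.Subset using (Subset; _∈_; _∩_; ∣_∣)
open import Data.Fin.Subset.Properties using (_∈?_; x∈p∩q⁺; x∈p∩q⁻; drop-there)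
import Data.Fin.Subset.Properties as Subset
open import Data.Vec using (Vec; []; _∷_; lookup; tabulate; replicate; here; there; removeAt; insertAt)
import Data.Vec.Properties as Vec
open import Data.List using (List; []; _∷_; map; concatMap; allFin; length; _++_)
import Data.List.Properties as List
open import Data.List.Relation.Unary.All using (All; []; _∷_)
import Data.List.Relation.Unary.All as All
import Data.List.Relation.Unary.All.Properties as All
open import Data.List.Relation.Unary.Any using (Any; here; there)
import Data.List.Relation.Unary.Any as Any
import Data.List.Relation.Unary.Any.Properties as Any
import Data.List.Membership.Propositional as List
import Data.List.Membership.Propositional.Properties as List
open import Data.Unit using (⊤; tt)
open import Data.Product using (Σ; ∃; ∃-syntax; _×_; _,_; proj₁; proj₂)
open import Data.Sum using (_⊎_; inj₁; inj₂)
import Data.Sum as Sum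
open import Data.Empty using (⊥; ⊥-elim)
open import Relation.Nullary using (¬_; _→-dec_; Dec; yes; no; does; _×-dec_; _⊎-dec_; ¬?)
open import Relation.Nullary.Decidable using (dec-true)
open import Relation.Binary.PropositionalEquality
open import Relation.Binary.Definitions using (tri<; tri≈; tri>)
open import Function using (_∘_; id; case_of_)

-- Counting over finite types

-- Everything is counted in ordered tuples: binomial coefficients become falling factorials, and an
-- edge is counted r! times. Large sunflowers are never formed. An embedding only asks for one edge
-- through a kernel that escapes the v vertices of a partial image, so richness is stated in exactly
-- this form, and cleaning a family until v vertices can be escaped costs the recurring factor 2v.
-- The obstacle is that the target has no error term. The edges outside L on which a star cannot be
-- continued must be outweighed by absent tuples through L, so both are measured by the same
-- quantity, the number q of poor pairs. Vertices of high Q-degree number O(q/n); joining them to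
-- everything changes q by a constant factor only and makes every pair left unjoined fit for greedy
-- continuation. The constants follow: N₂ = 4v lets v vertices spoil at most n/4 candidates, N₃ is
-- the product of the factors lost in comparing cliques with absent tuples, and N′ is the sparseness
-- of poor pairs that both demand. A single L exists because a list of t centres contained in at
-- most t centres tied to a pair must equal them; equality is then passed from pair to pair.

opaque
  𝟙 : {P : Set} → Dec P → ℕ
  𝟙 d = if does d then 1 else 0

  𝟙-yes : {P : Set} (d : Dec P) → P → 𝟙 d ≡ 1
  𝟙-yes (yes _) _ = refl
  𝟙-yes (no ¬p) p = ⊥-elim (¬p p)

  𝟙-no : {P : Set} (d : Dec P) → ¬ P → 𝟙 d ≡ 0
  𝟙-no (yes p) ¬p = ⊥-elim (¬p p)
  𝟙-no (no _)  _  = refl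

𝟙≤ : {P : Set} (d : Dec P) {x : ℕ} → (P → 1 ≤ x) → 𝟙 d ≤ x
𝟙≤ d@(yes p) h = ≤-trans (≤-reflexive (𝟙-yes d p)) (h p)
𝟙≤ d@(no ¬p) h = ≤-trans (≤-reflexive (𝟙-no d ¬p)) z≤n

𝟙≤1 : {P : Set} (d : Dec P) → 𝟙 d ≤ 1
𝟙≤1 d = 𝟙≤ d (λ _ → ≤-refl)

𝟙*≤ : {P : Set} (d : Dec P) {x y : ℕ} → (P → x ≤ y) → 𝟙 d * x ≤ y
𝟙*≤ d@(yes p) {x} h rewrite 𝟙-yes d p = ≤-trans (≤-reflexive (+-identityʳ x)) (h p)
𝟙*≤ d@(no ¬p) h rewrite 𝟙-no d ¬p = z≤n

𝟙-pos : {P : Set} (d : Dec P) → 1 ≤ 𝟙 d → P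
𝟙-pos (yes p) _ = p
𝟙-pos d@(no ¬p) h rewrite 𝟙-no d ¬p with () ← h

𝟙-mono : {P Q : Set} (d : Dec P) (d′ : Dec Q) → (P → Q) → 𝟙 d ≤ 𝟙 d′
𝟙-mono d d′ f = 𝟙≤ d (λ p → ≤-reflexive (sym (𝟙-yes d′ (f p))))

𝟙-≡ : {P Q : Set} (d : Dec P) (d′ : Dec Q) → (P → Q) → (Q → P) → 𝟙 d ≡ 𝟙 d′
𝟙-≡ d d′ f g = ≤-antisym (𝟙-mono d d′ f) (𝟙-mono d′ d g)

opaque
  unfolding 𝟙
  𝟙-× : {P Q : Set} (d : Dec P) (d′ : Dec Q) → 𝟙 (d ×-dec d′) ≡ 𝟙 d * 𝟙 d′
  𝟙-× (yes _) (yes _) = refl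
  𝟙-× (yes _) (no _)  = refl
  𝟙-× (no _)  _       = refl

  𝟙-¬ : {P Q : Set} (d : Dec P) (d′ : Dec Q) → 𝟙 d ≡ 𝟙 (d ×-dec d′) + 𝟙 (d ×-dec ¬? d′)
  𝟙-¬ (yes _) (yes _) = refl
  𝟙-¬ (yes _) (no _)  = refl
  𝟙-¬ (no _)  _       = refl

∑ˡ : {A : Set} → List A → (A → ℕ) → ℕ
∑ˡ []       f = 0
∑ˡ (x ∷ xs) f = f x + ∑ˡ xs f

module _ {A : Set} where

  ∑ˡ-mono : ∀ xs {f g : A → ℕ} → (∀ x → f x ≤ g x) → ∑ˡ xs f ≤ ∑ˡ xs g
  ∑ˡ-mono []       h = z≤n
  ∑ˡ-mono (x ∷ xs) h = +-mono-≤ (h x) (∑ˡ-mono xs h)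

  ∑ˡ-+ : ∀ xs (f g : A → ℕ) → ∑ˡ xs (λ x → f x + g x) ≡ ∑ˡ xs f + ∑ˡ xs g
  ∑ˡ-+ []       f g = refl
  ∑ˡ-+ (x ∷ xs) f g rewrite ∑ˡ-+ xs f g = +-swap (f x) (g x) (∑ˡ xs f) (∑ˡ xs g)
    where
    +-swap : ∀ a b c d → (a + b) + (c + d) ≡ (a + c) + (b + d)
    +-swap a b c d rewrite +-assoc a b (c + d) | +-assoc a c (b + d)
      | sym (+-assoc b c d) | +-comm b c | +-assoc c b d = refl

  ∑ˡ-* : ∀ xs c (f : A → ℕ) → ∑ˡ xs (λ x → c * f x) ≡ c * ∑ˡ xs f
  ∑ˡ-* []       c f = sym (*-zeroʳ c)
  ∑ˡ-* (x ∷ xs) c f rewrite ∑ˡ-* xs c f = sym (*-distribˡ-+ c (f x) (∑ˡ xs f))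

  ∑ˡ-++ : ∀ xs ys (f : A → ℕ) → ∑ˡ (xs ++ ys) f ≡ ∑ˡ xs f + ∑ˡ ys f
  ∑ˡ-++ []       ys f = refl
  ∑ˡ-++ (x ∷ xs) ys f rewrite ∑ˡ-++ xs ys f = sym (+-assoc (f x) _ _)

  ∑ˡ-pos : ∀ xs (f : A → ℕ) → 1 ≤ ∑ˡ xs f → ∃ λ x → 1 ≤ f x
  ∑ˡ-pos (x ∷ xs) f h with f x in eq
  ... | suc k = x , subst (1 ≤_) (sym eq) (s≤s z≤n)
  ... | zero  = ∑ˡ-pos xs f h

∑ˡ-cong : ∀ {A : Set} (xs : List A) {f g} → (∀ x → f x ≡ g x) → ∑ˡ xs f ≡ ∑ˡ xs g
∑ˡ-cong xs h = ≤-antisym (∑ˡ-mono xs (≤-reflexive ∘ h)) (∑ˡ-mono xs (≤-reflexive ∘ sym ∘ h))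

∑ˡ-0 : ∀ {A : Set} (xs : List A) → ∑ˡ xs (λ _ → 0) ≡ 0
∑ˡ-0 xs = ∑ˡ-* xs 0 (λ _ → 0)

∑ˡ-swap : ∀ {A B : Set} (xs : List A) (ys : List B) (f : A → B → ℕ) →
          ∑ˡ xs (λ x → ∑ˡ ys (f x)) ≡ ∑ˡ ys (λ y → ∑ˡ xs (λ x → f x y))
∑ˡ-swap []       ys f = sym (∑ˡ-0 ys)
∑ˡ-swap (x ∷ xs) ys f rewrite ∑ˡ-swap xs ys f = sym (∑ˡ-+ ys (f x) _)

∑ˡ-map : ∀ {A B : Set} (xs : List A) (g : A → B) (f : B → ℕ) → ∑ˡ (map g xs) f ≡ ∑ˡ xs (f ∘ g)
∑ˡ-map []       g f = refl
∑ˡ-map (x ∷ xs) g f = cong (f (g x) +_) (∑ˡ-map xs g f)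

∑ˡ-concatMap : ∀ {A B : Set} (xs : List A) (g : A → List B) (f : B → ℕ) →
               ∑ˡ (concatMap g xs) f ≡ ∑ˡ xs (λ x → ∑ˡ (g x) f)
∑ˡ-concatMap []       g f = refl
∑ˡ-concatMap (x ∷ xs) g f =
  trans (∑ˡ-++ (g x) (concatMap g xs) f) (cong (∑ˡ (g x) f +_) (∑ˡ-concatMap xs g f))

-- The single equation `once` says both that every element is listed and that none is listed twice.
-- Being a sum of indicators, it can be inserted into any count.
record Enum (A : Set) : Set where
  field
    elements : List A
    _≟ᴱ_     : (x y : A) → Dec (x ≡ y)
    once     : ∀ x → ∑ˡ elements (λ y → 𝟙 (x ≟ᴱ y)) ≡ 1

open Enum ⦃ ... ⦄ public

opaque
  ∑ : {A : Set} ⦃ _ : Enum A ⦄ → (A → ℕ) → ℕ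
  ∑ f = ∑ˡ elements f

opaque
  unfolding ∑

  ∑-mono : {A : Set} ⦃ _ : Enum A ⦄ {f g : A → ℕ} → (∀ x → f x ≤ g x) → ∑ f ≤ ∑ g
  ∑-mono = ∑ˡ-mono elements

  ∑-cong : {A : Set} ⦃ _ : Enum A ⦄ {f g : A → ℕ} → (∀ x → f x ≡ g x) → ∑ f ≡ ∑ g
  ∑-cong = ∑ˡ-cong elements

  ∑-+ : {A : Set} ⦃ _ : Enum A ⦄ (f g : A → ℕ) → ∑ (λ x → f x + g x) ≡ ∑ f + ∑ g
  ∑-+ = ∑ˡ-+ elements

  ∑-* : {A : Set} ⦃ _ : Enum A ⦄ (c : ℕ) (f : A → ℕ) → ∑ (λ x → c * f x) ≡ c * ∑ f
  ∑-* = ∑ˡ-* elements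

  ∑-pos : {A : Set} ⦃ _ : Enum A ⦄ (f : A → ℕ) → 1 ≤ ∑ f → ∃ λ x → 1 ≤ f x
  ∑-pos = ∑ˡ-pos elements

  ∑-swap : {A B : Set} ⦃ _ : Enum A ⦄ ⦃ _ : Enum B ⦄ (f : A → B → ℕ) →
           ∑ (λ x → ∑ (f x)) ≡ ∑ (λ y → ∑ (λ x → f x y))
  ∑-swap = ∑ˡ-swap elements elements

  ∑-once : {A : Set} ⦃ _ : Enum A ⦄ (x : A) → ∑ (λ y → 𝟙 (x ≟ᴱ y)) ≡ 1
  ∑-once = once

# : {A : Set} ⦃ _ : Enum A ⦄ → {P : A → Set} → (∀ x → Dec (P x)) → ℕ
# P? = ∑ (λ x → 𝟙 (P? x))

size : (A : Set) → ⦃ _ : Enum A ⦄ → ℕ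
size A = ∑ {A} (λ _ → 1)

module _ {A : Set} ⦃ _ : Enum A ⦄ where

  ∑-0 : ∑ {A} (λ _ → 0) ≡ 0
  ∑-0 = ∑-* {A} 0 (λ _ → 0)

  ∑-*ʳ : (f : A → ℕ) (c : ℕ) → ∑ (λ x → f x * c) ≡ ∑ f * c
  ∑-*ʳ f c = trans (∑-cong (λ x → *-comm (f x) c)) (trans (∑-* c f) (*-comm c _))

  ∑-const : (c : ℕ) → ∑ {A} (λ _ → c) ≡ size A * c
  ∑-const c = trans (∑-cong (λ _ → sym (+-identityʳ c))) (∑-*ʳ (λ _ → 1) c)

  ∑-bound : {f : A → ℕ} (c : ℕ) → (∀ x → f x ≤ c) → ∑ f ≤ size A * c
  ∑-bound c h = ≤-trans (∑-mono h) (≤-reflexive (∑-const c))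

  ∑-≥ : (f : A → ℕ) (x : A) → f x ≤ ∑ f
  ∑-≥ f x = begin
    f x                              ≡⟨ *-identityˡ (f x) ⟨
    1 * f x                          ≡⟨ cong (_* f x) (∑-once x) ⟨
    ∑ (λ y → 𝟙 (x ≟ᴱ y)) * f x       ≡⟨ ∑-*ʳ (λ y → 𝟙 (x ≟ᴱ y)) (f x) ⟨
    ∑ (λ y → 𝟙 (x ≟ᴱ y) * f x)       ≤⟨ ∑-mono (λ y → 𝟙*≤ (x ≟ᴱ y) λ { refl → ≤-refl }) ⟩
    ∑ f                              ∎
    where open ≤-Reasoning

  module _ {P : A → Set} (P? : ∀ x → Dec (P x)) where

    #-pos : 1 ≤ # P? → ∃ P
    #-pos h with ∑-pos (λ x → 𝟙 (P? x)) h
    ... | x , q = x , 𝟙-pos (P? x) q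

    pos-# : ∀ x → P x → 1 ≤ # P?
    pos-# x p = ≤-trans (≤-reflexive (sym (𝟙-yes (P? x) p))) (∑-≥ (λ y → 𝟙 (P? y)) x)

    opaque
      ∃? : Dec (∃ P)
      ∃? with 1 ≤? # P?
      ... | yes q = yes (#-pos q)
      ... | no ¬q = no λ { (x , p) → ¬q (pos-# x p) }

    #-none : (∀ x → ¬ P x) → # P? ≡ 0
    #-none h = trans (∑-cong (λ x → 𝟙-no (P? x) (h x))) ∑-0

    #≤size : # P? ≤ size A
    #≤size = ∑-mono (λ x → 𝟙≤1 (P? x))

    #-all : (∀ x → P x) → # P? ≡ size A
    #-all h = ∑-cong (λ x → 𝟙-yes (P? x) (h x))

  #-mono : {P Q : A → Set} (P? : ∀ x → Dec (P x)) (Q? : ∀ x → Dec (Q x)) →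
           (∀ x → P x → Q x) → # P? ≤ # Q?
  #-mono P? Q? h = ∑-mono (λ x → 𝟙-mono (P? x) (Q? x) (h x))

  #-cong : {P Q : A → Set} (P? : ∀ x → Dec (P x)) (Q? : ∀ x → Dec (Q x)) →
           (∀ x → P x → Q x) → (∀ x → Q x → P x) → # P? ≡ # Q?
  #-cong P? Q? h k = ≤-antisym (#-mono P? Q? h) (#-mono Q? P? k)

  #≤1 : {P : A → Set} (P? : ∀ x → Dec (P x)) → (∀ x y → P x → P y → x ≡ y) → # P? ≤ 1
  #≤1 P? u with ∃? P?
  ... | yes (x , p) = ≤-trans (#-mono P? (x ≟ᴱ_) (λ y q → u x y p q)) (≤-reflexive (∑-once x))
  ... | no ¬p       = ≤-trans (≤-reflexive (#-none P? (λ x p → ¬p (x , p)))) z≤n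

  #-split : {P Q : A → Set} (P? : ∀ x → Dec (P x)) (Q? : ∀ x → Dec (Q x)) →
            # P? ≡ # (λ x → P? x ×-dec Q? x) + # (λ x → P? x ×-dec ¬? (Q? x))
  #-split P? Q? = trans (∑-cong (λ x → 𝟙-¬ (P? x) (Q? x))) (∑-+ _ _)

  #-⊎ : {P Q R : A → Set} (P? : ∀ x → Dec (P x)) (Q? : ∀ x → Dec (Q x)) (R? : ∀ x → Dec (R x)) →
        (∀ x → P x → Q x ⊎ R x) → # P? ≤ # Q? + # R?
  #-⊎ P? Q? R? h = ≤-trans (∑-mono λ x → 𝟙≤ (P? x) (k x ∘ h x)) (≤-reflexive (∑-+ _ _))
    where
    k : ∀ x → _ → 1 ≤ 𝟙 (Q? x) + 𝟙 (R? x)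
    k x (inj₁ q) = ≤-trans (≤-reflexive (sym (𝟙-yes (Q? x) q))) (m≤m+n _ _)
    k x (inj₂ q) = ≤-trans (≤-reflexive (sym (𝟙-yes (R? x) q))) (m≤n+m _ _)

  opaque
    -- If the bound failed everywhere, summing the strict inequalities would put `size A * ∑ f`
    -- strictly below itself; the given element makes the size positive.
    average : (f : A → ℕ) → A → ∃ λ x → size A * f x ≤ ∑ f
    average f x₀ with ∃? (λ x → size A * f x ≤? ∑ f)
    ... | yes p = p
    ... | no ¬p = ⊥-elim (<-irrefl refl (begin-strict
        size A * ∑ f             ≡⟨ ∑-const (∑ f) ⟨
        ∑ {A} (λ _ → ∑ f)        <⟨ +-cancelˡ-≤ (size A) _ _ (begin
           size A + suc (∑ {A} (λ _ → ∑ f)) ≤⟨ +-monoʳ-≤ (size A) (+-monoˡ-≤ _ (∑-≥ (λ _ → 1) x₀)) ⟩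
           size A + (size A + ∑ {A} (λ _ → ∑ f)) ≡⟨ cong (size A +_) (∑-+ (λ _ → 1) (λ _ → ∑ f)) ⟨
           size A + ∑ {A} (λ _ → suc (∑ f)) ≤⟨ +-monoʳ-≤ (size A) (∑-mono (λ x → ≰⇒> (λ q → ¬p (x , q)))) ⟩
           size A + ∑ (λ x → size A * f x) ∎) ⟩
        ∑ (λ x → size A * f x)   ≡⟨ ∑-* (size A) f ⟩
        size A * ∑ f             ∎))
      where open ≤-Reasoning

opaque
  ∀? : {A : Set} ⦃ _ : Enum A ⦄ {P : A → Set} (P? : ∀ x → Dec (P x)) → Dec (∀ x → P x)
  ∀? P? with ∃? (λ x → ¬? (P? x))
  ... | yes (x , ¬p) = no λ h → ¬p (h x)
  ... | no h = yes λ x → case P? x of λ { (yes p) → p ; (no ¬p) → ⊥-elim (h (x , ¬p)) }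

#-∃ : {A B : Set} ⦃ _ : Enum A ⦄ ⦃ _ : Enum B ⦄ {P : A → Set} {R : A → B → Set}
      (P? : ∀ x → Dec (P x)) (R? : ∀ x y → Dec (R x y)) →
      (∀ x → P x → ∃ λ y → R x y) → # P? ≤ ∑ (λ y → # (λ x → R? x y))
#-∃ P? R? h = ≤-trans
  (∑-mono λ x → 𝟙≤ (P? x) λ p → pos-# (R? x) (proj₁ (h x p)) (proj₂ (h x p)))
  (≤-reflexive (∑-swap (λ x y → 𝟙 (R? x y))))

#-fiber : {A B : Set} ⦃ _ : Enum A ⦄ ⦃ _ : Enum B ⦄ {P : A → Set} (P? : ∀ x → Dec (P x)) (f : A → B) →
          # P? ≡ ∑ (λ y → # (λ x → P? x ×-dec (f x ≟ᴱ y)))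
#-fiber P? f = trans (∑-cong λ x → begin
    𝟙 (P? x)                                ≡⟨ *-identityʳ _ ⟨
    𝟙 (P? x) * 1                            ≡⟨ cong (𝟙 (P? x) *_) (∑-once (f x)) ⟨
    𝟙 (P? x) * # (f x ≟ᴱ_)                  ≡⟨ ∑-* (𝟙 (P? x)) (λ y → 𝟙 (f x ≟ᴱ y)) ⟨
    ∑ (λ y → 𝟙 (P? x) * 𝟙 (f x ≟ᴱ y))       ≡⟨ ∑-cong (λ y → 𝟙-× (P? x) (f x ≟ᴱ y)) ⟨
    # (λ y → P? x ×-dec (f x ≟ᴱ y))         ∎)
  (∑-swap (λ x y → 𝟙 (P? x ×-dec (f x ≟ᴱ y))))
  where open ≡-Reasoning

#-inj : {A B : Set} ⦃ _ : Enum A ⦄ ⦃ _ : Enum B ⦄ {P : A → Set} {Q : B → Set}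
        (P? : ∀ x → Dec (P x)) (Q? : ∀ y → Dec (Q y)) (f : A → B) →
        (∀ x → P x → Q (f x)) → (∀ x x′ → P x → P x′ → f x ≡ f x′ → x ≡ x′) → # P? ≤ # Q?
#-inj P? Q? f into inj = begin
  # P?                                          ≡⟨ #-fiber P? f ⟩
  ∑ (λ y → # (λ x → P? x ×-dec (f x ≟ᴱ y)))     ≤⟨ ∑-mono fib ⟩
  # Q?                                          ∎
  where
  open ≤-Reasoning
  fib : ∀ y → # (λ x → P? x ×-dec (f x ≟ᴱ y)) ≤ 𝟙 (Q? y)
  fib y with Q? y
  ... | d@(yes q) = ≤-trans
    (#≤1 _ λ { x x′ (p , e) (p′ , e′) → inj x x′ p p′ (trans e (sym e′)) })
    (≤-reflexive (sym (𝟙-yes d q)))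
  ... | no ¬q = ≤-trans (≤-reflexive (#-none _ λ { x (p , refl) → ¬q (into x p) })) z≤n

-- Enumerations of `Fin` and `Vec`

private
  opaque
    finElements : ∀ n → List (Fin n)
    finElements zero    = []
    finElements (suc n) = fzero ∷ map fsuc (finElements n)

    vecElements : ∀ n k → List (Vec (Fin n) k)
    vecElements n zero    = [] ∷ []
    vecElements n (suc k) = concatMap (λ x → map (x ∷_) (vecElements n k)) (finElements n)

  opaque
    unfolding 𝟙 finElements vecElements
    ∑ˡ-vec : ∀ n k (f : Vec (Fin n) (suc k) → ℕ) →
             ∑ˡ (vecElements n (suc k)) f ≡ ∑ˡ (finElements n) (λ x → ∑ˡ (vecElements n k) (λ xs → f (x ∷ xs)))
    ∑ˡ-vec n k f = trans (∑ˡ-concatMap (finElements n) _ f)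
      (∑ˡ-cong (finElements n) (λ x → ∑ˡ-map (vecElements n k) (x ∷_) f))

    finOnce : ∀ n (x : Fin n) → ∑ˡ (finElements n) (λ y → 𝟙 (x Fin.≟ y)) ≡ 1
    finOnce (suc n) fzero = cong suc
      (trans (∑ˡ-map (finElements n) fsuc _) (∑ˡ-0 (finElements n)))
    finOnce (suc n) (fsuc x) =
      trans (∑ˡ-map (finElements n) fsuc _) (finOnce n x)

    vecOnce : ∀ n k (xs : Vec (Fin n) k) → ∑ˡ (vecElements n k) (λ ys → 𝟙 (Vec.≡-dec Fin._≟_ xs ys)) ≡ 1
    vecOnce n zero    []       = refl
    vecOnce n (suc k) (x ∷ xs) = trans (∑ˡ-vec n k _) (trans
      (∑ˡ-cong (finElements n) (λ y → trans
        (∑ˡ-cong (vecElements n k) (λ ys → trans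
           (𝟙-≡ (Vec.≡-dec Fin._≟_ (x ∷ xs) (y ∷ ys)) ((x Fin.≟ y) ×-dec Vec.≡-dec Fin._≟_ xs ys)
             (λ { refl → refl , refl }) (λ { (refl , refl) → refl }))
           (𝟙-× (x Fin.≟ y) (Vec.≡-dec Fin._≟_ xs ys))))
        (trans (∑ˡ-* (vecElements n k) (𝟙 (x Fin.≟ y)) _)
           (trans (cong (𝟙 (x Fin.≟ y) *_) (vecOnce n k xs)) (*-identityʳ _)))))
      (finOnce n x))

instance
  Enum-Fin : ∀ {n} → Enum (Fin n)
  Enum-Fin {n} = record { elements = finElements n ; _≟ᴱ_ = Fin._≟_ ; once = finOnce n }

  Enum-Vec : ∀ {n k} → Enum (Vec (Fin n) k)
  Enum-Vec {n} {k} = record { elements = vecElements n k ; _≟ᴱ_ = Vec.≡-dec Fin._≟_ ; once = vecOnce n k }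

opaque
  unfolding ∑ finElements vecElements

  ∑-suc : ∀ {n} (f : Fin (suc n) → ℕ) → ∑ f ≡ f fzero + ∑ (λ x → f (fsuc x))
  ∑-suc {n} f = cong (f fzero +_) (∑ˡ-map (finElements n) fsuc f)

  ∑-∷ : ∀ {n k} (f : Vec (Fin n) (suc k) → ℕ) → ∑ f ≡ ∑ (λ x → ∑ (λ xs → f (x ∷ xs)))
  ∑-∷ {n} {k} = ∑ˡ-vec n k

  ∑-[] : ∀ {n} (f : Vec (Fin n) 0 → ℕ) → ∑ f ≡ f []
  ∑-[] f = +-identityʳ (f [])

  ∑-Fin0 : (f : Fin 0 → ℕ) → ∑ f ≡ 0
  ∑-Fin0 f = refl

size-Fin : ∀ n → size (Fin n) ≡ n
size-Fin zero    = ∑-Fin0 (λ _ → 1)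
size-Fin (suc n) = trans (∑-suc {n} (λ _ → 1)) (cong suc (size-Fin n))

size-Vec : ∀ n k → size (Vec (Fin n) k) ≡ n ^ k
size-Vec n zero    = ∑-[] {n} (λ _ → 1)
size-Vec n (suc k) = trans (∑-∷ {n} {k} (λ _ → 1))
  (trans (∑-const (size (Vec (Fin n) k))) (cong₂ _*_ (size-Fin n) (size-Vec n k)))

does⇒ : {P : Set} (d : Dec P) → does d ≡ true → P
does⇒ (yes p) _ = p

⇒does : {P : Set} (d : Dec P) → P → does d ≡ true
⇒does = dec-true

-- Injections and their extensions

InjOn : {A B : Set} → (A → Set) → (A → B) → Set
InjOn P f = ∀ x y → P x → P y → f x ≡ f y → x ≡ y

module _ {A : Set} ⦃ _ : Enum A ⦄ where

  #-remove : {P : A → Set} (P? : ∀ x → Dec (P x)) (y : A) → P y →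
             # P? ≡ suc (# (λ x → P? x ×-dec ¬? (x ≟ᴱ y)))
  #-remove P? y p = trans (#-split P? (_≟ᴱ y)) (cong (_+ # (λ x → P? x ×-dec ¬? (x ≟ᴱ y)))
    (≤-antisym (#≤1 _ λ { x x′ (_ , e) (_ , e′) → trans e (sym e′) }) (pos-# _ y (p , refl))))

  #-⊆-≡ : {P Q : A → Set} (P? : ∀ x → Dec (P x)) (Q? : ∀ x → Dec (Q x)) →
          (∀ x → P x → Q x) → # Q? ≤ # P? → ∀ x → Q x → P x
  #-⊆-≡ P? Q? h le x q with P? x
  ... | yes p = p
  ... | no ¬p = ⊥-elim (<-irrefl refl (≤-trans (s≤s (#-mono P? (λ z → Q? z ×-dec ¬? (z ≟ᴱ x))
                  λ z p → h z p , λ { refl → ¬p p }))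
                  (≤-trans (≤-reflexive (sym (#-remove Q? x q))) le)))

module _ {A B : Set} ⦃ _ : Enum A ⦄ ⦃ _ : Enum B ⦄ where

  opaque
    missed : {P : A → Set} {Q : B → Set} (P? : ∀ x → Dec (P x)) (Q? : ∀ y → Dec (Q y)) (f : A → B) →
             # P? < # Q? → ∃ λ y → Q y × (∀ x → P x → f x ≢ y)
    missed {P} {Q} P? Q? f lt with ∃? (λ y → Q? y ×-dec ¬? (∃? (λ x → P? x ×-dec (f x ≟ᴱ y))))
    ... | yes (y , q , h) = y , q , λ x p e → h (x , p , e)
    ... | no h = ⊥-elim (<⇒≱ lt (≤-trans (#-∃ Q? (λ y x → P? x ×-dec (f x ≟ᴱ y)) hit)
          (∑-mono λ x → fib x)))
      where
      hit : ∀ y → Q y → ∃ λ x → P x × f x ≡ y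
      hit y q with ∃? (λ x → P? x ×-dec (f x ≟ᴱ y))
      ... | yes r = r
      ... | no ¬r = ⊥-elim (h (y , q , ¬r))
      fib : ∀ x → # (λ y → P? x ×-dec (f x ≟ᴱ y)) ≤ 𝟙 (P? x)
      fib x with P? x
      ... | d@(yes p) = ≤-trans (#≤1 _ λ { y y′ (_ , e) (_ , e′) → trans (sym e) e′ })
                          (≤-reflexive (sym (𝟙-yes d p)))
      ... | no ¬p = ≤-trans (≤-reflexive (#-none _ λ { y (p , _) → ¬p p })) z≤n

    injective⇒surjective : {P : A → Set} {Q : B → Set} (P? : ∀ x → Dec (P x)) (Q? : ∀ y → Dec (Q y))
      (f : A → B) → (∀ x → P x → Q (f x)) → InjOn P f → # Q? ≤ # P? →
      ∀ y → Q y → ∃ λ x → P x × f x ≡ y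
    injective⇒surjective P? Q? f into inj le y q with ∃? (λ x → P? x ×-dec (f x ≟ᴱ y))
    ... | yes r = r
    ... | no ¬r = ⊥-elim (<-irrefl refl (≤-trans
          (s≤s (#-inj P? (λ z → Q? z ×-dec ¬? (z ≟ᴱ y)) f (λ x p → into x p , λ e → ¬r (x , p , e)) inj))
          (≤-trans (≤-reflexive (sym (#-remove Q? y q))) le)))

  _[_↦_] : (A → B) → A → B → A → B
  (φ [ z ↦ u ]) x with x ≟ᴱ z
  ... | yes _ = u
  ... | no  _ = φ x

  upd-same : (φ : A → B) (z : A) (u : B) → (φ [ z ↦ u ]) z ≡ u
  upd-same φ z u with z ≟ᴱ z
  ... | yes _ = refl
  ... | no ¬p = ⊥-elim (¬p refl)

  upd-other : (φ : A → B) (z : A) (u : B) {x : A} → x ≢ z → (φ [ z ↦ u ]) x ≡ φ x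
  upd-other φ z u {x} h with x ≟ᴱ z
  ... | yes p = ⊥-elim (h p)
  ... | no  _ = refl

  extend-by-one : {U : A → Set} (φ : A → B) (z : A) (u : B) → InjOn U φ → ¬ U z →
    (∀ x → U x → φ x ≢ u) →
    ∃ λ φ′ → (∀ x → U x → φ′ x ≡ φ x) × φ′ z ≡ u × InjOn (λ x → U x ⊎ x ≡ z) φ′
  extend-by-one {U} φ z u inj ¬Uz avoid = φ′ , old , new , inj′
    where
    φ′ : A → B
    φ′ = φ [ z ↦ u ]
    old : ∀ x → U x → φ′ x ≡ φ x
    old x p = upd-other φ z u λ { refl → ¬Uz p }
    new : φ′ z ≡ u
    new = upd-same φ z u
    inj′ : InjOn (λ x → U x ⊎ x ≡ z) φ′
    inj′ x y (inj₁ p) (inj₁ q) e = inj x y p q (trans (sym (old x p)) (trans e (old y q)))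
    inj′ x y (inj₁ p) (inj₂ refl) e = ⊥-elim (avoid x p (trans (sym (old x p)) (trans e new)))
    inj′ x y (inj₂ refl) (inj₁ q) e = ⊥-elim (avoid y q (trans (sym (old y q)) (trans (sym e) new)))
    inj′ x y (inj₂ refl) (inj₂ refl) e = refl

  opaque
    -- The last hypothesis says that the places of `Q` already taken are taken by members of `E`.
    -- Since `E` is no larger than `Q`, a member of `E` not yet placed always finds a place of `Q`
    -- that is free.
    extend : {U E : A → Set} {Q : B → Set}
      (U? : ∀ x → Dec (U x)) (E? : ∀ x → Dec (E x)) (Q? : ∀ y → Dec (Q y)) (φ : A → B) →
      # E? ≤ # Q? → InjOn U φ → (∀ x → E x → U x → Q (φ x)) → (∀ x → U x → Q (φ x) → E x) →
      ∃ λ φ′ → (∀ x → U x → φ′ x ≡ φ x) × InjOn (λ x → U x ⊎ E x) φ′ × (∀ x → E x → Q (φ′ x))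
    extend {U₀} {E} {Q} U₀? E? Q? φ₀ le = go _ U₀? φ₀ ≤-refl
      where
      go : ∀ k {U : A → Set} (U? : ∀ x → Dec (U x)) (φ : A → B) →
        # (λ x → E? x ×-dec ¬? (U? x)) ≤ k →
        InjOn U φ → (∀ x → E x → U x → Q (φ x)) → (∀ x → U x → Q (φ x) → E x) →
        ∃ λ φ′ → (∀ x → U x → φ′ x ≡ φ x) × InjOn (λ x → U x ⊎ E x) φ′ × (∀ x → E x → Q (φ′ x))
      go k {U} U? φ bound inj into back with ∃? (λ x → E? x ×-dec ¬? (U? x))
      ... | no none = φ , (λ _ _ → refl) , (λ x y p q → inj x y (U-all p) (U-all q)) , (λ x e → into x e (E⊆U x e))
        where
        E⊆U : ∀ x → E x → U x
        E⊆U x e with U? x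
        ... | yes u = u
        ... | no ¬u = ⊥-elim (none (x , e , ¬u))
        U-all : ∀ {x} → U x ⊎ E x → U x
        U-all (inj₁ u) = u
        U-all (inj₂ e) = E⊆U _ e
      go zero U? φ bound inj into back | yes (z , e , ¬u) =
        ⊥-elim (<⇒≱ (pos-# (λ x → E? x ×-dec ¬? (U? x)) z (e , ¬u)) bound)
      go (suc k) {U} U? φ bound inj into back | yes (z , e , ¬u)
        with missed (λ x → E? x ×-dec U? x) Q? φ
               (≤-trans (≤-trans (≤-trans (≤-reflexive (+-comm 1 _))
                 (+-monoʳ-≤ (# (λ x → E? x ×-dec U? x)) (pos-# (λ x → E? x ×-dec ¬? (U? x)) z (e , ¬u))))
                 (≤-reflexive (sym (#-split E? U?)))) le)
      ... | y , q , fresh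
        with extend-by-one φ z y inj ¬u (λ x u eq → fresh x (back x u (subst Q (sym eq) q) , u) eq)
      ... | φ₁ , old₁ , new₁ , inj₁′
        with go k {λ x → U x ⊎ x ≡ z} (λ x → U? x ⊎-dec (x ≟ᴱ z)) φ₁
               (≤-pred (≤-trans (≤-trans (s≤s (#-mono _ _ λ { x (p , h) → (p , h ∘ inj₁) , h ∘ inj₂ }))
                  (≤-reflexive (sym (#-remove (λ x → E? x ×-dec ¬? (U? x)) z (e , ¬u))))) bound))
               inj₁′
               (λ { x p (inj₁ u) → subst Q (sym (old₁ x u)) (into x p u)
                  ; x p (inj₂ refl) → subst Q (sym new₁) q })
               (λ { x (inj₁ u) h → back x u (subst Q (old₁ x u) h) ; x (inj₂ refl) _ → e })
      ... | φ₂ , old₂ , inj₂′ , into₂ = φ₂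
          , (λ x u → trans (old₂ x (inj₁ u)) (old₁ x u))
          , (λ x y p q → inj₂′ x y (weaken p) (weaken q)) , into₂
        where
        weaken : ∀ {x} → U x ⊎ E x → (U x ⊎ x ≡ z) ⊎ E x
        weaken (inj₁ u) = inj₁ (inj₁ u)
        weaken (inj₂ p) = inj₂ p

    injection : {P : A → Set} {Q : B → Set} (P? : ∀ x → Dec (P x)) (Q? : ∀ y → Dec (Q y)) → (A → B) →
      # P? ≤ # Q? → ∃ λ f → InjOn P f × (∀ x → P x → Q (f x))
    injection P? Q? f₀ le with extend {λ _ → ⊥} (λ _ → no λ ()) P? Q? f₀ le (λ _ _ ()) (λ _ _ ()) (λ _ ())
    ... | f , _ , inj , into = f , (λ x y p q → inj x y (inj₂ p) (inj₂ q)) , into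

#-full : ∀ {n} → # {A = Fin n} (λ _ → yes tt) ≡ n
#-full {n} = trans (#-all {A = Fin n} (λ _ → yes tt) (λ _ → tt)) (size-Fin n)

fresh : ∀ {n k} → k < n → (Z : Vec (Fin n) k) → ∃ λ x → ∀ q → lookup Z q ≢ x
fresh {n} {k} lt Z with missed {A = Fin k} (λ _ → yes tt) (λ _ → yes tt) (lookup Z)
  (subst₂ _<_ (sym #-full) (sym #-full) lt)
... | x , _ , h = x , λ q → h q tt

-- Tuples with distinct entries

opaque
  -- The falling factorial q (q - 1) ... (q - k + 1). Truncated subtraction makes it 0 for q < k,
  -- and `ff k k` is k!.
  ff : ℕ → ℕ → ℕ
  ff q zero    = 1
  ff q (suc k) = q * ff (q ∸ 1) k

  ff-zero : ∀ q → ff q 0 ≡ 1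
  ff-zero q = refl

  ff-suc : ∀ q k → ff q (suc k) ≡ q * ff (q ∸ 1) k
  ff-suc q k = refl

-- The predicate loses each chosen entry along the vector, so membership and distinctness form one
-- recursion, the same as that of `ff`.
Emb : ∀ {n k} → (Fin n → Set) → Vec (Fin n) k → Set
Emb P []       = ⊤
Emb P (x ∷ xs) = P x × Emb (λ y → P y × y ≢ x) xs

opaque
  Emb? : ∀ {n k} {P : Fin n → Set} → (∀ x → Dec (P x)) → (e : Vec (Fin n) k) → Dec (Emb P e)
  Emb? P? []       = yes tt
  Emb? P? (x ∷ xs) = P? x ×-dec Emb? (λ y → P? y ×-dec ¬? (y ≟ᴱ x)) xs

Emb-mono : ∀ {n k} {P Q : Fin n → Set} (e : Vec (Fin n) k) → (∀ x → P x → Q x) → Emb P e → Emb Q e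
Emb-mono []       h p       = tt
Emb-mono (x ∷ xs) h (p , r) = h x p , Emb-mono xs (λ { y (a , b) → h y a , b }) r

Emb-∈ : ∀ {n k} {P : Fin n → Set} (e : Vec (Fin n) k) → Emb P e → ∀ i → P (lookup e i)
Emb-∈ (x ∷ xs) (p , r) fzero    = p
Emb-∈ (x ∷ xs) (p , r) (fsuc i) = proj₁ (Emb-∈ xs r i)

Emb-inj : ∀ {n k} {P : Fin n → Set} (e : Vec (Fin n) k) → Emb P e → ∀ i j → lookup e i ≡ lookup e j → i ≡ j
Emb-inj (x ∷ xs) (p , r) fzero    fzero    eq = refl
Emb-inj (x ∷ xs) (p , r) fzero    (fsuc j) eq = ⊥-elim (proj₂ (Emb-∈ xs r j) (sym eq))
Emb-inj (x ∷ xs) (p , r) (fsuc i) fzero    eq = ⊥-elim (proj₂ (Emb-∈ xs r i) eq)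
Emb-inj (x ∷ xs) (p , r) (fsuc i) (fsuc j) eq = cong fsuc (Emb-inj xs r i j eq)

opaque
  unfolding Emb?

  #-Emb : ∀ {n} k {P : Fin n → Set} (P? : ∀ x → Dec (P x)) → # (Emb? {k = k} P?) ≡ ff (# P?) k
  #-Emb zero P? = trans (∑-[] (λ e → 𝟙 (Emb? P? e))) (trans (𝟙-yes (yes tt) tt) (sym (ff-zero _)))
  #-Emb {n} (suc k) {P} P? = begin
    # (Emb? {k = suc k} P?)
      ≡⟨ ∑-∷ (λ e → 𝟙 (Emb? P? e)) ⟩
    ∑ (λ x → ∑ (λ xs → 𝟙 (P? x ×-dec Emb? {k = k} (λ y → P? y ×-dec ¬? (y ≟ᴱ x)) xs)))
      ≡⟨ ∑-cong (λ x → trans (∑-cong (λ xs → 𝟙-× (P? x) _)) (∑-* (𝟙 (P? x)) _)) ⟩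
    ∑ (λ x → 𝟙 (P? x) * # (Emb? {k = k} (λ y → P? y ×-dec ¬? (y ≟ᴱ x))))
      ≡⟨ ∑-cong step ⟩
    ∑ (λ x → 𝟙 (P? x) * ff (# P? ∸ 1) k)
      ≡⟨ ∑-*ʳ (λ x → 𝟙 (P? x)) _ ⟩
    # P? * ff (# P? ∸ 1) k
      ≡⟨ ff-suc (# P?) k ⟨
    ff (# P?) (suc k) ∎
    where
    open ≡-Reasoning
    step : ∀ x → 𝟙 (P? x) * # (Emb? {k = k} (λ y → P? y ×-dec ¬? (y ≟ᴱ x))) ≡ 𝟙 (P? x) * ff (# P? ∸ 1) k
    step x = by-cases (P? x)
      where
      by-cases : (d : Dec (P x)) → 𝟙 d * # (Emb? {k = k} (λ y → P? y ×-dec ¬? (y ≟ᴱ x))) ≡ 𝟙 d * ff (# P? ∸ 1) k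
      by-cases d@(yes p) = cong (𝟙 d *_) (trans (#-Emb k (λ y → P? y ×-dec ¬? (y ≟ᴱ x)))
        (cong (λ q → ff q k) (cong (_∸ 1) (sym (#-remove P? x p)))))
      by-cases d@(no ¬p) rewrite 𝟙-no d ¬p = refl

Emb-surj : ∀ {n r} {P : Fin n → Set} (P? : ∀ x → Dec (P x)) (e : Vec (Fin n) r) → Emb P e → # P? ≤ r →
           ∀ x → P x → ∃ λ i → lookup e i ≡ x
Emb-surj {n} {r} P? e emb le x p
  with injective⇒surjective {A = Fin r} (λ _ → yes tt) P? (lookup e) (λ i _ → Emb-∈ e emb i)
         (λ i j _ _ → Emb-inj e emb i j)
         (≤-trans le (≤-reflexive (sym #-full))) x p
... | i , _ , eq = i , eq

earlier-or-last : ∀ {k m} (k<m : k < m) (j : Fin m) → toℕ j < suc k → toℕ j < k ⊎ j ≡ fromℕ< k<m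
earlier-or-last k<m j lt with m≤n⇒m<n∨m≡n (≤-pred lt)
... | inj₁ l = inj₁ l
... | inj₂ e = inj₂ (Fin.toℕ-injective (trans e (sym (Fin.toℕ-fromℕ< k<m))))

-- Families, shadows and stable subfamilies

infix 4 _∈ᶠ_ _∈ᶠ?_ _⊆ᶠ_

_∈ᶠ_ : {A : Set} → A → (A → Bool) → Set
x ∈ᶠ T = T x ≡ true

_∈ᶠ?_ : {A : Set} (x : A) (T : A → Bool) → Dec (x ∈ᶠ T)
x ∈ᶠ? T = T x Bool.≟ true

_⊆ᶠ_ : {A : Set} → (A → Bool) → (A → Bool) → Set
T ⊆ᶠ T′ = ∀ x → x ∈ᶠ T → x ∈ᶠ T′

module _ {A : Set} ⦃ _ : Enum A ⦄ where

  ⟦_⟧ : {P : A → Set} → (∀ x → Dec (P x)) → A → Bool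
  ⟦ P? ⟧ x = does (P? x)

  Projection : ℕ → Set
  Projection n = ∃ λ k → A → Vec (Fin n) k

  module _ {n : ℕ} where

    fiber : Projection n → (A → Bool) → A → ℕ
    fiber (k , p) T e = # (λ e′ → (e′ ∈ᶠ? T) ×-dec (p e′ ≟ᴱ p e))

    shadow : Projection n → (A → Bool) → ℕ
    shadow (k , p) T = # (λ y → ∃? (λ e → (e ∈ᶠ? T) ×-dec (p e ≟ᴱ y)))

    shadows : List (Projection n) → (A → Bool) → ℕ
    shadows []       T = 0
    shadows (b ∷ bs) T = shadow b T + shadows bs T

    shadow-mono : ∀ b {T T′} → T ⊆ᶠ T′ → shadow b T ≤ shadow b T′
    shadow-mono (k , p) h = #-mono _ _ λ { y (e , t , eq) → e , h e t , eq }

    shadows-mono : ∀ bs {T T′} → T ⊆ᶠ T′ → shadows bs T ≤ shadows bs T′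
    shadows-mono []       h = z≤n
    shadows-mono (b ∷ bs) h = +-mono-≤ (shadow-mono b h) (shadows-mono bs h)

    -- A minimum-degree condition. For ordered pairs and the two coordinate projections, every
    -- vertex used as a first entry has more than `g` out-neighbours, and every vertex used as a
    -- second entry more than `g` in-neighbours.
    Stable : ℕ → List (Projection n) → (A → Bool) → Set
    Stable g bs T = ∃ (_∈ᶠ T) × (∀ e → e ∈ᶠ T → All (λ b → g < fiber b T e) bs)

    private
      without : (b : Projection n) → A → (A → Bool) → A → Bool
      without (k , p) e T = ⟦ (λ e′ → (e′ ∈ᶠ? T) ×-dec ¬? (p e′ ≟ᴱ p e)) ⟧

      without-⊆ : ∀ b e T → without b e T ⊆ᶠ T
      without-⊆ (k , p) e T x h = proj₁ (does⇒ ((x ∈ᶠ? T) ×-dec ¬? (p x ≟ᴱ p e)) h)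

      shadow-< : ∀ b e T → e ∈ᶠ T → suc (shadow b (without b e T)) ≤ shadow b T
      shadow-< b@(k , p) e T t = ≤-trans
        (s≤s (#-mono (λ y → ∃? (λ e′ → (e′ ∈ᶠ? without b e T) ×-dec (p e′ ≟ᴱ y)))
                     (λ y → ∃? (λ e′ → (e′ ∈ᶠ? T) ×-dec (p e′ ≟ᴱ y)) ×-dec ¬? (y ≟ᴱ p e))
          λ { y (e′ , t′ , eq) → (e′ , without-⊆ b e T e′ t′ , eq) ,
              λ eq′ → proj₂ (does⇒ ((e′ ∈ᶠ? T) ×-dec ¬? (p e′ ≟ᴱ p e)) t′) (trans eq eq′) }))
        (≤-reflexive (sym (#-remove (λ y → ∃? (λ e′ → (e′ ∈ᶠ? T) ×-dec (p e′ ≟ᴱ y))) (p e) (e , t , refl))))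

      shadows-< : ∀ {bs} {b} {P : Projection n → Set} → (a : Any P bs) → b ≡ Any.lookup a → ∀ e T → e ∈ᶠ T →
                  suc (shadows bs (without b e T)) ≤ shadows bs T
      shadows-< {b ∷ bs} (here _) refl e T t = +-mono-≤ (shadow-< b e T t) (shadows-mono bs (without-⊆ b e T))
      shadows-< {c ∷ bs} {b} (there a) eq e T t = ≤-trans (≤-reflexive (sym (+-suc (shadow c (without b e T)) _)))
        (+-mono-≤ (shadow-mono c (without-⊆ b e T)) (shadows-< a eq e T t))

      size-without : ∀ b e T → # (_∈ᶠ? T) ≡ fiber b T e + # (_∈ᶠ? without b e T)
      size-without (k , p) e T = trans (#-split (_∈ᶠ? T) (λ e′ → p e′ ≟ᴱ p e))
        (cong (fiber (k , p) T e +_) (#-cong _ _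
          (λ x h → ⇒does ((x ∈ᶠ? T) ×-dec ¬? (p x ≟ᴱ p e)) h)
          (λ x h → does⇒ ((x ∈ᶠ? T) ×-dec ¬? (p x ≟ᴱ p e)) h)))

    -- Deleting a fibre with at most g members lowers the total shadow by at least one.
    stable-or-small : ∀ g (bs : List (Projection n)) T →
      (∃ λ T* → T* ⊆ᶠ T × Stable g bs T*) ⊎ # (_∈ᶠ? T) ≤ g * shadows bs T
    stable-or-small g bs T₀ = go _ T₀ ≤-refl
      where
      go : ∀ k T → # (_∈ᶠ? T) ≤ k → (∃ λ T* → T* ⊆ᶠ T × Stable g bs T*) ⊎ # (_∈ᶠ? T) ≤ g * shadows bs T
      go k T bound with ∃? (λ e → (e ∈ᶠ? T) ×-dec Any.any? (λ b → fiber b T e ≤? g) bs)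
      go k T bound | no h with ∃? (_∈ᶠ? T)
      ... | yes some = inj₁ (T , (λ _ t → t) , some , λ e t →
              All.map ≰⇒> (All.¬Any⇒All¬ bs (λ a → h (e , t , a))))
      ... | no none = inj₂ (≤-trans (≤-reflexive (#-none _ λ e t → none (e , t))) z≤n)
      go zero T bound | yes (e , t , _) = ⊥-elim (<⇒≱ (pos-# (_∈ᶠ? T) e t) bound)
      go (suc k) T bound | yes (e , t , a)
        with go k (without b e T) (≤-pred (≤-trans (≤-trans (+-monoˡ-≤ _ (pos-# (λ e′ → (e′ ∈ᶠ? T) ×-dec (proj₂ b e′ ≟ᴱ proj₂ b e)) e (t , refl)))
              (≤-reflexive (sym (size-without b e T)))) bound))
        where b = Any.lookup a
      ... | inj₁ (T* , sub , st) = inj₁ (T* , (λ x h → without-⊆ (Any.lookup a) e T x (sub x h)) , st)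
      ... | inj₂ small = inj₂ (begin
          # (_∈ᶠ? T)                                    ≡⟨ size-without b e T ⟩
          fiber b T e + # (_∈ᶠ? without b e T)          ≤⟨ +-mono-≤ (Any.lookup-result a) small ⟩
          g + g * shadows bs (without b e T)            ≡⟨ *-suc g _ ⟨
          g * suc (shadows bs (without b e T))          ≤⟨ *-monoʳ-≤ g (shadows-< a refl e T t) ⟩
          g * shadows bs T                              ∎)
        where
        open ≤-Reasoning
        b = Any.lookup a

-- Embedding trees through rich triples

#-∈ : ∀ {n} (s : Subset n) → # (_∈? s) ≡ ∣ s ∣
#-∈ [] = ∑-Fin0 _
#-∈ (true ∷ s) = trans (∑-suc _) (cong₂ _+_ (𝟙-yes (fzero ∈? (true ∷ s)) here)
  (trans (#-cong _ (_∈? s) (λ x → drop-there) (λ x → there)) (#-∈ s)))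
#-∈ (false ∷ s) = trans (∑-suc _) (cong₂ _+_ (𝟙-no (fzero ∈? (false ∷ s)) λ ())
  (trans (#-cong _ (_∈? s) (λ x → drop-there) (λ x → there)) (#-∈ s)))

#-count : ∀ {m} (f : Fin m → Bool) → # (_∈ᶠ? f) ≡ count f
#-count {zero}  f = ∑-Fin0 _
#-count {suc m} f = trans (∑-suc _) (cong₂ _+_ head (#-count (f ∘ fsuc)))
  where
  head : 𝟙 (fzero ∈ᶠ? f) ≡ (if f fzero then 1 else 0)
  head with f fzero
  ... | true  = 𝟙-yes (true Bool.≟ true) refl
  ... | false = 𝟙-no (false Bool.≟ true) λ ()

-- Pads the at most two shared vertices of an edge to exactly two distinct ones, so that every edge
-- of the tree corresponds to an edge of the auxiliary graph.
two-cover : ∀ {A : Set} ⦃ _ : Enum A ⦄ {P Q : A → Set} (P? : ∀ x → Dec (P x)) (Q? : ∀ x → Dec (Q x)) →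
  (∀ x → P x → Q x) → # P? ≤ 2 → 2 ≤ # Q? →
  ∃ λ x → ∃ λ y → x ≢ y × Q x × Q y × (∀ z → P z → z ≡ x ⊎ z ≡ y)
two-cover {A} {P} {Q} P? Q? sub P≤ Q≥ = from (∃? P?)
  where
  second : ∀ x → Q x → ∃ λ y → Q y × y ≢ x
  second x q = #-pos (λ y → Q? y ×-dec ¬? (y ≟ᴱ x)) (≤-pred (≤-trans Q≥ (≤-reflexive (#-remove Q? x q))))
  from : Dec (∃ P) → _
  from (no ¬p) with #-pos Q? (≤-trans (s≤s z≤n) Q≥)
  ... | x , q with second x q
  ... | y , q′ , ne = x , y , ne ∘ sym , q , q′ , λ z p → ⊥-elim (¬p (z , p))
  from (yes (x , p)) with ∃? (λ y → P? y ×-dec ¬? (y ≟ᴱ x))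
  ... | no none with second x (sub x p)
  ...   | y , q′ , ne = x , y , ne ∘ sym , sub x p , q′ , cov
    where
    cov : ∀ z → P z → z ≡ x ⊎ z ≡ y
    cov z pz with z ≟ᴱ x
    ... | yes e = inj₁ e
    ... | no ¬e = ⊥-elim (none (z , pz , ¬e))
  from (yes (x , p)) | yes (y , p′ , ne) = x , y , ne ∘ sym , sub x p , sub y p′ , cov
    where
    Px? = λ y → P? y ×-dec ¬? (y ≟ᴱ x)
    cov : ∀ z → P z → z ≡ x ⊎ z ≡ y
    cov z pz with z ≟ᴱ x | z ≟ᴱ y
    ... | yes e | _ = inj₁ e
    ... | no _ | yes e = inj₂ e
    ... | no a | no b = ⊥-elim (<⇒≱ {2} {# P?} (≤-trans (s≤s (≤-trans (s≤s
            (pos-# (λ z → Px? z ×-dec ¬? (z ≟ᴱ y)) z ((pz , a) , b)))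
            (≤-reflexive (sym (#-remove Px? y (p′ , ne))))))
            (≤-reflexive (sym (#-remove P? x p)))) P≤)

module _ {n : ℕ} (F : Hypergraph n) where

  -- Repetitions among `a`, `b`, `c` are allowed, which is how a pair is encoded. Entries of `Z` may
  -- coincide with them, so `Z` can be the whole image of a partial embedding, kernel included.
  Escapes : ∀ {v} → Fin n → Fin n → Fin n → Vec (Fin n) v → Set
  Escapes a b c Z = ∃ λ i → (a ∈ edge F i × b ∈ edge F i × c ∈ edge F i) ×
    (∀ q → lookup Z q ∈ edge F i → lookup Z q ≡ a ⊎ lookup Z q ≡ b ⊎ lookup Z q ≡ c)

  -- Plays the role of a set of size at most three that is the kernel of a large sunflower.
  Rich : ℕ → Fin n → Fin n → Fin n → Set
  Rich v a b c = (Z : Vec (Fin n) v) → Escapes a b c Z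

  opaque
    Escapes? : ∀ {v} a b c (Z : Vec (Fin n) v) → Dec (Escapes a b c Z)
    Escapes? a b c Z = ∃? λ i → ((a ∈? edge F i) ×-dec (b ∈? edge F i) ×-dec (c ∈? edge F i)) ×-dec
      ∀? λ q → (lookup Z q ∈? edge F i) →-dec
        ((lookup Z q ≟ᴱ a) ⊎-dec (lookup Z q ≟ᴱ b) ⊎-dec (lookup Z q ≟ᴱ c))

    Rich? : ∀ v a b c → Dec (Rich v a b c)
    Rich? v a b c = ∀? (Escapes? a b c)

  Rich-swap : ∀ {v a b c} → Rich v a b c → Rich v a c b
  Rich-swap h Z with h Z
  ... | i , (p , q , s) , out = i , (p , s , q) , λ k z → case out k z of λ
    { (inj₁ e) → inj₁ e ; (inj₂ (inj₁ e)) → inj₂ (inj₂ e) ; (inj₂ (inj₂ e)) → inj₂ (inj₁ e) }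

module Embedding {v n r : ℕ} (H : Hypergraph v) (F : Hypergraph n)
  (uniformH : Uniform H r) (uniformF : Uniform F r)
  (private-vertex : ∀ j → ∃ λ x → x ∈ edge H j × (∀ j′ → x ∈ edge H j′ → j′ ≡ j))
  (v≤n : v ≤ n) where

  #H : ∀ j → # (_∈? edge H j) ≡ r
  #H j = trans (#-∈ (edge H j)) (uniformH j)

  #F : ∀ i → # (_∈? edge F i) ≡ r
  #F i = trans (#-∈ (edge F i)) (uniformF i)

  -- All edges have r vertices, so an edge of `H` mapped into an edge of `F` is mapped onto it. A
  -- private vertex then tells the edges of `H` apart and makes `ψ` injective.
  contains : (φ : Fin v → Fin n) → (∀ x y → φ x ≡ φ y → x ≡ y) →
    (∀ j → ∃ λ i → ∀ x → x ∈ edge H j → φ x ∈ edge F i) → Contains F H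
  contains φ inj image = φ , (λ {x} {y} → inj x y) , ψ , ψ-inj , λ j → into j , onto j
    where
    ψ : Fin (m H) → Fin (m F)
    ψ j = proj₁ (image j)
    into : ∀ j y → y ∈ edge H j → φ y ∈ edge F (ψ j)
    into j = proj₂ (image j)
    onto : ∀ j x → x ∈ edge F (ψ j) → ∃ λ y → y ∈ edge H j × φ y ≡ x
    onto j = injective⇒surjective (_∈? edge H j) (_∈? edge F (ψ j)) φ (into j)
      (λ x y _ _ → inj x y) (≤-reflexive (trans (#F (ψ j)) (sym (#H j))))
    ψ-inj : ∀ {j j′} → ψ j ≡ ψ j′ → j ≡ j′
    ψ-inj {j} {j′} e with private-vertex j
    ... | x , x∈ , only with onto j′ (φ x) (subst (λ i → φ x ∈ edge F i) e (into j x x∈))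
    ... | y , y∈ , eq = sym (only j′ (subst (_∈ edge H j′) (inj y x eq) y∈))

  -- The edges of a prescribed star are embedded from the outset; every other edge must have its
  -- fixed part covered by a rich `Kernel`.
  Placed : (D : Fin v → Set) (φ : Fin v → Fin n) → Fin (m H) → Set
  Placed D φ j = (∀ x → x ∈ edge H j → D x) × ∃ λ i → ∀ x → x ∈ edge H j → φ x ∈ edge F i

  Kernel : (D : Fin v → Set) (φ : Fin v → Fin n) → Fin (m H) → Set
  Kernel D φ j = ∃ λ a → ∃ λ b → ∃ λ c → (a ∈ edge H j × b ∈ edge H j × c ∈ edge H j) × (D a × D b × D c) ×
    (∀ x → x ∈ edge H j → D x → x ≡ a ⊎ x ≡ b ⊎ x ≡ c) × Rich F v (φ a) (φ b) (φ c)

  module _ {D : Fin v → Set} (D? : ∀ x → Dec (D x)) (φ₀ : Fin v → Fin n) (inj₀ : InjOn D φ₀)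
    (D-shared : ∀ x j j′ → j ≢ j′ → x ∈ edge H j → x ∈ edge H j′ → D x)
    (supply : ∀ j → Placed D φ₀ j ⊎ Kernel D φ₀ j) where

    private
      U : ℕ → Fin v → Set
      U k x = D x ⊎ ∃ λ j → toℕ j < k × x ∈ edge H j

      U? : ∀ k x → Dec (U k x)
      U? k x = D? x ⊎-dec ∃? λ j → (toℕ j <? k) ×-dec (x ∈? edge H j)

      Partial : ℕ → Set
      Partial k = ∃ λ φ → (∀ x → D x → φ x ≡ φ₀ x) × InjOn (U k) φ ×
        (∀ j → toℕ j < k → ∃ λ i → ∀ x → x ∈ edge H j → φ x ∈ edge F i)

      step : ∀ k → k < m H → Partial k → Partial (suc k)
      step k k<m (φ , agree , inj , image) = from (supply j)
        where
        j = fromℕ< k<m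
        new? : ∀ {x} → x ∈ edge H j → U k x → D x
        new? p (inj₁ d) = d
        new? p (inj₂ (j′ , lt , q)) = D-shared _ j j′
          (λ e → <-irrefl (trans (sym (cong toℕ e)) (Fin.toℕ-fromℕ< k<m)) lt) p q
        from : Placed D φ₀ j ⊎ Kernel D φ₀ j → Partial (suc k)
        from (inj₁ (E⊆D , i , into)) = φ , agree , (λ x y p q → inj x y (shrink p) (shrink q)) , image′
          where
          shrink : ∀ {x} → U (suc k) x → U k x
          shrink (inj₁ d) = inj₁ d
          shrink (inj₂ (j′ , lt , q)) with earlier-or-last k<m j′ lt
          ... | inj₁ l = inj₂ (j′ , l , q)
          ... | inj₂ refl = inj₁ (E⊆D _ q)
          image′ : ∀ j′ → toℕ j′ < suc k → ∃ λ i → ∀ x → x ∈ edge H j′ → φ x ∈ edge F i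
          image′ j′ lt with earlier-or-last k<m j′ lt
          ... | inj₁ l = image j′ l
          ... | inj₂ refl = i , λ x p → subst (_∈ edge F i) (sym (agree x (E⊆D x p))) (into x p)
        from (inj₂ (a , b , c , (a∈ , b∈ , c∈) , (Da , Db , Dc) , cover , rich))
          -- All v current values of `φ` are blocked, including the arbitrary ones outside `U k`;
          -- blocking those too does no harm, and no bookkeeping of the image is required.
          with rich (tabulate φ)
        ... | i , (a∈i , b∈i , c∈i) , outside
          with extend (U? k) (_∈? edge H j) (_∈? edge F i) φ
                 (≤-reflexive (trans (#H j) (sym (#F i)))) inj
                 (λ x p u → into x (cover x p (new? p u)))
                 (λ x u h → back x u (subst (λ z → z ∈ edge F i → z ≡ φ₀ a ⊎ z ≡ φ₀ b ⊎ z ≡ φ₀ c)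
                    (Vec.lookup∘tabulate φ x) (outside x) h))
          where
          hit : ∀ {z} → D z → φ₀ z ∈ edge F i → φ z ∈ edge F i
          hit d = subst (_∈ edge F i) (sym (agree _ d))
          into : ∀ x → x ≡ a ⊎ x ≡ b ⊎ x ≡ c → φ x ∈ edge F i
          into x (inj₁ refl) = hit Da a∈i
          into x (inj₂ (inj₁ refl)) = hit Db b∈i
          into x (inj₂ (inj₂ refl)) = hit Dc c∈i
          same : ∀ {x z} → U k x → D z → φ x ≡ φ₀ z → z ∈ edge H j → x ∈ edge H j
          same {x} {z} u d e z∈ = subst (_∈ edge H j)
            (sym (inj x z u (inj₁ d) (trans e (sym (agree z d))))) z∈
          back : ∀ x → U k x → φ x ≡ φ₀ a ⊎ φ x ≡ φ₀ b ⊎ φ x ≡ φ₀ c → x ∈ edge H j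
          back x u (inj₁ e) = same u Da e a∈
          back x u (inj₂ (inj₁ e)) = same u Db e b∈
          back x u (inj₂ (inj₂ e)) = same u Dc e c∈
        ... | φ′ , old , inj′ , into′ = φ′ , (λ x d → trans (old x (inj₁ d)) (agree x d))
              , (λ x y p q → inj′ x y (shrink p) (shrink q)) , image′
          where
          shrink : ∀ {x} → U (suc k) x → U k x ⊎ x ∈ edge H j
          shrink (inj₁ d) = inj₁ (inj₁ d)
          shrink (inj₂ (j′ , lt , q)) with earlier-or-last k<m j′ lt
          ... | inj₁ l = inj₁ (inj₂ (j′ , l , q))
          ... | inj₂ refl = inj₂ q
          image′ : ∀ j′ → toℕ j′ < suc k → ∃ λ i → ∀ x → x ∈ edge H j′ → φ′ x ∈ edge F i
          image′ j′ lt with earlier-or-last k<m j′ lt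
          ... | inj₂ refl = i , into′
          ... | inj₁ l with image j′ l
          ...   | i′ , h = i′ , λ x p → subst (_∈ edge F i′) (sym (old x (inj₂ (j′ , l , p)))) (h x p)

      partial : ∀ k → k ≤ m H → Partial k
      partial zero _ = φ₀ , (λ _ _ → refl) , (λ { x y (inj₁ p) (inj₁ q) → inj₀ x y p q
                                                ; x y (inj₂ (_ , () , _)) _ ; x y _ (inj₂ (_ , () , _)) }) , λ _ ()
      partial (suc k) le = step k le (partial k (≤-trans (n≤1+n k) le))

    -- Distinct edges of `H` meet only in `D`, so completing one edge leaves the vertices of the
    -- others outside `D` unplaced, and the edges can be treated one at a time. The last extension
    -- places the vertices that lie in no edge.
    fill : Contains F H
    fill with partial (m H) ≤-refl
    ... | φ , agree , inj , image
      with extend (U? (m H)) (λ _ → yes tt) (λ _ → yes tt) φ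
             (subst₂ _≤_ (sym #-full) (sym #-full) v≤n)
             inj (λ _ _ _ → tt) (λ _ _ _ → tt)
    ... | φ′ , old , inj′ , _ = contains φ′ (λ x y → inj′ x y (inj₂ tt) (inj₂ tt)) λ j →
          let (i , h) = image j (Fin.toℕ<n j) in
          i , λ x p → subst (_∈ edge F i) (sym (old x (inj₂ (j , Fin.toℕ<n j , p)))) (h x p)

  -- Large minimum degree in the form in which it is consumed. Isolated vertices are exempt, so `Γ`
  -- may live on a small part of the vertex set.
  record MinDegree (Γ : Fin n → Fin n → Set) : Set where
    field
      symmetric   : ∀ u w → Γ u w → Γ w u
      irreflexive : ∀ u w → Γ u w → u ≢ w
      start       : ∃ λ u → ∃ λ w → Γ u w
      neighbour   : ∀ u w → Γ u w → (Z : Vec (Fin n) v) → ∃ λ u′ → Γ u u′ × (∀ q → u′ ≢ lookup Z q)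

  -- One argument for both kinds of kernel. Either `S` is the cross-cut and the kernel is a pair
  -- together with the centre `ρ (z j)`, or `S` is empty, `z j` is `X j`, and the kernel is a pair.
  module Greedy (tree : IsTreeOrdering H)
    {S : Fin v → Set} (S? : ∀ x → Dec (S x)) (ρ : Fin v → Fin n) (ρ-inj : InjOn S ρ)
    (X Y z : Fin (m H) → Fin v)
    (X∈ : ∀ j → X j ∈ edge H j) (Y∈ : ∀ j → Y j ∈ edge H j) (z∈ : ∀ j → z j ∈ edge H j)
    (X∉S : ∀ j → ¬ S (X j)) (Y∉S : ∀ j → ¬ S (Y j)) (X≢Y : ∀ j → X j ≢ Y j)
    (cover : ∀ j x → x ∈ edge H j → ¬ S x → (∃ λ j′ → j′ ≢ j × x ∈ edge H j′) → x ≡ X j ⊎ x ≡ Y j)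
    (S-cover : ∀ j x → x ∈ edge H j → S x → x ≡ z j)
    (z-kind : ∀ j → S (z j) ⊎ z j ≡ X j)
    {Γ : Fin n → Fin n → Set} (minDegree : MinDegree Γ)
    (rich-X : ∀ j → z j ≡ X j → ∀ u w → Γ u w → Rich F v u u w)
    (rich-S : ∀ j → S (z j) → ∀ u w → Γ u w → Rich F v (ρ (z j)) u w) where

    open MinDegree minDegree

    private
      W : ℕ → Fin v → Set
      W k x = S x ⊎ ∃ λ j → toℕ j < k × (x ≡ X j ⊎ x ≡ Y j)

      W? : ∀ k x → Dec (W k x)
      W? k x = S? x ⊎-dec ∃? λ j → (toℕ j <? k) ×-dec ((x ≟ᴱ X j) ⊎-dec (x ≟ᴱ Y j))

      Partial : ℕ → Set
      Partial k = ∃ λ φ → (∀ x → S x → φ x ≡ ρ x) × InjOn (W k) φ ×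
        (∀ j → toℕ j < k → Γ (φ (X j)) (φ (Y j)))

      earlier : ∀ {k x} → ¬ S x → W k x → ∃ λ j → toℕ j < k × (x ≡ X j ⊎ x ≡ Y j)
      earlier ¬s (inj₁ s) = ⊥-elim (¬s s)
      earlier ¬s (inj₂ h) = h

      in-edge : ∀ {x j} → x ≡ X j ⊎ x ≡ Y j → x ∈ edge H j
      in-edge {j = j} (inj₁ refl) = X∈ j
      in-edge {j = j} (inj₂ refl) = Y∈ j

      step : ∀ k → k < m H → Partial k → Partial (suc k)
      step k k<m (φ , agree , inj , adj) = finish (place (W? k (X j)) (W? k (Y j)))
        where
        j = fromℕ< k<m
        j≡k : toℕ j ≡ k
        j≡k = Fin.toℕ-fromℕ< k<m

        Extension : Set
        Extension = ∃ λ φ′ → (∀ x → W k x → φ′ x ≡ φ x) ×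
          InjOn (λ x → W k x ⊎ x ≡ X j ⊎ x ≡ Y j) φ′ × Γ (φ′ (X j)) (φ′ (Y j))

        touched : ∀ {x} → ¬ S x → W k x → ∃ λ w → Γ (φ x) w
        touched ¬s h with earlier ¬s h
        ... | j′ , lt , inj₁ refl = φ (Y j′) , adj j′ lt
        ... | j′ , lt , inj₂ refl = φ (X j′) , symmetric _ _ (adj j′ lt)

        avoids : ∀ {u} → (∀ q → u ≢ lookup (tabulate φ) q) → ∀ x → φ x ≢ u
        avoids h x e = h x (trans (sym e) (sym (Vec.lookup∘tabulate φ x)))

        place : Dec (W k (X j)) → Dec (W k (Y j)) → Extension
        -- Both vertices are already placed, so both lie in the parent edge `a`. There they are
        -- shared and off `S`, hence they are the pair of `a`, whose images are adjacent.
        place (yes p) (yes q) = φ , (λ _ _ → refl) , (λ x y a b → inj x y (in-W a) (in-W b)) , adjacent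
          where
          in-W : ∀ {x} → W k x ⊎ x ≡ X j ⊎ x ≡ Y j → W k x
          in-W (inj₁ h) = h
          in-W (inj₂ (inj₁ refl)) = p
          in-W (inj₂ (inj₂ refl)) = q
          before : ∀ {x} → ¬ S x → W k x → ∃ λ j′ → toℕ j′ < toℕ j × x ∈ edge H j′
          before ¬s h with earlier ¬s h
          ... | j′ , lt , e = j′ , subst (toℕ j′ <_) (sym j≡k) lt , in-edge e
          adjacent : Γ (φ (X j)) (φ (Y j))
          adjacent with before (X∉S j) p | before (Y∉S j) q
          ... | bX@(_ , lt , _) | bY with tree j (≤-<-trans z≤n lt)
          ... | a , a<j , parent = orient
                (cover a (X j) (parent (X j) (X∈ j) bX) (X∉S j) (j , j≢a , X∈ j))
                (cover a (Y j) (parent (Y j) (Y∈ j) bY) (Y∉S j) (j , j≢a , Y∈ j))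
            where
            j≢a : j ≢ a
            j≢a e = <-irrefl (cong toℕ (sym e)) a<j
            a-adj = adj a (subst (toℕ a <_) j≡k a<j)
            orient : X j ≡ X a ⊎ X j ≡ Y a → Y j ≡ X a ⊎ Y j ≡ Y a → Γ (φ (X j)) (φ (Y j))
            orient (inj₁ e) (inj₁ f) = ⊥-elim (X≢Y j (trans e (sym f)))
            orient (inj₁ e) (inj₂ f) = subst₂ (λ s t → Γ (φ s) (φ t)) (sym e) (sym f) a-adj
            orient (inj₂ e) (inj₁ f) = subst₂ (λ s t → Γ (φ s) (φ t)) (sym e) (sym f) (symmetric _ _ a-adj)
            orient (inj₂ e) (inj₂ f) = ⊥-elim (X≢Y j (trans e (sym f)))
        place (yes p) (no ¬q) with touched (X∉S j) p
        ... | w , g with neighbour _ w g (tabulate φ)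
        ... | u , g′ , av with extend-by-one φ (Y j) u inj ¬q (λ x _ → avoids av x)
        ... | φ′ , old , new , inj′ = φ′ , old , (λ x y a b → inj′ x y (shrink a) (shrink b)) ,
              subst₂ Γ (sym (old _ p)) (sym new) g′
          where
          shrink : ∀ {x} → W k x ⊎ x ≡ X j ⊎ x ≡ Y j → W k x ⊎ x ≡ Y j
          shrink (inj₁ h) = inj₁ h
          shrink (inj₂ (inj₁ refl)) = inj₁ p
          shrink (inj₂ (inj₂ e)) = inj₂ e
        place (no ¬p) (yes q) with touched (Y∉S j) q
        ... | w , g with neighbour _ w g (tabulate φ)
        ... | u , g′ , av with extend-by-one φ (X j) u inj ¬p (λ x _ → avoids av x)
        ... | φ′ , old , new , inj′ = φ′ , old , (λ x y a b → inj′ x y (shrink a) (shrink b)) ,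
              subst₂ Γ (sym new) (sym (old _ q)) (symmetric _ _ g′)
          where
          shrink : ∀ {x} → W k x ⊎ x ≡ X j ⊎ x ≡ Y j → W k x ⊎ x ≡ X j
          shrink (inj₁ h) = inj₁ h
          shrink (inj₂ (inj₁ e)) = inj₂ e
          shrink (inj₂ (inj₂ refl)) = inj₁ q
        -- Nothing to attach to: a fresh neighbour `u` of a fixed non-isolated vertex is itself
        -- non-isolated, so it can be continued.
        place (no ¬p) (no ¬q) with start
        ... | w₀ , w₁ , g₀ with neighbour w₀ w₁ g₀ (tabulate φ)
        ... | u , g , av with neighbour u w₀ (symmetric _ _ g) (tabulate φ)
        ... | u′ , g′ , av′ with extend-by-one φ (X j) u inj ¬p (λ x _ → avoids av x)
        ... | φ₁ , old₁ , new₁ , inj₁′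
          with extend-by-one φ₁ (Y j) u′ inj₁′ ¬both fresh-u′
          where
          ¬both : ¬ (W k (Y j) ⊎ Y j ≡ X j)
          ¬both (inj₁ h) = ¬q h
          ¬both (inj₂ e) = X≢Y j (sym e)
          fresh-u′ : ∀ x → W k x ⊎ x ≡ X j → φ₁ x ≢ u′
          fresh-u′ x (inj₁ h) e = avoids av′ x (trans (sym (old₁ x h)) e)
          fresh-u′ x (inj₂ refl) e = irreflexive _ _ g′ (trans (sym new₁) e)
        ... | φ₂ , old₂ , new₂ , inj₂′ = φ₂ , (λ x h → trans (old₂ x (inj₁ h)) (old₁ x h)) ,
              (λ x y a b → inj₂′ x y (shrink a) (shrink b)) ,
              subst₂ Γ (sym (trans (old₂ _ (inj₂ refl)) new₁)) (sym new₂) g′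
          where
          shrink : ∀ {x} → W k x ⊎ x ≡ X j ⊎ x ≡ Y j → (W k x ⊎ x ≡ X j) ⊎ x ≡ Y j
          shrink (inj₁ h) = inj₁ (inj₁ h)
          shrink (inj₂ (inj₁ e)) = inj₁ (inj₂ e)
          shrink (inj₂ (inj₂ e)) = inj₂ e

        finish : Extension → Partial (suc k)
        finish (φ′ , old , inj′ , new) = φ′ , (λ x s → trans (old x (inj₁ s)) (agree x s)) ,
            (λ x y a b → inj′ x y (shrink a) (shrink b)) , adj′
          where
          shrink : ∀ {x} → W (suc k) x → W k x ⊎ x ≡ X j ⊎ x ≡ Y j
          shrink (inj₁ s) = inj₁ (inj₁ s)
          shrink (inj₂ (j′ , lt , h)) with earlier-or-last k<m j′ lt
          ... | inj₁ l = inj₁ (inj₂ (j′ , l , h))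
          ... | inj₂ refl = inj₂ h
          adj′ : ∀ j′ → toℕ j′ < suc k → Γ (φ′ (X j′)) (φ′ (Y j′))
          adj′ j′ lt with earlier-or-last k<m j′ lt
          ... | inj₂ refl = new
          ... | inj₁ l = subst₂ Γ (sym (old _ (inj₂ (j′ , l , inj₁ refl)))) (sym (old _ (inj₂ (j′ , l , inj₂ refl)))) (adj j′ l)

      partial : ∀ k → k ≤ m H → Partial k
      partial zero _ = ρ , (λ _ _ → refl) , (λ { x y (inj₁ p) (inj₁ q) → ρ-inj x y p q
                                               ; x y (inj₂ (_ , () , _)) _ ; x y _ (inj₂ (_ , () , _)) }) , λ _ ()
      partial (suc k) le = step k le (partial k (≤-trans (n≤1+n k) le))

    greedy : Contains F H
    greedy with partial (m H) ≤-refl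
    ... | φ , agree , inj , adj = fill (W? (m H)) φ inj shared λ j → inj₂ (kernel j)
      where
      shared : ∀ x j j′ → j ≢ j′ → x ∈ edge H j → x ∈ edge H j′ → W (m H) x
      shared x j j′ ne p q with S? x
      ... | yes s = inj₁ s
      ... | no ¬s = inj₂ (j , Fin.toℕ<n j , cover j x p ¬s (j′ , ne ∘ sym , q))
      W-X : ∀ j → W (m H) (X j)
      W-X j = inj₂ (j , Fin.toℕ<n j , inj₁ refl)
      W-Y : ∀ j → W (m H) (Y j)
      W-Y j = inj₂ (j , Fin.toℕ<n j , inj₂ refl)
      W-z : ∀ j → S (z j) ⊎ z j ≡ X j → W (m H) (z j)
      W-z j (inj₁ s) = inj₁ s
      W-z j (inj₂ e) = subst (W (m H)) (sym e) (W-X j)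
      covered : ∀ j x → x ∈ edge H j → W (m H) x → x ≡ z j ⊎ x ≡ X j ⊎ x ≡ Y j
      covered j x p (inj₁ s) = inj₁ (S-cover j x p s)
      covered j x p (inj₂ (j′ , _ , h)) with j′ ≟ᴱ j | S? x
      ... | yes refl | _ = inj₂ h
      ... | no ne | yes s = inj₁ (S-cover j x p s)
      ... | no ne | no ¬s = inj₂ (cover j x p ¬s (j′ , ne , in-edge h))
      richness : ∀ j → S (z j) ⊎ z j ≡ X j → Rich F v (φ (z j)) (φ (X j)) (φ (Y j))
      richness j (inj₁ s) = subst (λ u → Rich F v u (φ (X j)) (φ (Y j))) (sym (agree _ s)) (rich-S j s _ _ (adj j (Fin.toℕ<n j)))
      richness j (inj₂ e) = subst (λ u → Rich F v (φ u) (φ (X j)) (φ (Y j))) (sym e) (rich-X j e _ _ (adj j (Fin.toℕ<n j)))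
      kernel : ∀ j → Kernel (W (m H)) φ j
      kernel j = z j , X j , Y j , (z∈ j , X∈ j , Y∈ j) , (W-z j (z-kind j) , W-X j , W-Y j) ,
                 covered j , richness j (z-kind j)

module TreeStructure {v r′ : ℕ} (H : Hypergraph v) (uniformH : Uniform H (4 + r′))
  (tree : IsTreeOrdering H) (reducible : Reducible H (2 + r′))
  (S : Subset v) (cross : CrossCut H S) where

  private
    r = 4 + r′

    #E : ∀ j → # (_∈? edge H j) ≡ r
    #E j = trans (#-∈ (edge H j)) (uniformH j)

  Shared : Fin (m H) → Fin v → Set
  Shared j x = x ∈ edge H j × ∃ λ j′ → j′ ≢ j × x ∈ edge H j′

  Shared? : ∀ j x → Dec (Shared j x)
  Shared? j x = (x ∈? edge H j) ×-dec ∃? λ j′ → ¬? (j′ ≟ᴱ j) ×-dec (x ∈? edge H j′)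

  degree-# : ∀ x → degree H x ≡ # (λ j → x ∈? edge H j)
  degree-# x = trans (sym (#-count (λ j → lookup (edge H j) x)))
    (#-cong _ _ (λ j → Vec.lookup⇒[]= x (edge H j)) (λ j → Vec.[]=⇒lookup))

  shared⇒degree : ∀ j x → Shared j x → 2 ≤ degree H x
  shared⇒degree j x (p , j′ , ne , q) = ≤-trans
    (s≤s (pos-# (λ i → (x ∈? edge H i) ×-dec ¬? (i ≟ᴱ j)) j′ (q , ne)))
    (≤-reflexive (sym (trans (degree-# x) (#-remove (λ i → x ∈? edge H i) j p))))

  private
    own : Fin (m H) → Fin v → Bool
    own j x = lookup (edge H j) x ∧ (degree H x ≡ᵇ 1)

    own⇒ : ∀ j x → x ∈ᶠ own j → x ∈ edge H j × ¬ Shared j x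
    own⇒ j x h with lookup (edge H j) x in eq | degree H x ≡ᵇ 1 in eq′
    ... | true | true = Vec.lookup⇒[]= x (edge H j) eq ,
      λ s → <⇒≱ (shared⇒degree j x s)
        (≤-reflexive (≡ᵇ⇒≡ (degree H x) 1 (subst True (sym eq′) tt)))

  -- Of the r vertices of an edge at least r - 2 have degree 1, whereas a shared vertex has degree
  -- at least 2.
  #Shared : ∀ j → # (Shared? j) ≤ 2
  #Shared j = +-cancelˡ-≤ (2 + r′) _ _ (begin
    2 + r′ + # (Shared? j)
      ≤⟨ +-mono-≤ (≤-trans (reducible j) (≤-reflexive (sym (#-count (own j)))))
           (#-mono (Shared? j) (λ x → (x ∈? edge H j) ×-dec ¬? (x ∈ᶠ? own j))
              λ x s → proj₁ s , λ o → proj₂ (own⇒ j x o) s) ⟩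
    # (_∈ᶠ? own j) + # (λ x → (x ∈? edge H j) ×-dec ¬? (x ∈ᶠ? own j))
      ≤⟨ +-monoˡ-≤ _ (#-mono (_∈ᶠ? own j) (λ x → (x ∈? edge H j) ×-dec (x ∈ᶠ? own j))
           λ x o → proj₁ (own⇒ j x o) , o) ⟩
    # (λ x → (x ∈? edge H j) ×-dec (x ∈ᶠ? own j)) + # (λ x → (x ∈? edge H j) ×-dec ¬? (x ∈ᶠ? own j))
      ≡⟨ #-split (_∈? edge H j) (_∈ᶠ? own j) ⟨
    # (_∈? edge H j)
      ≡⟨ trans (#E j) (trans (+-comm 2 (2 + r′)) refl) ⟩
    2 + r′ + 2 ∎)
    where open ≤-Reasoning

  private-vertex : ∀ j → ∃ λ x → x ∈ edge H j × (∀ j′ → x ∈ edge H j′ → j′ ≡ j)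
  private-vertex j with ∃? (λ x → (x ∈? edge H j) ×-dec ¬? (Shared? j x))
  ... | yes (x , p , ¬s) = x , p , only
    where
    only : ∀ j′ → x ∈ edge H j′ → j′ ≡ j
    only j′ q with j′ ≟ᴱ j
    ... | yes e = e
    ... | no ne = ⊥-elim (¬s (p , j′ , ne , q))
  ... | no none = ⊥-elim (<⇒≱ (≤-trans (s≤s (s≤s (s≤s z≤n))) (≤-trans (≤-reflexive (sym (#E j)))
      (#-mono (_∈? edge H j) (Shared? j) all))) (#Shared j))
    where
    all : ∀ x → x ∈ edge H j → Shared j x
    all x p with Shared? j x
    ... | yes s = s
    ... | no ¬s = ⊥-elim (none (x , p , ¬s))

  #∩S : ∀ j → # (λ x → (x ∈? edge H j) ×-dec (x ∈? S)) ≡ 1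
  #∩S j = trans (trans (#-cong _ (_∈? (edge H j ∩ S)) (λ x → x∈p∩q⁺) (λ x → x∈p∩q⁻ (edge H j) S)) (#-∈ (edge H j ∩ S))) (cross j)

  opaque
    cut : ∀ j → ∃ λ x → x ∈ edge H j × x ∈ S
    cut j = #-pos _ (≤-reflexive (sym (#∩S j)))

  cut-unique : ∀ j x y → x ∈ edge H j → x ∈ S → y ∈ edge H j → y ∈ S → x ≡ y
  cut-unique j x y p s q t with x ≟ᴱ y
  ... | yes e = e
  ... | no ne = ⊥-elim (<⇒≱ {1} {1} (≤-trans (s≤s (pos-# (λ z → ((z ∈? edge H j) ×-dec (z ∈? S)) ×-dec ¬? (z ≟ᴱ x)) y ((q , t) , ne ∘ sym)))
      (≤-reflexive (trans (sym (#-remove (λ z → (z ∈? edge H j) ×-dec (z ∈? S)) x (p , s))) (#∩S j)))) ≤-refl)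

  opaque
    pair : ∀ j → ∃ λ x → ∃ λ y → x ≢ y × (x ∈ edge H j × ¬ x ∈ S) × (y ∈ edge H j × ¬ y ∈ S) ×
           (∀ z → Shared j z × ¬ z ∈ S → z ≡ x ⊎ z ≡ y)
    pair j = two-cover (λ z → Shared? j z ×-dec ¬? (z ∈? S)) (λ z → (z ∈? edge H j) ×-dec ¬? (z ∈? S))
      (λ { z ((p , _) , q) → p , q })
      (≤-trans (#-mono _ (Shared? j) λ z → proj₁) (#Shared j))
      (≤-trans (s≤s (s≤s z≤n)) (≤-reflexive (suc-injective (trans (sym (#E j))
        (trans (#-split (_∈? edge H j) (_∈? S)) (cong (_+ # (λ z → (z ∈? edge H j) ×-dec ¬? (z ∈? S))) (#∩S j)))))))

    pair₀ : ∀ j → ∃ λ x → ∃ λ y → x ≢ y × x ∈ edge H j × y ∈ edge H j × (∀ z → Shared j z → z ≡ x ⊎ z ≡ y)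
    pair₀ j = two-cover (Shared? j) (_∈? edge H j) (λ z → proj₁) (#Shared j)
      (≤-trans (s≤s (s≤s z≤n)) (≤-reflexive (sym (#E j))))

  module _ {n : ℕ} (F : Hypergraph n) (uniformF : Uniform F r) (v≤n : v ≤ n) where

    open Embedding H F uniformH uniformF private-vertex v≤n

    embed-rich-pairs : {Γ : Fin n → Fin n → Set} → MinDegree Γ → (∀ u w → Γ u w → Rich F v u u w) → Contains F H
    embed-rich-pairs {Γ} md rich = Greedy.greedy tree {λ _ → ⊥} (λ _ → no λ ()) f₀ (λ _ _ ())
      X Y X X∈ Y∈ X∈ (λ _ ()) (λ _ ()) (λ j → proj₁ (proj₂ (proj₂ (pair₀ j))))
      (λ j x p _ q → proj₂ (proj₂ (proj₂ (proj₂ (proj₂ (pair₀ j))))) x (p , q))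
      (λ _ _ _ ()) (λ _ → inj₂ refl) md (λ _ _ → rich) (λ _ ())
      where
      f₀ : Fin v → Fin n
      f₀ x = inject≤ x v≤n
      X Y : Fin (m H) → Fin v
      X j = proj₁ (pair₀ j)
      Y j = proj₁ (proj₂ (pair₀ j))
      X∈ : ∀ j → X j ∈ edge H j
      X∈ j = proj₁ (proj₂ (proj₂ (proj₂ (pair₀ j))))
      Y∈ : ∀ j → Y j ∈ edge H j
      Y∈ j = proj₁ (proj₂ (proj₂ (proj₂ (proj₂ (pair₀ j)))))

    embed-rich-triples : (ρ : Fin v → Fin n) → InjOn (_∈ S) ρ → {Γ : Fin n → Fin n → Set} → MinDegree Γ →
      (∀ x → x ∈ S → ∀ u w → Γ u w → Rich F v (ρ x) u w) → Contains F H
    embed-rich-triples ρ ρ-inj {Γ} md rich = Greedy.greedy tree (_∈? S) ρ ρ-inj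
      X Y z (λ j → proj₁ (X∈ j)) (λ j → proj₁ (Y∈ j)) (λ j → proj₁ (proj₂ (cut j)))
      (λ j → proj₂ (X∈ j)) (λ j → proj₂ (Y∈ j)) (λ j → proj₁ (proj₂ (proj₂ (pair j))))
      (λ j x p ¬s q → proj₂ (proj₂ (proj₂ (proj₂ (proj₂ (pair j))))) x ((p , q) , ¬s))
      (λ j x p s → cut-unique j x (z j) p s (proj₁ (proj₂ (cut j))) (proj₂ (proj₂ (cut j))))
      (λ j → inj₁ (proj₂ (proj₂ (cut j)))) md
      (λ j e → ⊥-elim (proj₂ (X∈ j) (subst (_∈ S) e (proj₂ (proj₂ (cut j)))))) (λ j s → rich (z j) s)
      where
      X Y z : Fin (m H) → Fin v
      X j = proj₁ (pair j)
      Y j = proj₁ (proj₂ (pair j))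
      z j = proj₁ (cut j)
      X∈ : ∀ j → X j ∈ edge H j × ¬ X j ∈ S
      X∈ j = proj₁ (proj₂ (proj₂ (proj₂ (pair j))))
      Y∈ : ∀ j → Y j ∈ edge H j × ¬ Y j ∈ S
      Y∈ j = proj₁ (proj₂ (proj₂ (proj₂ (proj₂ (pair j)))))

-- Dense graphs contain subgraphs of large minimum degree

avoid : ∀ {A : Set} ⦃ _ : Enum A ⦄ {n v : ℕ} {P : A → Set} (P? : ∀ x → Dec (P x)) (f : A → Fin n) → InjOn P f →
        v < # P? → (Z : Vec (Fin n) v) → ∃ λ x → P x × (∀ q → f x ≢ lookup Z q)
avoid {v = v} P? f inj lt Z with ∃? (λ x → P? x ×-dec ∀? (λ q → ¬? (f x ≟ᴱ lookup Z q)))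
... | yes r = r
... | no none = ⊥-elim (<⇒≱ lt (≤-trans
      (#-∃ P? (λ x q → P? x ×-dec (f x ≟ᴱ lookup Z q)) hit)
      (≤-trans (∑-bound {A = Fin v} 1 (λ q → #≤1 _ λ { x y (p , e) (p′ , e′) → inj x y p p′ (trans e (sym e′)) }))
        (≤-reflexive (trans (*-identityʳ _) (size-Fin v))))))
  where
  hit : ∀ x → _ → ∃ λ q → _ × f x ≡ lookup Z q
  hit x p with ∃? (λ q → f x ≟ᴱ lookup Z q)
  ... | yes (q , e) = q , p , e
  ... | no h = ⊥-elim (none (x , p , λ q e → h (q , e)))

#₂ : ∀ {n} {P : Fin n → Fin n → Set} (P? : ∀ u w → Dec (P u w)) →
     # (λ (e : Vec (Fin n) 2) → P? (lookup e fzero) (lookup e (fsuc fzero))) ≡ ∑ (λ u → # (P? u))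
#₂ P? = trans (∑-∷ _) (∑-cong λ u → trans (∑-∷ _) (∑-cong λ w → ∑-[] _))

module _ {n v : ℕ} {P : Fin n → Fin n → Set} (P? : ∀ u w → Dec (P u w)) where

  sparse : (∀ {Γ : Fin n → Fin n → Set} → (∀ u w → Γ u w → Γ w u) → (∃ λ u → ∃ λ w → Γ u w) →
             (∀ u w → Γ u w → (Z : Vec (Fin n) v) → ∃ λ u′ → Γ u u′ × (∀ q → u′ ≢ lookup Z q)) →
             (∀ u w → Γ u w → P u w ⊎ P w u) → ⊥) →
           ∑ (λ u → # (P? u)) ≤ 2 * v * n
  sparse no-core with stable-or-small {n = n} v ((1 , λ e → removeAt e fzero) ∷ (1 , λ e → removeAt e (fsuc fzero)) ∷ [])
                     ⟦ (λ (e : Vec (Fin n) 2) → P? (lookup e fzero) (lookup e (fsuc fzero))) ⟧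
  ... | inj₂ small = ≤-trans (≤-reflexive (trans (sym (#₂ P?)) (#-cong _ _
           (λ e → ⇒does (P? (lookup e fzero) (lookup e (fsuc fzero)))) (λ e → does⇒ (P? (lookup e fzero) (lookup e (fsuc fzero)))))))
         (≤-trans small (≤-trans (*-monoʳ-≤ v (+-mono-≤ bound (+-monoˡ-≤ 0 bound)))
           (≤-reflexive (trans (sym (*-assoc v 2 n)) (cong (_* n) (*-comm v 2))))))
    where
    bound : ∀ {P : Vec (Fin n) 1 → Set} {P? : ∀ y → Dec (P y)} → # P? ≤ n
    bound {P? = P?} = ≤-trans (#≤size P?) (≤-reflexive (trans (size-Vec n 1) (*-identityʳ n)))
  ... | inj₁ (T , T⊆ , (e₀ , t₀) , st) = ⊥-elim (no-core {Γ} sym-Γ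
         (lookup e₀ fzero , lookup e₀ (fsuc fzero) , inj₁ (eta e₀ t₀)) nbr sub)
    where
    Γ : Fin n → Fin n → Set
    Γ u w = (u ∷ w ∷ []) ∈ᶠ T ⊎ (w ∷ u ∷ []) ∈ᶠ T
    eta : ∀ e → e ∈ᶠ T → (lookup e fzero ∷ lookup e (fsuc fzero) ∷ []) ∈ᶠ T
    eta (_ ∷ _ ∷ []) t = t
    sym-Γ : ∀ u w → Γ u w → Γ w u
    sym-Γ u w (inj₁ t) = inj₂ t
    sym-Γ u w (inj₂ t) = inj₁ t
    sub : ∀ u w → Γ u w → P u w ⊎ P w u
    sub u w (inj₁ t) = inj₁ (does⇒ (P? u w) (T⊆ _ t))
    sub u w (inj₂ t) = inj₂ (does⇒ (P? w u) (T⊆ _ t))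
    nbr : ∀ u w → Γ u w → (Z : Vec (Fin n) v) → ∃ λ u′ → Γ u u′ × (∀ q → u′ ≢ lookup Z q)
    nbr u w (inj₁ t) Z with st _ t
    ... | _ ∷ big ∷ [] with avoid _ (λ e → lookup e (fsuc fzero)) (λ { (_ ∷ _ ∷ []) (_ ∷ _ ∷ []) (_ , refl) (_ , refl) refl → refl }) big Z
    ... | (u ∷ u′ ∷ []) , (t′ , refl) , av = u′ , inj₁ t′ , av
    nbr u w (inj₂ t) Z with st _ t
    ... | big ∷ _ ∷ [] with avoid _ (λ e → lookup e fzero) (λ { (_ ∷ _ ∷ []) (_ ∷ _ ∷ []) (_ , refl) (_ , refl) refl → refl }) big Z
    ... | (u′ ∷ u ∷ []) , (t′ , refl) , av = u′ , inj₂ t′ , av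

-- Homogeneous families of tuples

punch-elsewhere : ∀ {A : Set} {k} (e e′ : Vec A (suc k)) j → removeAt e j ≡ removeAt e′ j →
                  ∀ q → j ≢ q → lookup e q ≡ lookup e′ q
punch-elsewhere e e′ j eq q ne = trans (sym (Vec.removeAt-punchOut e ne))
  (trans (cong (λ s → lookup s (punchOut ne)) eq) (Vec.removeAt-punchOut e′ ne))

lookup-ext : ∀ {A : Set} {k} (e e′ : Vec A k) → (∀ q → lookup e q ≡ lookup e′ q) → e ≡ e′
lookup-ext e e′ h = trans (sym (Vec.tabulate∘lookup e)) (trans (Vec.tabulate-cong h) (Vec.tabulate∘lookup e′))

removeAt-ext : ∀ {A : Set} {k} (e e′ : Vec A (suc k)) j → (∀ q → j ≢ q → lookup e q ≡ lookup e′ q) →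
               removeAt e j ≡ removeAt e′ j
removeAt-ext e e′ j h = lookup-ext _ _ λ p → subst
  (λ s → lookup (removeAt e j) s ≡ lookup (removeAt e′ j) s) (Fin.punchOut-punchIn j)
  (trans (Vec.removeAt-punchOut e (Fin.punchInᵢ≢i j p ∘ sym))
    (trans (h _ (Fin.punchInᵢ≢i j p ∘ sym)) (sym (Vec.removeAt-punchOut e′ (Fin.punchInᵢ≢i j p ∘ sym)))))

-- The witness returned by the decision `over?` serves as the choice of a member over each point of
-- the shadow; it depends on the point alone, whence injectivity.
transversal : ∀ {A : Set} ⦃ _ : Enum A ⦄ {n} (b : Projection n) (T : A → Bool) →
  ∃ λ T′ → T′ ⊆ᶠ T × InjOn (_∈ᶠ T′) (proj₂ b) × shadow b T ≤ # (_∈ᶠ? T′)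
transversal {A} {n} (k , p) T = ⟦ member? ⟧ , (λ e h → proj₁ (mem e h)) , inj , count-≤
  where
  over? : ∀ y → Dec (∃ λ e → e ∈ᶠ T × p e ≡ y)
  over? y = ∃? λ e → (e ∈ᶠ? T) ×-dec (p e ≟ᴱ y)
  Chosen : Vec (Fin n) k → A → Set
  Chosen y e with over? y
  ... | yes (e′ , _) = e′ ≡ e
  ... | no _ = ⊥
  chosen? : ∀ y e → Dec (Chosen y e)
  chosen? y e with over? y
  ... | yes (e′ , _) = e′ ≟ᴱ e
  ... | no _ = no λ ()
  unique : ∀ y e e′ → Chosen y e → Chosen y e′ → e ≡ e′
  unique y e e′ c c′ with over? y
  ... | yes _ = trans (sym c) c′
  exists : ∀ y → (∃ λ e → e ∈ᶠ T × p e ≡ y) → ∃ λ e → (e ∈ᶠ T × p e ≡ y) × Chosen y e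
  exists y w with over? y
  ... | yes (e , h) = e , h , refl
  ... | no ¬w = ⊥-elim (¬w w)
  member? : ∀ e → Dec (e ∈ᶠ T × Chosen (p e) e)
  member? e = (e ∈ᶠ? T) ×-dec chosen? (p e) e
  mem : ∀ e → e ∈ᶠ ⟦ member? ⟧ → e ∈ᶠ T × Chosen (p e) e
  mem e = does⇒ (member? e)
  inj : InjOn (_∈ᶠ ⟦ member? ⟧) p
  inj e e′ h h′ eq = unique (p e) e e′ (proj₂ (mem e h)) (subst (λ y → Chosen y e′) (sym eq) (proj₂ (mem e′ h′)))
  count-≤ : shadow (k , p) T ≤ # (_∈ᶠ? ⟦ member? ⟧)
  count-≤ = ≤-trans (∑-mono λ y → 𝟙≤ (over? y) λ w → let (e , (t , eq) , c) = exists y w in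
      pos-# (λ e → (e ∈ᶠ? ⟦ member? ⟧) ×-dec (p e ≟ᴱ y)) e (⇒does (member? e) (t , subst (λ y → Chosen y e) (sym eq) c) , eq))
    (≤-reflexive (sym (#-fiber (_∈ᶠ? ⟦ member? ⟧) p)))

module _ (v k : ℕ) where

  private
    r = suc (suc k)

  opaque
    -- The deletion threshold 2v times r * r, a bound for the number of projections attached to one
    -- marking.
    branching : ℕ
    branching = 2 * v * (r * r)

    -- In units of n^k, the bound on the shadow at an unmarked position when at most l positions are
    -- unmarked. It is at least 1 so as to cover also the n^k values of a projection that forgets
    -- two positions.
    cost : ℕ → ℕ
    cost zero    = 1
    cost (suc l) = 1 + branching * cost l

    1≤cost : ∀ l → 1 ≤ cost l
    1≤cost zero    = ≤-refl
    1≤cost (suc l) = s≤s z≤n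

    cost-suc : ∀ l → branching * cost l ≤ cost (suc l)
    cost-suc l = n≤1+n _

    branching-* : ∀ x → 2 * v * (r * (r * x)) ≡ branching * x
    branching-* x = trans (cong (2 * v *_) (sym (*-assoc r r x))) (sym (*-assoc (2 * v) (r * r) x))

module Tuples (n v k : ℕ) where

  private
    r = suc (suc k)

  Family : Set
  Family = Vec (Fin n) r → Bool

  single : Fin r → Projection n
  single j = suc k , λ e → removeAt e j

  double : ∀ {j j′ : Fin r} → j ≢ j′ → Projection n
  double {j} ne = k , λ e → removeAt (removeAt e j) (punchOut ne)

  -- In the language of delta-systems the complement of j is an own set of each member, respectively
  -- the complement of X is the kernel of a large sunflower.
  Own : Fin r → Family → Set
  Own j T = InjOn (_∈ᶠ T) (λ e → removeAt e j)

  Swappable : Family → (Fin r → Set) → Set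
  Swappable T X = ∀ e → e ∈ᶠ T → (Z : Vec (Fin n) v) → ∃ λ e′ → e′ ∈ᶠ T ×
    (∀ q → ¬ X q → lookup e′ q ≡ lookup e q) × (∀ q → X q → ∀ i → lookup e′ q ≢ lookup Z i)

  module _ {T : Family} where

    swap-≡ : {X X′ : Fin r → Set} → (∀ q → X q → X′ q) → (∀ q → X′ q → X q) → Swappable T X → Swappable T X′
    swap-≡ f g sw e t Z with sw e t Z
    ... | e′ , t′ , keep , av = e′ , t′ , (λ q h → keep q (h ∘ f q)) , (λ q h → av q (g q h))

    -- The second exchange can undo the first only on `Y`, and there it avoids `Z` itself.
    swap-∪ : {X Y : Fin r → Set} → (∀ q → Dec (Y q)) → Swappable T X → Swappable T Y → Swappable T (λ q → X q ⊎ Y q)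
    swap-∪ {X} {Y} Y? sw sw′ e t Z with sw e t Z
    ... | e₁ , t₁ , keep₁ , av₁ with sw′ e₁ t₁ Z
    ... | e₂ , t₂ , keep₂ , av₂ = e₂ , t₂ , (λ q h → trans (keep₂ q (h ∘ inj₂)) (keep₁ q (h ∘ inj₁))) , av
      where
      av : ∀ q → X q ⊎ Y q → ∀ i → lookup e₂ q ≢ lookup Z i
      av q h with Y? q
      av q h | yes y = av₂ q y
      av q (inj₁ x) | no ¬y = λ i eq → av₁ q x i (trans (sym (keep₂ q ¬y)) eq)
      av q (inj₂ y) | no ¬y = ⊥-elim (¬y y)

    -- A marked position is exchanged only together with a partner, so `X` is assembled from
    -- exchangeable pairs inside `X`; a position exchanged alone is the case `q′ = q`.
    swap-⋃ : {X : Fin r → Set} → (∀ q → Dec (X q)) →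
      (∀ q → X q → ∃ λ q′ → X q′ × Swappable T (λ p → p ≡ q ⊎ p ≡ q′)) → Swappable T X
    swap-⋃ {X} X? cov with go r ≤-refl
      where
      go : ∀ l → l ≤ r → Σ (Fin r → Set) λ Y → (∀ q → Dec (Y q)) × (∀ q → Y q → X q) ×
           (∀ q → X q → toℕ q < l → Y q) × Swappable T Y
      go zero _ = (λ _ → ⊥) , (λ _ → no λ ()) , (λ _ ()) , (λ _ _ ()) , λ e t Z → e , t , (λ _ _ → refl) , λ _ ()
      go (suc l) l<r with go l (≤-trans (n≤1+n l) l<r)
      ... | Y , Y? , Y⊆X , ⊆Y , sw with X? (fromℕ< l<r)
      ... | no ¬x = Y , Y? , Y⊆X , ⊆Y′ , sw
        where
        ⊆Y′ : ∀ q → X q → toℕ q < suc l → Y q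
        ⊆Y′ q x lt with earlier-or-last l<r q lt
        ... | inj₁ l = ⊆Y q x l
        ... | inj₂ refl = ⊥-elim (¬x x)
      ... | yes x with cov (fromℕ< l<r) x
      ... | q′ , x′ , sw′ = (λ p → Y p ⊎ (p ≡ q₀ ⊎ p ≡ q′)) , (λ p → Y? p ⊎-dec B? p) ,
            (λ { p (inj₁ y) → Y⊆X p y ; p (inj₂ (inj₁ refl)) → x ; p (inj₂ (inj₂ refl)) → x′ }) , ⊆Y′ , swap-∪ B? sw sw′
        where
        q₀ = fromℕ< l<r
        B? : ∀ p → Dec (p ≡ q₀ ⊎ p ≡ q′)
        B? p = (p ≟ᴱ q₀) ⊎-dec (p ≟ᴱ q′)
        ⊆Y′ : ∀ q → X q → toℕ q < suc l → Y q ⊎ (q ≡ q₀ ⊎ q ≡ q′)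
        ⊆Y′ q x lt with earlier-or-last l<r q lt
        ... | inj₁ l = inj₁ (⊆Y q x l)
        ... | inj₂ e = inj₂ (inj₁ e)
    ... | Y , _ , Y⊆X , ⊆Y , sw = swap-≡ Y⊆X (λ q x → ⊆Y q x (Fin.toℕ<n q)) sw

    swap-single : ∀ j → (∀ e → e ∈ᶠ T → 2 * v < fiber (single j) T e) → Swappable T (_≡ j)
    swap-single j big e t Z with avoid (λ e′ → (e′ ∈ᶠ? T) ×-dec (removeAt e′ j ≟ᴱ removeAt e j)) (λ e′ → lookup e′ j) inj
        (≤-<-trans (m≤m+n v (v + 0)) (big e t)) Z
      where
      inj : InjOn (λ e′ → e′ ∈ᶠ T × removeAt e′ j ≡ removeAt e j) (λ e′ → lookup e′ j)
      inj x y (_ , p) (_ , q) eq = trans (sym (Vec.insertAt-removeAt x j))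
        (trans (cong₂ (λ s u → insertAt s j u) (trans p (sym q)) eq) (Vec.insertAt-removeAt y j))
    ... | e′ , (t′ , same) , av = e′ , t′ , (λ q ne → punch-elsewhere e′ e j same q (ne ∘ sym)) , λ { q refl → av }

    -- Inside the fibre only the entries at `j` and `j′` vary, and by the two own conditions either
    -- entry determines the tuple. So `Z` spoils at most v tuples through each entry, which is the
    -- origin of the threshold 2v.
    swap-double : ∀ {j j′} (ne : j ≢ j′) → Own j T → Own j′ T →
      (∀ e → e ∈ᶠ T → 2 * v < fiber (double ne) T e) → Swappable T (λ p → p ≡ j ⊎ p ≡ j′)
    swap-double {j} {j′} ne own own′ big e t Z with ∃? (λ e′ → mem? e′ ×-dec
        ∀? (λ i → ¬? (lookup e′ j ≟ᴱ lookup Z i)) ×-dec ∀? (λ i → ¬? (lookup e′ j′ ≟ᴱ lookup Z i)))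
      where
      mem? = λ e′ → (e′ ∈ᶠ? T) ×-dec (removeAt (removeAt e′ j) (punchOut ne) ≟ᴱ removeAt (removeAt e j) (punchOut ne))
    ... | yes (e′ , (t′ , same) , av , av′) = e′ , t′ , keep , λ { q (inj₁ refl) → av ; q (inj₂ refl) → av′ }
      where
      keep : ∀ q → ¬ (q ≡ j ⊎ q ≡ j′) → lookup e′ q ≡ lookup e q
      keep q h = trans (sym (Vec.removeAt-punchOut e′ j≢q)) (trans
          (punch-elsewhere (removeAt e′ j) (removeAt e j) (punchOut ne) same (punchOut j≢q)
             (λ eq → h (inj₂ (sym (Fin.punchOut-injective ne j≢q eq)))))
          (Vec.removeAt-punchOut e j≢q))
        where
        j≢q : j ≢ q
        j≢q eq = h (inj₁ (sym eq))
    ... | no none = ⊥-elim (<⇒≱ (big e t) (begin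
        # mem?
          ≤⟨ #-⊎ mem? (λ x → mem? x ×-dec ∃? (λ i → lookup x j ≟ᴱ lookup Z i))
                      (λ x → mem? x ×-dec ∃? (λ i → lookup x j′ ≟ᴱ lookup Z i)) hit ⟩
        _ ≤⟨ +-mono-≤ (count-≤ j (λ x y (t , _) (t′ , _) p → own′ x y t t′ p) (λ x y p q eq → agree x y p q (inj₁ eq)))
                      (count-≤ j′ (λ x y (t , _) (t′ , _) p → own x y t t′ p) (λ x y p q eq → agree′ x y p q eq)) ⟩
        v + v ≡⟨ cong (v +_) (sym (+-identityʳ v)) ⟩
        2 * v ∎))
      where
      open ≤-Reasoning
      Mem : Vec (Fin n) r → Set
      Mem e′ = e′ ∈ᶠ T × removeAt (removeAt e′ j) (punchOut ne) ≡ removeAt (removeAt e j) (punchOut ne)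
      mem? : ∀ e′ → Dec (Mem e′)
      mem? = λ e′ → (e′ ∈ᶠ? T) ×-dec (removeAt (removeAt e′ j) (punchOut ne) ≟ᴱ removeAt (removeAt e j) (punchOut ne))
      off : ∀ x y → Mem x → Mem y → ∀ q → j ≢ q → j′ ≢ q → lookup x q ≡ lookup y q
      off x y (_ , p) (_ , p′) q j≢q j′≢q = trans (sym (Vec.removeAt-punchOut x j≢q)) (trans
          (punch-elsewhere (removeAt x j) (removeAt y j) (punchOut ne) (trans p (sym p′)) (punchOut j≢q)
             (λ eq → j′≢q (Fin.punchOut-injective ne j≢q eq)))
          (Vec.removeAt-punchOut y j≢q))
      agree : ∀ x y → Mem x → Mem y → lookup x j ≡ lookup y j ⊎ ⊥ → removeAt x j′ ≡ removeAt y j′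
      agree x y p q (inj₁ eq) = removeAt-ext x y j′ λ s j′≢s → case j ≟ᴱ s of λ
        { (yes refl) → eq ; (no j≢s) → off x y p q s j≢s j′≢s }
      agree′ : ∀ x y → Mem x → Mem y → lookup x j′ ≡ lookup y j′ → removeAt x j ≡ removeAt y j
      agree′ x y p q eq = removeAt-ext x y j λ s j≢s → case j′ ≟ᴱ s of λ
        { (yes refl) → eq ; (no j′≢s) → off x y p q s j≢s j′≢s }
      hit : ∀ x → Mem x → (Mem x × ∃ λ i → lookup x j ≡ lookup Z i) ⊎ (Mem x × ∃ λ i → lookup x j′ ≡ lookup Z i)
      hit x p with ∃? (λ i → lookup x j ≟ᴱ lookup Z i) | ∃? (λ i → lookup x j′ ≟ᴱ lookup Z i)
      ... | yes h | _ = inj₁ (p , h)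
      ... | no _ | yes h = inj₂ (p , h)
      ... | no a | no b = ⊥-elim (none (x , p , (λ i eq → a (i , eq)) , (λ i eq → b (i , eq))))
      count-≤ : ∀ s {s′ : Fin r} → (∀ x y → Mem x → Mem y → removeAt x s′ ≡ removeAt y s′ → x ≡ y) →
        (∀ x y → Mem x → Mem y → lookup x s ≡ lookup y s → removeAt x s′ ≡ removeAt y s′) →
        # (λ x → mem? x ×-dec ∃? (λ i → lookup x s ≟ᴱ lookup Z i)) ≤ v
      count-≤ s o ag = ≤-trans (#-∃ _ (λ x i → mem? x ×-dec (lookup x s ≟ᴱ lookup Z i)) (λ { x (p , i , eq) → i , p , eq }))
        (≤-trans (∑-bound {A = Fin v} 1 (λ i → #≤1 _ λ { x y (p , eq) (q , eq′) → o x y p q (ag x y p q (trans eq (sym eq′))) }))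
          (≤-reflexive (trans (*-identityʳ _) (size-Fin v))))

  -- `M` marks the positions determined by the remaining entries. A tuple cannot be changed there
  -- alone, so marked positions are exchanged in pairs and unmarked ones singly.
  Homogeneous : (Fin r → Bool) → Family → Set
  Homogeneous M T = ∃ (_∈ᶠ T) × (∀ j → j ∈ᶠ M → Own j T) × (∀ j → M j ≡ false → Swappable T (_≡ j)) ×
    (∀ j j′ → j ≢ j′ → j ∈ᶠ M → j′ ∈ᶠ M → Swappable T (λ p → p ≡ j ⊎ p ≡ j′))

  shadows-++ : ∀ (xs ys : List (Projection n)) (T : Family) → shadows (xs ++ ys) T ≡ shadows xs T + shadows ys T
  shadows-++ []       ys T = refl
  shadows-++ (x ∷ xs) ys T = trans (cong (shadow x T +_) (shadows-++ xs ys T)) (sym (+-assoc (shadow x T) _ _))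

  shadows-concatMap : ∀ {A : Set} (f : A → List (Projection n)) (xs : List A) (T : Family) c → (∀ x → shadows (f x) T ≤ c) →
    shadows (concatMap f xs) T ≤ length xs * c
  shadows-concatMap f []       T c h = z≤n
  shadows-concatMap f (x ∷ xs) T c h = ≤-trans (≤-reflexive (shadows-++ (f x) (concatMap f xs) T))
    (+-mono-≤ (h x) (shadows-concatMap f xs T c h))

  private
    block : (Fin r → Bool) → Fin r → Fin r → List (Projection n)
    block M j j′ with M j | M j′ | j ≟ᴱ j′
    ... | false | _    | _      = single j ∷ []
    ... | true  | true | no ne  = double ne ∷ []
    ... | true  | _    | _      = []

    blocks : (Fin r → Bool) → List (Projection n)
    blocks M = concatMap (λ j → concatMap (block M j) (allFin r)) (allFin r)

    block∈ : ∀ M j j′ {b} → b List.∈ block M j j′ → b List.∈ blocks M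
    block∈ M j j′ h = List.∈-concatMap⁺ (λ j → concatMap (block M j) (allFin r))
      (List.lose (List.∈-allFin j) (List.∈-concatMap⁺ (block M j) (List.lose (List.∈-allFin j′) h)))

    single∈ : ∀ M j → M j ≡ false → single j List.∈ blocks M
    single∈ M j e = block∈ M j j (h e)
      where
      h : M j ≡ false → single j List.∈ block M j j
      h e with M j
      h refl | false = here refl

    double∈ : ∀ M j j′ → j ≢ j′ → j ∈ᶠ M → j′ ∈ᶠ M → ∃ λ (ne : j ≢ j′) → double ne List.∈ blocks M
    double∈ M j j′ ne e e′ = let (ne′ , p) = h e e′ in ne′ , block∈ M j j′ p
      where
      h : j ∈ᶠ M → j′ ∈ᶠ M → ∃ λ (ne : j ≢ j′) → double ne List.∈ block M j j′
      h e e′ with M j | M j′ | j ≟ᴱ j′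
      h refl refl | true | true | no ne′ = ne′ , here refl
      h refl refl | true | true | yes p  = ⊥-elim (ne p)

    shadow-double : ∀ {j j′} (ne : j ≢ j′) (T : Family) → shadow (double ne) T ≤ n ^ k
    shadow-double ne T = ≤-trans (#≤size _) (≤-reflexive (size-Vec n k))

    shadows-blocks : ∀ M (T : Family) c → (∀ j → M j ≡ false → shadow (single j) T ≤ c) → n ^ k ≤ c →
      shadows (blocks M) T ≤ r * (r * c)
    shadows-blocks M T c h h′ = subst (λ l → shadows (blocks M) T ≤ l * (r * c)) (List.length-tabulate {A = Fin r} id)
      (shadows-concatMap (λ j → concatMap (block M j) (allFin r)) (allFin r) T (r * c) λ j →
        subst (λ l → shadows (concatMap (block M j) (allFin r)) T ≤ l * c) (List.length-tabulate {A = Fin r} id)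
          (shadows-concatMap (block M j) (allFin r) T c (each j)))
      where
      each : ∀ j j′ → shadows (block M j j′) T ≤ c
      each j j′ with M j in eq | M j′ | j ≟ᴱ j′
      ... | false | _     | _      = ≤-trans (≤-reflexive (+-identityʳ _)) (h j eq)
      ... | true  | true  | no ne  = ≤-trans (≤-reflexive (+-identityʳ _)) (≤-trans (shadow-double ne T) h′)
      ... | true  | true  | yes _  = z≤n
      ... | true  | false | yes _  = z≤n
      ... | true  | false | no _   = z≤n

    all-or : ∀ {l} {A : Set} {B : Fin l → Set} → (∀ j → A ⊎ B j) → A ⊎ (∀ j → B j)
    all-or {zero} h = inj₂ λ ()
    all-or {suc l} {A} {B} h with h fzero | all-or {l} (λ j → h (fsuc j))
    ... | inj₁ a | _ = inj₁ a
    ... | inj₂ _ | inj₁ a = inj₁ a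
    ... | inj₂ b | inj₂ g = inj₂ λ { fzero → b ; (fsuc j) → g j }

  private
    not-marked : (Fin r → Bool) → ℕ
    not-marked M = # (λ j → M j Bool.≟ false)

  -- Unless a subfamily is stable for the given M, some position outside M has a large shadow;
  -- a transversal of it determines that position too, and M can be enlarged.
  homogeneous-or-small : ∀ l M (T : Family) → not-marked M ≤ l → (∀ j → j ∈ᶠ M → Own j T) →
    (∃ λ M′ → ∃ λ T* → T* ⊆ᶠ T × Homogeneous M′ T*) ⊎ # (_∈ᶠ? T) ≤ branching v k * cost v k l * n ^ k
  homogeneous-or-small l M T bound own = decide (all-or singles)
    where
    Found : Set
    Found = ∃ λ M′ → ∃ λ T* → T* ⊆ᶠ T × Homogeneous M′ T*
    singles : ∀ j → Found ⊎ (M j ≡ false → shadow (single j) T ≤ cost v k l * n ^ k)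
    singles j with M j Bool.≟ false
    ... | no h = inj₂ λ e → ⊥-elim (h e)
    ... | yes e = enlarge l bound
      where
      T′ = proj₁ (transversal (single j) T)
      M′ : Fin r → Bool
      M′ = ⟦ (λ i → (i ≟ᴱ j) ⊎-dec (M i Bool.≟ true)) ⟧
      M′⇒ : ∀ i → i ∈ᶠ M′ → i ≡ j ⊎ i ∈ᶠ M
      M′⇒ i = does⇒ ((i ≟ᴱ j) ⊎-dec (M i Bool.≟ true))
      ⇒M′ : ∀ i → i ≡ j ⊎ i ∈ᶠ M → i ∈ᶠ M′
      ⇒M′ i = ⇒does ((i ≟ᴱ j) ⊎-dec (M i Bool.≟ true))
      fewer : suc (not-marked M′) ≤ not-marked M
      fewer = ≤-trans (s≤s (#-mono (λ i → M′ i Bool.≟ false) (λ i → (M i Bool.≟ false) ×-dec ¬? (i ≟ᴱ j))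
          λ i h → Bool.¬-not (λ p → absurd h (⇒M′ i (inj₂ p))) , λ p → absurd h (⇒M′ i (inj₁ p))))
        (≤-reflexive (sym (#-remove (λ i → M i Bool.≟ false) j e)))
        where
        absurd : ∀ {b} → b ≡ false → b ≡ true → ⊥
        absurd refl ()
      T′⊆T : T′ ⊆ᶠ T
      T′⊆T = proj₁ (proj₂ (transversal (single j) T))
      own′ : ∀ i → i ∈ᶠ M′ → Own i T′
      own′ i h with M′⇒ i h
      ... | inj₁ refl = proj₁ (proj₂ (proj₂ (transversal (single j) T)))
      ... | inj₂ p = λ x y s t → own i p x y (T′⊆T x s) (T′⊆T y t)
      enlarge : ∀ l → not-marked M ≤ l → Found ⊎ (M j ≡ false → shadow (single j) T ≤ cost v k l * n ^ k)
      enlarge zero b = ⊥-elim (<⇒≱ (pos-# (λ j → M j Bool.≟ false) j e) b)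
      enlarge (suc l) b with homogeneous-or-small l M′ T′ (≤-pred (≤-trans fewer b)) own′
      ... | inj₁ (M″ , T* , sub , hom) = inj₁ (M″ , T* , (λ x h → T′⊆T x (sub x h)) , hom)
      ... | inj₂ small = inj₂ λ _ → ≤-trans (proj₂ (proj₂ (proj₂ (transversal (single j) T))))
              (≤-trans small (*-monoˡ-≤ (n ^ k) (cost-suc v k l)))
    decide : Found ⊎ (∀ j → M j ≡ false → shadow (single j) T ≤ cost v k l * n ^ k) →
             Found ⊎ # (_∈ᶠ? T) ≤ branching v k * cost v k l * n ^ k
    decide (inj₁ f) = inj₁ f
    decide (inj₂ h) with stable-or-small (2 * v) (blocks M) T
    ... | inj₁ (T* , sub , some , st) = inj₁ (M , T* , sub , some , own* ,
          (λ j e → swap-single j λ e′ t → All.lookup (st e′ t) (single∈ M j e)) ,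
          (λ j j′ ne p p′ → let (ne′ , mem) = double∈ M j j′ ne p p′ in
             swap-double ne′ (own* j p) (own* j′ p′) λ e′ t → All.lookup (st e′ t) mem))
      where
      own* : ∀ j → j ∈ᶠ M → Own j T*
      own* j p x y s t = own j p x y (sub x s) (sub y t)
    ... | inj₂ small = inj₂ (≤-trans small (≤-trans (*-monoʳ-≤ (2 * v)
            (shadows-blocks M T (cost v k l * n ^ k) h (≤-trans (≤-reflexive (sym (*-identityˡ _))) (*-monoˡ-≤ (n ^ k) (1≤cost v k l)))))
            (≤-reflexive (trans (branching-* v k (cost v k l * n ^ k)) (sym (*-assoc (branching v k) (cost v k l) (n ^ k)))))))

  -- The case without marks: every one-position shadow is bounded by assumption, and a single
  -- cleaning at all positions suffices.
  swappable-or-small : ∀ (T : Family) c → (∀ j → shadow (single j) T ≤ c) →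
    (∃ λ T* → T* ⊆ᶠ T × ∃ (_∈ᶠ T*) × (∀ j → Swappable T* (_≡ j))) ⊎ # (_∈ᶠ? T) ≤ 2 * v * (r * c)
  swappable-or-small T c h with stable-or-small (2 * v) (concatMap (λ j → single j ∷ []) (allFin r)) T
  ... | inj₂ small = inj₂ (≤-trans small (*-monoʳ-≤ (2 * v)
          (subst (λ l → shadows (concatMap (λ j → single j ∷ []) (allFin r)) T ≤ l * c) (List.length-tabulate {A = Fin r} id)
            (shadows-concatMap (λ j → single j ∷ []) (allFin r) T c (λ j → ≤-trans (≤-reflexive (+-identityʳ _)) (h j))))))
  ... | inj₁ (T* , sub , some , st) = inj₁ (T* , sub , some , λ q → swap-single q λ e t →
      All.lookup (st e t) (List.∈-concatMap⁺ (λ j → single j ∷ []) (List.lose (List.∈-allFin q) (here refl))))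

-- Rich kernels in an H-free hypergraph

module EdgeTuples {n : ℕ} (F : Hypergraph n) where

  Enumerates : ∀ {k} → Fin (m F) → Vec (Fin n) k → Set
  Enumerates i = Emb (_∈ edge F i)

  Enumerates? : ∀ {k} i (e : Vec (Fin n) k) → Dec (Enumerates i e)
  Enumerates? i = Emb? (_∈? edge F i)

  module _ {r : ℕ} (uniform : Uniform F r) where

    enumerates-surj : ∀ i (e : Vec (Fin n) r) → Enumerates i e → ∀ x → x ∈ edge F i → ∃ λ q → lookup e q ≡ x
    enumerates-surj i e h = Emb-surj (_∈? edge F i) e h (≤-reflexive (trans (#-∈ (edge F i)) (uniform i)))

    enumerates-unique : Simple F → ∀ i j (e : Vec (Fin n) r) → Enumerates i e → Enumerates j e → i ≡ j
    enumerates-unique simple i j e h h′ = simple (Subset.⊆-antisym (sub i j h h′) (sub j i h′ h))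
      where
      sub : ∀ i j → Enumerates i e → Enumerates j e → ∀ {x} → x ∈ edge F i → x ∈ edge F j
      sub i j h h′ {x} p with enumerates-surj i e h x p
      ... | q , refl = Emb-∈ e h′ q

    #-tuples : Simple F → {Q : Fin (m F) → Set} (Q? : ∀ i → Dec (Q i)) →
      ff r r * # Q? ≤ # (λ (e : Vec (Fin n) r) → ∃? λ i → Q? i ×-dec Enumerates? i e)
    #-tuples simple {Q} Q? = begin
      ff r r * # Q?
        ≡⟨ ∑-* (ff r r) (λ i → 𝟙 (Q? i)) ⟨
      ∑ (λ i → ff r r * 𝟙 (Q? i))
        ≡⟨ ∑-cong (λ i → trans (*-comm (ff r r) _) (cong (𝟙 (Q? i) *_)
             (sym (trans (#-Emb r (_∈? edge F i)) (cong (λ q → ff q r) (trans (#-∈ (edge F i)) (uniform i))))))) ⟩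
      ∑ (λ i → 𝟙 (Q? i) * # (Enumerates? {r} i))
        ≡⟨ ∑-cong (λ i → trans (sym (∑-* (𝟙 (Q? i)) _)) (∑-cong (λ e → sym (𝟙-× (Q? i) (Enumerates? i e))))) ⟩
      ∑ (λ i → ∑ (λ e → 𝟙 (Q? i ×-dec Enumerates? {r} i e)))
        ≡⟨ ∑-swap (λ i e → 𝟙 (Q? i ×-dec Enumerates? {r} i e)) ⟩
      ∑ (λ e → ∑ (λ i → 𝟙 (Q? i ×-dec Enumerates? {r} i e)))
        -- Passing from pairs of an edge and an enumeration to bare tuples loses nothing, since a
        -- tuple determines its edge in a simple hypergraph.
        ≤⟨ ∑-mono (λ e → at-most-one e) ⟩
      _ ∎
      where
      open ≤-Reasoning
      at-most-one : ∀ (e : Vec (Fin n) r) → # (λ i → Q? i ×-dec Enumerates? i e) ≤ 𝟙 (∃? λ i → Q? i ×-dec Enumerates? i e)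
      at-most-one e with ∃? (λ i → Q? i ×-dec Enumerates? i e)
      ... | d@(yes w) = ≤-trans (#≤1 _ λ { i j (_ , h) (_ , h′) → enumerates-unique simple i j e h h′ }) (≤-reflexive (sym (𝟙-yes d w)))
      ... | no ¬w = ≤-trans (≤-reflexive (#-none _ λ i h → ¬w (i , h))) z≤n

module HFree {v r′ : ℕ} (H : Hypergraph v) (uniformH : Uniform H (4 + r′))
  (tree : IsTreeOrdering H) (reducible : Reducible H (2 + r′))
  (S : Subset v) (cross : CrossCut H S)
  {n : ℕ} (F : Hypergraph n) (uniformF : Uniform F (4 + r′)) (v≤n : v ≤ n)
  (H⊈F : ¬ Contains F H) where

  r : ℕ
  r = 4 + r′

  open TreeStructure H uniformH tree reducible S cross public
  open EdgeTuples F public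
  open Tuples n v (2 + r′) public

  EdgeFamily : Family → Set
  EdgeFamily T = ∀ e → e ∈ᶠ T → ∃ λ i → Enumerates i e

  private
    X∉? : ∀ (a b c : Fin r) p → Dec (p ≢ a × p ≢ b × p ≢ c)
    X∉? a b c p = ¬? (p ≟ᴱ a) ×-dec ¬? (p ≟ᴱ b) ×-dec ¬? (p ≟ᴱ c)

  -- The exchanged tuple keeps the entries at `a`, `b`, `c` and avoids `Z` elsewhere. Its entries
  -- are the whole edge, so the edge meets `Z` in the kernel only.
  swap⇒rich : ∀ {T} → EdgeFamily T → ∀ a b c → Swappable T (λ p → p ≢ a × p ≢ b × p ≢ c) →
              ∀ e → e ∈ᶠ T → Rich F v (lookup e a) (lookup e b) (lookup e c)
  swap⇒rich T⊆ a b c sw e t Z with sw e t Z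
  ... | e′ , t′ , keep , av with T⊆ e′ t′
  ... | i , h = i , (at a (λ { (p , _) → p refl }) , at b (λ { (_ , p , _) → p refl }) , at c (λ { (_ , _ , p) → p refl })) , outside
    where
    at : ∀ q → ¬ (q ≢ a × q ≢ b × q ≢ c) → lookup e q ∈ edge F i
    at q ¬x = subst (_∈ edge F i) (keep q ¬x) (Emb-∈ e′ h q)
    outside : ∀ k → lookup Z k ∈ edge F i → lookup Z k ≡ lookup e a ⊎ lookup Z k ≡ lookup e b ⊎ lookup Z k ≡ lookup e c
    outside k z∈ with enumerates-surj uniformF i e′ h _ z∈
    ... | q , eq with X∉? a b c q
    ... | yes x = ⊥-elim (av q x k eq)
    ... | no ¬x with q ≟ᴱ a | q ≟ᴱ b | q ≟ᴱ c
    ... | yes refl | _ | _ = inj₁ (trans (sym eq) (keep q ¬x))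
    ... | no _ | yes refl | _ = inj₂ (inj₁ (trans (sym eq) (keep q ¬x)))
    ... | no _ | no _ | yes refl = inj₂ (inj₂ (trans (sym eq) (keep q ¬x)))
    ... | no p | no p′ | no p″ = ⊥-elim (¬x (p , p′ , p″))

  -- The pairs of entries at positions a and b form a graph of large minimum degree.
  swap⇒⊥ : ∀ {T} → EdgeFamily T → ∃ (_∈ᶠ T) → ∀ a b → a ≢ b → Swappable T (λ p → p ≢ a × p ≢ b) →
           Swappable T (_≢ a) → Swappable T (_≢ b) → ⊥
  swap⇒⊥ {T} T⊆ (e₀ , t₀) a b a≢b sw swa swb = H⊈F (embed-rich-pairs F uniformF v≤n {Γ} (record
    { symmetric = λ { u w (e , t , inj₁ h) → e , t , inj₂ h ; u w (e , t , inj₂ h) → e , t , inj₁ h }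
    ; irreflexive = irr
    ; start = lookup e₀ a , lookup e₀ b , e₀ , t₀ , inj₁ (refl , refl)
    ; neighbour = nbr }) rich)
    where
    Γ : Fin n → Fin n → Set
    Γ u w = ∃ λ e → e ∈ᶠ T × ((lookup e a ≡ u × lookup e b ≡ w) ⊎ (lookup e a ≡ w × lookup e b ≡ u))
    distinct : ∀ e → e ∈ᶠ T → lookup e a ≢ lookup e b
    distinct e t eq = a≢b (Emb-inj e (proj₂ (T⊆ e t)) a b eq)
    irr : ∀ u w → Γ u w → u ≢ w
    irr u w (e , t , inj₁ (refl , refl)) = distinct e t
    irr u w (e , t , inj₂ (refl , refl)) = distinct e t ∘ sym
    rich : ∀ u w → Γ u w → Rich F v u u w
    rich u w (e , t , inj₁ (refl , refl)) = swap⇒rich T⊆ a a b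
      (swap-≡ (λ { p (x , y) → x , x , y }) (λ { p (_ , x , y) → x , y }) sw) e t
    rich u w (e , t , inj₂ (refl , refl)) = swap⇒rich T⊆ b b a
      (swap-≡ (λ { p (x , y) → y , y , x }) (λ { p (_ , y , x) → x , y }) sw) e t
    nbr : ∀ u w → Γ u w → (Z : Vec (Fin n) v) → ∃ λ u′ → Γ u u′ × (∀ q → u′ ≢ lookup Z q)
    nbr u w (e , t , inj₁ (refl , refl)) Z with swa e t Z
    ... | e′ , t′ , keep , av = lookup e′ b , (e′ , t′ , inj₁ (keep a (λ h → h refl) , refl)) , av b (a≢b ∘ sym)
    nbr u w (e , t , inj₂ (refl , refl)) Z with swb e t Z
    ... | e′ , t′ , keep , av = lookup e′ a , (e′ , t′ , inj₂ (refl , keep b (λ h → h refl))) , av a a≢b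

  private
    fresh₃ : ∀ (a b c : Fin r) → ∃ λ q → q ≢ a × q ≢ b × q ≢ c
    fresh₃ a b c with fresh (s≤s (s≤s (s≤s (s≤s z≤n)))) (a ∷ b ∷ c ∷ [])
    ... | q , h = q , h fzero ∘ sym , h (fsuc fzero) ∘ sym , h (fsuc (fsuc fzero)) ∘ sym

    singles⇒swap : ∀ {T} {X : Fin r → Set} → (∀ q → Dec (X q)) → (∀ q → X q → Swappable T (_≡ q)) → Swappable T X
    singles⇒swap X? sw = swap-⋃ X? λ q x → q , x , swap-≡ (λ p → inj₁) (λ { p (inj₁ e) → e ; p (inj₂ e) → e }) (sw q x)

  module _ {T : Family} (T⊆ : EdgeFamily T) {M : Fin r → Bool} (hom : Homogeneous M T) where

    private
      some = proj₁ hom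
      singles = proj₁ (proj₂ (proj₂ hom))
      doubles = proj₂ (proj₂ (proj₂ hom))

      -- Unmarked positions are exchanged alone, marked ones with their partner. As partners avoid
      -- `a` and `b`, this exchanges the complements of {a, b}, {a} and {b}, as `swap⇒⊥` demands.
      partners⇒⊥ : ∀ a b → a ≢ b → (∀ j → ∃ λ j′ → j′ ∈ᶠ M × j′ ≢ j × j′ ≢ a × j′ ≢ b) → ⊥
      partners⇒⊥ a b a≢b partner = swap⇒⊥ T⊆ some a b a≢b
        (swap (λ p → ¬? (p ≟ᴱ a) ×-dec ¬? (p ≟ᴱ b)) (λ p → _,_))
        (swap (λ p → ¬? (p ≟ᴱ a)) (λ p x _ → x)) (swap (λ p → ¬? (p ≟ᴱ b)) (λ p _ x → x))
        where
        swap : {X : Fin r → Set} → (∀ q → Dec (X q)) → (∀ q → q ≢ a → q ≢ b → X q) → Swappable T X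
        swap {X} X? ⊇ = swap-⋃ X? cov
          where
          cov : ∀ q → X q → ∃ λ q′ → X q′ × Swappable T (λ p → p ≡ q ⊎ p ≡ q′)
          cov q x with M q in eq
          ... | false = q , x , swap-≡ (λ p → inj₁) (λ { p (inj₁ e) → e ; p (inj₂ e) → e }) (singles q eq)
          ... | true with partner q
          ... | q′ , q′∈ , ne , ≢a , ≢b = q′ , ⊇ q′ ≢a ≢b , doubles q q′ (ne ∘ sym) eq q′∈

    -- Two marked positions are impossible. If two positions are unmarked, take these as the pair;
    -- one of the two marked ones is always a partner. If at most one is unmarked, let the pair
    -- contain it: as r ≥ 4, a position other than `j` and the pair exists, and it is marked.
    homogeneous⇒centre : ∃ λ a → ∀ j → j ≢ a → Swappable T (_≡ j)
    homogeneous⇒centre with ∃? (_∈ᶠ? M)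
    ... | no none = fzero , λ j _ → singles j (Bool.¬-not λ p → none (j , p))
    ... | yes (a , a∈) with ∃? (λ j → (j ∈ᶠ? M) ×-dec ¬? (j ≟ᴱ a))
    ... | no none = a , λ j ne → singles j (Bool.¬-not λ p → none (j , p , ne))
    ... | yes (a′ , a′∈ , a′≢a) = ⊥-elim (two-marked (∃? λ b → (M b Bool.≟ false) ×-dec ∃? λ c → (M c Bool.≟ false) ×-dec ¬? (b ≟ᴱ c)))
      where
      clash : ∀ {x y} → x ∈ᶠ M → M y ≡ false → x ≢ y
      clash p q refl with trans (sym p) q
      ... | ()
      two-marked : Dec (∃ λ b → M b ≡ false × ∃ λ c → M c ≡ false × b ≢ c) → ⊥
      two-marked (yes (b , b∉ , c , c∉ , b≢c)) = partners⇒⊥ b c b≢c λ j → case j ≟ᴱ a of λ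
        { (no ne)  → a , a∈ , ne ∘ sym , clash a∈ b∉ , clash a∈ c∉
        ; (yes refl) → a′ , a′∈ , a′≢a , clash a′∈ b∉ , clash a′∈ c∉ }
      two-marked (no none) = one-unmarked (∃? λ b → M b Bool.≟ false)
        where
        finish : ∀ b → (∀ q → q ≢ b → q ∈ᶠ M) → ⊥
        finish b all with fresh₃ b b b
        ... | c , c≢b , _ = partners⇒⊥ b c (c≢b ∘ sym) λ j → let (q , h₁ , h₂ , h₃) = fresh₃ j b c in
              q , all q h₂ , h₁ , h₂ , h₃
        one-unmarked : Dec (∃ λ b → M b ≡ false) → ⊥
        one-unmarked (yes (b , b∉)) = finish b λ q ne → Bool.¬-not λ q∉ → none (b , b∉ , q , q∉ , ne ∘ sym)
        one-unmarked (no ¬b) = finish fzero λ q _ → Bool.¬-not λ q∉ → ¬b (q , q∉)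

  -- The cases `u = w` and `u = c` are included, so `c` also forms a rich pair with each other
  -- vertex of the edge.
  DominatedBy : Fin (m F) → Fin n → Set
  DominatedBy i c = c ∈ edge F i × (∀ u → u ∈ edge F i → ∀ w → w ∈ edge F i → Rich F v c u w)

  opaque
    DominatedBy? : ∀ i c → Dec (DominatedBy i c)
    DominatedBy? i c = (c ∈? edge F i) ×-dec ∀? λ u → (u ∈? edge F i) →-dec ∀? λ w → (w ∈? edge F i) →-dec Rich? F v c u w

  Dominated : Fin (m F) → Set
  Dominated i = ∃ (DominatedBy i)

  Dominated? : ∀ i → Dec (Dominated i)
  Dominated? i = ∃? (DominatedBy? i)

  centre⇒dominated : ∀ {T} → EdgeFamily T → ∀ a → (∀ j → j ≢ a → Swappable T (_≡ j)) →
    ∀ e → e ∈ᶠ T → ∀ i → Enumerates i e → Dominated i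
  centre⇒dominated {T} T⊆ a sw e t i h = lookup e a , Emb-∈ e h a , dom
    where
    rich : ∀ q q′ → Rich F v (lookup e a) (lookup e q) (lookup e q′)
    rich q q′ = swap⇒rich T⊆ a q q′ (singles⇒swap (X∉? a q q′) λ p x → sw p (proj₁ x)) e t
    dom : ∀ u → u ∈ edge F i → ∀ w → w ∈ edge F i → Rich F v (lookup e a) u w
    dom u u∈ w w∈ = let (q , eq) = enumerates-surj uniformF i e h u u∈ ; (q′ , eq′) = enumerates-surj uniformF i e h w w∈ in
      subst₂ (Rich F v (lookup e a)) eq eq′ (rich q q′)

  homogeneous⇒dominated : ∀ {T} → EdgeFamily T → ∀ {M} → Homogeneous M T →
    ∃ λ e → e ∈ᶠ T × (∀ i → Enumerates i e → Dominated i)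
  homogeneous⇒dominated T⊆ hom@((e , t) , _) = let (a , sw) = homogeneous⇒centre T⊆ hom in
    e , t , centre⇒dominated T⊆ a sw e t

  few-undominated : Simple F → ff r r * # (λ i → ¬? (Dominated? i)) ≤ branching v (2 + r′) * cost v (2 + r′) r * n ^ (2 + r′)
  few-undominated simple = ≤-trans (#-tuples uniformF simple (λ i → ¬? (Dominated? i)))
    (≤-trans (#-mono T₀? (_∈ᶠ? T₀) λ e → ⇒does (T₀? e)) (bound
      (homogeneous-or-small r (λ _ → false) T₀ (≤-trans (#≤size {A = Fin r} (λ _ → false Bool.≟ false)) (≤-reflexive (size-Fin r))) (λ _ ()))))
    where
    T₀? : ∀ (e : Vec (Fin n) r) → Dec (∃ λ i → ¬ Dominated i × Enumerates i e)
    T₀? e = ∃? λ i → ¬? (Dominated? i) ×-dec Enumerates? i e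
    T₀ : Family
    T₀ = ⟦ T₀? ⟧
    bound : (∃ λ M → ∃ λ T → T ⊆ᶠ T₀ × Homogeneous M T) ⊎ # (_∈ᶠ? T₀) ≤ branching v (2 + r′) * cost v (2 + r′) r * n ^ (2 + r′) →
            # (_∈ᶠ? T₀) ≤ branching v (2 + r′) * cost v (2 + r′) r * n ^ (2 + r′)
    bound (inj₂ small) = small
    bound (inj₁ (M , T , sub , hom)) =
      let (e , t , dom) = homogeneous⇒dominated (λ e t → let (i , _ , h) = does⇒ (T₀? e) (sub e t) in i , h) hom
          (i , ¬dom , h) = does⇒ (T₀? e) (sub e t)
      in ⊥-elim (¬dom (dom i h))

  -- The bound of an H-free family by a constant times its shadow: beyond it, exchanges at all
  -- single positions compose to those that `swap⇒⊥` refutes.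
  small-family : ∀ {T} → EdgeFamily T → ∀ c → (∀ j → shadow (single j) T ≤ c) → # (_∈ᶠ? T) ≤ 2 * v * (r * c)
  small-family {T} T⊆ c h with swappable-or-small T c h
  ... | inj₂ small = small
  ... | inj₁ (T* , sub , some , sw) = ⊥-elim (swap⇒⊥ (λ e t → T⊆ e (sub e t)) some fzero (fsuc fzero) (λ ())
          (singles⇒swap (λ p → ¬? (p ≟ᴱ fzero) ×-dec ¬? (p ≟ᴱ fsuc fzero)) λ q _ → sw q)
          (singles⇒swap (λ p → ¬? (p ≟ᴱ fzero)) λ q _ → sw q) (singles⇒swap (λ p → ¬? (p ≟ᴱ fsuc fzero)) λ q _ → sw q))

-- Falling factorials and binomial coefficients

ff-last : ∀ n k → ff n (suc k) ≡ ff n k * (n ∸ k)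
ff-last n zero = begin
  ff n 1              ≡⟨ ff-suc n 0 ⟩
  n * ff (n ∸ 1) 0    ≡⟨ cong (n *_) (ff-zero (n ∸ 1)) ⟩
  n * 1               ≡⟨ *-comm n 1 ⟩
  1 * n               ≡⟨ cong (_* n) (ff-zero n) ⟨
  ff n 0 * n          ∎
  where open ≡-Reasoning
ff-last n (suc k) = begin
  ff n (2 + k)                              ≡⟨ ff-suc n (suc k) ⟩
  n * ff (n ∸ 1) (suc k)                    ≡⟨ cong (n *_) (ff-last (n ∸ 1) k) ⟩
  n * (ff (n ∸ 1) k * (n ∸ 1 ∸ k))          ≡⟨ *-assoc n _ _ ⟨
  n * ff (n ∸ 1) k * (n ∸ 1 ∸ k)            ≡⟨ cong₂ _*_ (sym (ff-suc n k)) (∸-+-assoc n 1 k) ⟩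
  ff n (suc k) * (n ∸ suc k)                ∎
  where open ≡-Reasoning

C-ff : ∀ n k → (n C k) * ff k k ≡ ff n k
C-ff n zero = trans (*-identityˡ _) (trans (ff-zero 0) (sym (ff-zero n)))
C-ff zero (suc k) = sym (ff-suc 0 k)
C-ff (suc n) (suc k) = begin
  (suc n C suc k) * ff (suc k) (suc k)
    ≡⟨ cong₂ _*_ (sym (nCk+nC[k+1]≡[n+1]C[k+1] n k)) (ff-suc (suc k) k) ⟩
  ((n C k) + (n C suc k)) * (suc k * ff k k)
    ≡⟨ distribute (n C k) (n C suc k) (suc k) (ff k k) ⟩
  suc k * ((n C k) * ff k k) + (n C suc k) * (suc k * ff k k)
    ≡⟨ cong₂ (λ x y → suc k * x + (n C suc k) * y) (C-ff n k) (sym (ff-suc (suc k) k)) ⟩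
  suc k * ff n k + (n C suc k) * ff (suc k) (suc k)
    ≡⟨ cong (suc k * ff n k +_) (trans (C-ff n (suc k)) (ff-last n k)) ⟩
  suc k * ff n k + ff n k * (n ∸ k)
    ≡⟨ total ⟩
  suc n * ff n k
    ≡⟨ ff-suc (suc n) k ⟨
  ff (suc n) (suc k) ∎
  where
  open ≡-Reasoning
  distribute : ∀ a b s f → (a + b) * (s * f) ≡ s * (a * f) + b * (s * f)
  distribute = solve-∀
  ff-vanish : ∀ n k → n < k → ff n k ≡ 0
  ff-vanish zero    (suc k) lt = ff-suc 0 k
  ff-vanish (suc n) (suc k) lt = trans (ff-suc (suc n) k) (trans (cong (suc n *_) (ff-vanish n k (≤-pred lt))) (*-zeroʳ (suc n)))
  -- For k > n truncated subtraction spoils k + (n ∸ k) = n, but then `ff n k` is 0.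
  total : suc k * ff n k + ff n k * (n ∸ k) ≡ suc n * ff n k
  total with k ≤? n
  ... | yes k≤n = trans (cong (suc k * ff n k +_) (*-comm (ff n k) (n ∸ k)))
          (trans (sym (*-distribʳ-+ (ff n k) (suc k) (n ∸ k))) (cong (λ x → suc x * ff n k) (m+[n∸m]≡n k≤n)))
  ... | no k≰n rewrite ff-vanish n k (≰⇒> k≰n) | *-zeroʳ k | *-zeroʳ n = refl

C-mono : ∀ n k → (n C k) ≤ (suc n C k)
C-mono n zero    = ≤-refl
C-mono n (suc k) = ≤-trans (m≤n+m (n C suc k) (n C k)) (≤-reflexive (nCk+nC[k+1]≡[n+1]C[k+1] n k))

C-mono-+ : ∀ t n k → (n C k) ≤ ((t + n) C k)
C-mono-+ zero    n k = ≤-refl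
C-mono-+ (suc t) n k = ≤-trans (C-mono-+ t n k) (C-mono (t + n) k)

-- Adding t vertices one by one, each creates at least `n C a` new sets by Pascal's rule.
C-telescope : ∀ t n a → (n C suc a) + t * (n C a) ≤ ((t + n) C suc a)
C-telescope zero    n a = ≤-reflexive (+-identityʳ _)
C-telescope (suc t) n a = begin
  (n C suc a) + ((n C a) + t * (n C a))     ≡⟨ rearrange (n C suc a) (n C a) (t * (n C a)) ⟩
  (n C a) + ((n C suc a) + t * (n C a))     ≤⟨ +-mono-≤ (C-mono-+ t n a) (C-telescope t n a) ⟩
  ((t + n) C a) + ((t + n) C suc a)         ≡⟨ nCk+nC[k+1]≡[n+1]C[k+1] (t + n) a ⟩
  (suc (t + n) C suc a)                     ∎
  where
  open ≤-Reasoning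
  rearrange : ∀ a b c → a + (b + c) ≡ b + (a + c)
  rearrange = solve-∀

C-difference : ∀ n t a → t ≤ n → t * ((n ∸ t) C a) ≤ (n C suc a) ∸ ((n ∸ t) C suc a)
C-difference n t a t≤n = m+n≤o⇒n≤o∸m ((n ∸ t) C suc a)
  (subst (λ z → ((n ∸ t) C suc a) + t * ((n ∸ t) C a) ≤ (z C suc a)) (m+[n∸m]≡n t≤n) (C-telescope t (n ∸ t) a))
  where
  m+n≤o⇒n≤o∸m : ∀ m {n o} → m + n ≤ o → n ≤ o ∸ m
  m+n≤o⇒n≤o∸m m {n} {o} h = ≤-trans (≤-reflexive (sym (m+n∸m≡n m n))) (∸-monoˡ-≤ m h)

ff≤^ : ∀ q k → ff q k ≤ q ^ k
ff≤^ q zero    = ≤-reflexive (ff-zero q)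
ff≤^ q (suc k) = ≤-trans (≤-reflexive (ff-suc q k))
  (*-monoʳ-≤ q (≤-trans (ff≤^ (q ∸ 1) k) (^-monoˡ-≤ k (m∸n≤m q 1))))

^≤ff : ∀ q k → (q ∸ k) ^ k ≤ ff q k
^≤ff q zero    = ≤-reflexive (sym (ff-zero q))
^≤ff q (suc k) = ≤-trans (*-mono-≤ (m∸n≤m q (suc k))
  (≤-trans (≤-reflexive (cong (_^ k) (sym (∸-+-assoc q 1 k)))) (^≤ff (q ∸ 1) k))) (≤-reflexive (sym (ff-suc q k)))

ff-pos : ∀ q k → k ≤ q → 1 ≤ ff q k
ff-pos q       zero    _  = ≤-reflexive (sym (ff-zero q))
ff-pos (suc q) (suc k) le = ≤-trans (*-mono-≤ (s≤s (z≤n {q})) (ff-pos q k (≤-pred le))) (≤-reflexive (sym (ff-suc (suc q) k)))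

ff-mono : ∀ {q q′} k → q ≤ q′ → ff q k ≤ ff q′ k
ff-mono {q} {q′} zero    h = ≤-reflexive (trans (ff-zero q) (sym (ff-zero q′)))
ff-mono {q} {q′} (suc k) h = ≤-trans (≤-reflexive (ff-suc q k))
  (≤-trans (*-mono-≤ h (ff-mono k (∸-monoˡ-≤ 1 h))) (≤-reflexive (sym (ff-suc q′ k))))

-- Replacing one factor n by n - d at a time loses at most d n^k, and there are k + 1 factors.
bernoulli : ∀ n d k → n ^ suc k ≤ (n ∸ d) ^ suc k + suc k * d * n ^ k
bernoulli n d k = go k
  where
  open ≤-Reasoning
  x = n ∸ d
  n≤x+d : n ≤ x + d
  n≤x+d = ≤-trans (m≤n+m∸n n d) (≤-reflexive (+-comm d x))
  go : ∀ k → n ^ suc k ≤ x ^ suc k + suc k * d * n ^ k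
  go zero = begin
    n * 1                        ≤⟨ *-monoˡ-≤ 1 n≤x+d ⟩
    (x + d) * 1                  ≡⟨ h x d ⟩
    x * 1 + (d + 0) * 1          ∎
    where
    h : ∀ x d → (x + d) * 1 ≡ x * 1 + (d + 0) * 1
    h = solve-∀
  go (suc k) = begin
    n * n ^ suc k
      ≤⟨ *-monoʳ-≤ n (go k) ⟩
    n * (x ^ suc k + suc k * d * n ^ k)
      ≡⟨ h₁ n (x ^ suc k) (suc k * d) (n ^ k) ⟩
    n * x ^ suc k + suc k * d * n ^ suc k
      ≤⟨ +-monoˡ-≤ _ (*-monoˡ-≤ (x ^ suc k) n≤x+d) ⟩
    (x + d) * x ^ suc k + suc k * d * n ^ suc k
      ≡⟨ h₂ x d (x ^ suc k) (suc k * d * n ^ suc k) ⟩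
    x ^ suc (suc k) + (d * x ^ suc k + suc k * d * n ^ suc k)
      ≤⟨ +-monoʳ-≤ (x ^ suc (suc k)) (+-monoˡ-≤ _ (*-monoʳ-≤ d (^-monoˡ-≤ (suc k) (m∸n≤m n d)))) ⟩
    x ^ suc (suc k) + (d * n ^ suc k + suc k * d * n ^ suc k)
      ≡⟨ cong (x ^ suc (suc k) +_) (sym (*-distribʳ-+ (n ^ suc k) d (suc k * d))) ⟩
    x ^ suc (suc k) + suc (suc k) * d * n ^ suc k ∎
    where
    h₁ : ∀ n y s z → n * (y + s * z) ≡ n * y + s * (n * z)
    h₁ = solve-∀
    h₂ : ∀ x d y z → (x + d) * y + z ≡ x * y + (d * y + z)
    h₂ = solve-∀

ff-lower : ∀ n d k → n ^ suc k ≤ ff (n ∸ d) (suc k) + suc k * (d + suc k) * n ^ k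
ff-lower n d k = ≤-trans (bernoulli n (d + suc k) k)
  (+-monoˡ-≤ _ (≤-trans (≤-reflexive (cong (_^ suc k) (sym (∸-+-assoc n d (suc k))))) (^≤ff (n ∸ d) (suc k))))

-- Stability

∑-∷₃ : ∀ {n k} (f : Vec (Fin n) (3 + k) → ℕ) →
       ∑ f ≡ ∑ (λ u → ∑ (λ w → ∑ (λ z → ∑ (λ τ → f (u ∷ w ∷ z ∷ τ)))))
∑-∷₃ f = trans (∑-∷ f) (∑-cong λ u → trans (∑-∷ _) (∑-cong λ w → ∑-∷ _))

∑-Fin : ∀ {n} (c : ℕ) → ∑ {Fin n} (λ _ → c) ≡ n * c
∑-Fin {n} c = trans (∑-const c) (cong (_* c) (size-Fin n))

∑-Vec : ∀ {n k} (c : ℕ) → ∑ {Vec (Fin n) k} (λ _ → c) ≡ n ^ k * c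
∑-Vec {n} {k} c = trans (∑-const c) (cong (_* c) (size-Vec n k))

module Heavy {v r′ : ℕ} (H : Hypergraph v) (uniformH : Uniform H (4 + r′))
  (tree : IsTreeOrdering H) (reducible : Reducible H (2 + r′))
  (S : Subset v) (cross : CrossCut H S)
  {n : ℕ} (F : Hypergraph n) (uniformF : Uniform F (4 + r′)) (v≤n : v ≤ n)
  (H⊈F : ¬ Contains F H) (simple : Simple F) (t : ℕ) (∣S∣ : ∣ S ∣ ≡ suc t) (N : ℕ) where

  open HFree H uniformH tree reducible S cross F uniformF v≤n H⊈F public

  private
    a = 3 + r′

  Adjacent : Fin n → Fin n → Set
  Adjacent c b = c ≢ b × Rich F v c c b

  opaque
    Adjacent? : ∀ c b → Dec (Adjacent c b)
    Adjacent? c b = ¬? (c ≟ᴱ b) ×-dec Rich? F v c c b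

  private
    Rich-flip : ∀ {u w} → Rich F v w w u → Rich F v u u w
    Rich-flip h Z with h Z
    ... | i , (p , _ , q) , out = i , (q , q , p) , λ k z → case out k z of λ
      { (inj₁ e) → inj₂ (inj₂ e) ; (inj₂ (inj₁ e)) → inj₂ (inj₂ e) ; (inj₂ (inj₂ e)) → inj₁ e }

  d : Fin n → ℕ
  d c = # (Adjacent? c)

  ∑d : ∑ d ≤ 2 * v * n
  ∑d = sparse {v = v} Adjacent? λ {Γ} sy st nb sub → H⊈F (embed-rich-pairs F uniformF v≤n {Γ}
    (record { symmetric = sy ; start = st ; neighbour = nb ; irreflexive = λ u w g → irr (sub u w g) })
    λ u w g → rich (sub u w g))
    where
    irr : ∀ {u w} → Adjacent u w ⊎ Adjacent w u → u ≢ w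
    irr (inj₁ (ne , _)) = ne
    irr (inj₂ (ne , _)) = ne ∘ sym
    rich : ∀ {u w} → Adjacent u w ⊎ Adjacent w u → Rich F v u u w
    rich (inj₁ (_ , h)) = h
    rich (inj₂ (_ , h)) = Rich-flip h

  -- Degree at least n / N in the graph of rich pairs. There are boundedly many such vertices, and
  -- `N` will be so large that the other centres contribute little.
  Big : Fin n → Set
  Big c = n ≤ N * d c

  opaque
    Big? : ∀ c → Dec (Big c)
    Big? c = n ≤? N * d c

  #Big : .{{_ : NonZero n}} → # Big? ≤ N * (2 * v)
  #Big = *-cancelʳ-≤ (# Big?) (N * (2 * v)) n (begin
    # Big? * n                  ≡⟨ ∑-*ʳ (λ c → 𝟙 (Big? c)) n ⟨
    ∑ (λ c → 𝟙 (Big? c) * n)    ≤⟨ ∑-mono (λ c → 𝟙*≤ (Big? c) id) ⟩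
    ∑ (λ c → N * d c)           ≡⟨ ∑-* N d ⟩
    N * ∑ d                     ≤⟨ *-monoʳ-≤ N ∑d ⟩
    N * (2 * v * n)             ≡⟨ *-assoc N (2 * v) n ⟨
    N * (2 * v) * n             ∎)
    where open ≤-Reasoning

  Pointed : Fin n → Vec (Fin n) a → Set
  Pointed c y = ∃ λ i → DominatedBy i c × Enumerates i (c ∷ y)

  opaque
    Pointed? : ∀ c y → Dec (Pointed c y)
    Pointed? c y = ∃? λ i → DominatedBy? i c ×-dec Enumerates? i (c ∷ y)

  many-pointed : ff a a * # Dominated? ≤ ∑ (λ c → # (Pointed? c))
  many-pointed = begin
    ff a a * # Dominated?
      ≡⟨ trans (sym (∑-* (ff a a) (λ i → 𝟙 (Dominated? i)))) (∑-cong λ i → *-comm (ff a a) _) ⟩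
    ∑ (λ i → 𝟙 (Dominated? i) * ff a a)
      ≤⟨ ∑-mono (λ i → 𝟙*≤ (Dominated? i) (by-centre i)) ⟩
    ∑ (λ i → ∑ (λ c → # (with-edge? i c)))
      ≡⟨ ∑-swap (λ i c → # (with-edge? i c)) ⟩
    ∑ (λ c → ∑ (λ i → # (with-edge? i c)))
      ≡⟨ ∑-cong (λ c → ∑-swap (λ i y → 𝟙 (with-edge? i c y))) ⟩
    ∑ (λ c → ∑ (λ y → # (λ i → with-edge? i c y)))
      ≤⟨ ∑-mono (λ c → ∑-mono (at-most-one c)) ⟩
    ∑ (λ c → # (Pointed? c)) ∎
    where
    open ≤-Reasoning
    with-edge? : ∀ i c (y : Vec (Fin n) a) → Dec (DominatedBy i c × Enumerates i (c ∷ y))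
    with-edge? i c y = DominatedBy? i c ×-dec Enumerates? i (c ∷ y)
    rest? : ∀ i c y → Dec (y ∈ edge F i × y ≢ c)
    rest? i c y = (y ∈? edge F i) ×-dec ¬? (y ≟ᴱ c)
    #rest : ∀ i c → c ∈ edge F i → # (rest? i c) ≡ a
    #rest i c p = suc-injective (trans (sym (#-remove (_∈? edge F i) c p)) (trans (#-∈ (edge F i)) (uniformF i)))
    by-centre : ∀ i → Dominated i → ff a a ≤ ∑ (λ c → # (with-edge? i c))
    by-centre i (c , dom) = begin
      ff a a                         ≡⟨ cong (λ q → ff q a) (sym (#rest i c (proj₁ dom))) ⟩
      ff (# (rest? i c)) a           ≡⟨ #-Emb a (rest? i c) ⟨
      # (Emb? {k = a} (rest? i c))   ≤⟨ #-mono (Emb? {k = a} (rest? i c)) (with-edge? i c) (λ y h → dom , proj₁ dom , h) ⟩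
      # (with-edge? i c)             ≤⟨ ∑-≥ (λ c → # (with-edge? i c)) c ⟩
      ∑ (λ c → # (with-edge? i c))   ∎
    at-most-one : ∀ c y → # (λ i → with-edge? i c y) ≤ 𝟙 (Pointed? c y)
    at-most-one c y with Pointed? c y
    ... | p@(yes w) = ≤-trans (#≤1 (λ i → with-edge? i c y) λ { i j (_ , h) (_ , h′) → enumerates-unique uniformF simple i j (c ∷ y) h h′ })
          (≤-reflexive (sym (𝟙-yes p w)))
    ... | no ¬w = ≤-trans (≤-reflexive (#-none (λ i → with-edge? i c y) λ i h → ¬w (i , h))) z≤n

  pointed⇒adjacent : ∀ c y → Pointed c y → Emb (Adjacent c) y
  pointed⇒adjacent c y (i , (c∈ , rich) , _ , h) = Emb-mono y (λ { x (x∈ , ne) → ne ∘ sym , rich c c∈ x x∈ }) h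

  -- All entries of `y` are adjacent to `c`, so at most d(c)^(r-1) tuples are pointed at `c`. One
  -- factor is traded for n / N, one is kept and summed by `∑d`, the others are at most n.
  pointed-at-small : N * ∑ (λ c → 𝟙 (¬? (Big? c)) * # (Pointed? c)) ≤ 2 * v * n ^ a
  pointed-at-small = begin
    N * ∑ (λ c → 𝟙 (¬? (Big? c)) * # (Pointed? c))   ≡⟨ ∑-* N _ ⟨
    ∑ (λ c → N * (𝟙 (¬? (Big? c)) * # (Pointed? c))) ≤⟨ ∑-mono each ⟩
    ∑ (λ c → d c * n ^ (2 + r′))                     ≡⟨ ∑-*ʳ d (n ^ (2 + r′)) ⟩
    ∑ d * n ^ (2 + r′)                               ≤⟨ *-monoˡ-≤ (n ^ (2 + r′)) ∑d ⟩
    2 * v * n * n ^ (2 + r′)                         ≡⟨ *-assoc (2 * v) n _ ⟩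
    2 * v * n ^ a                                    ∎
    where
    open ≤-Reasoning
    rearrange : ∀ N d X → N * (d * (d * X)) ≡ d * (N * d * X)
    rearrange = solve-∀
    small : ∀ c → ¬ Big c → N * # (Pointed? c) ≤ d c * n ^ (2 + r′)
    small c ¬big = begin
      N * # (Pointed? c)                      ≤⟨ *-monoʳ-≤ N (#-mono (Pointed? c) (Emb? {k = a} (Adjacent? c)) (pointed⇒adjacent c)) ⟩
      N * # (Emb? {k = a} (Adjacent? c))      ≡⟨ cong (N *_) (#-Emb a (Adjacent? c)) ⟩
      N * ff (d c) a                          ≤⟨ *-monoʳ-≤ N (ff≤^ (d c) a) ⟩
      N * (d c * (d c * d c ^ (1 + r′)))      ≡⟨ rearrange N (d c) (d c ^ (1 + r′)) ⟩
      d c * (N * d c * d c ^ (1 + r′))        ≤⟨ *-monoʳ-≤ (d c) (*-mono-≤ (<⇒≤ (≰⇒> ¬big))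
                                                   (^-monoˡ-≤ (1 + r′) (≤-trans (#≤size (Adjacent? c)) (≤-reflexive (size-Fin n))))) ⟩
      d c * (n * n ^ (1 + r′))                ∎
    each : ∀ c → N * (𝟙 (¬? (Big? c)) * # (Pointed? c)) ≤ d c * n ^ (2 + r′)
    each c = by-cases (¬? (Big? c))
      where
      by-cases : (q : Dec (¬ Big c)) → N * (𝟙 q * # (Pointed? c)) ≤ d c * n ^ (2 + r′)
      by-cases q@(yes h) rewrite 𝟙-yes q h | +-identityʳ (# (Pointed? c)) = small c h
      by-cases q@(no h) rewrite 𝟙-no q h | *-zeroʳ N = z≤n

  Listed : Vec (Fin n) a → Fin n → Set
  Listed y c = Big c × Pointed c y

  Listed? : ∀ y c → Dec (Listed y c)
  Listed? y c = Big? c ×-dec Pointed? c y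

  pointed-split : ∑ (λ c → # (Pointed? c)) ≡ ∑ (λ y → # (Listed? y)) + ∑ (λ c → 𝟙 (¬? (Big? c)) * # (Pointed? c))
  pointed-split = begin
    ∑ (λ c → # (Pointed? c))
      ≡⟨ ∑-cong (λ c → split (Big? c) (¬? (Big? c)) (# (Pointed? c))) ⟩
    ∑ (λ c → 𝟙 (Big? c) * # (Pointed? c) + 𝟙 (¬? (Big? c)) * # (Pointed? c))
      ≡⟨ ∑-+ (λ c → 𝟙 (Big? c) * # (Pointed? c)) (λ c → 𝟙 (¬? (Big? c)) * # (Pointed? c)) ⟩
    ∑ (λ c → 𝟙 (Big? c) * # (Pointed? c)) + rest
      ≡⟨ cong (_+ rest) (∑-cong (λ c → trans (sym (∑-* (𝟙 (Big? c)) (λ y → 𝟙 (Pointed? c y))))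
           (∑-cong λ y → sym (𝟙-× (Big? c) (Pointed? c y))))) ⟩
    ∑ (λ c → ∑ (λ y → 𝟙 (Listed? y c))) + rest
      ≡⟨ cong (_+ rest) (∑-swap (λ c y → 𝟙 (Listed? y c))) ⟩
    ∑ (λ y → # (Listed? y)) + rest ∎
    where
    open ≡-Reasoning
    rest = ∑ (λ c → 𝟙 (¬? (Big? c)) * # (Pointed? c))
    split : {P : Set} (p : Dec P) (q : Dec (¬ P)) (x : ℕ) → x ≡ 𝟙 p * x + 𝟙 q * x
    split p@(yes h) q x rewrite 𝟙-yes p h | 𝟙-no q (λ f → f h) | +-identityʳ x | +-identityʳ x = refl
    split p@(no h) q x rewrite 𝟙-no p h | 𝟙-yes q h | +-identityʳ x = refl

  Tied : Fin n → Fin n → Fin n → Set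
  Tied u w c = Big c × u ≢ w × Rich F v c u w

  opaque
    Tied? : ∀ u w c → Dec (Tied u w c)
    Tied? u w c = Big? c ×-dec ¬? (u ≟ᴱ w) ×-dec Rich? F v c u w

  Over : Fin n → Fin n → Set
  Over u w = t < # (Tied? u w)

  opaque
    Over? : ∀ u w → Dec (Over u w)
    Over? u w = t <? # (Tied? u w)

  -- t + 1 common centres for more than linearly many pairs would carry the whole cross-cut.
  common-sparse : (A : Vec (Fin n) (suc t)) → ∑ (λ u → # (λ w → Emb? (Tied? u w) A)) ≤ 2 * v * n
  common-sparse A = sparse {v = v} (λ u w → Emb? (Tied? u w) A) λ {Γ} sy st nb sub → H⊈F
    (contra {Γ} sy st nb sub)
    where
    ρ-data : ∃ λ (f : Fin v → Fin (suc t)) → InjOn (_∈ S) f × (∀ x → x ∈ S → ⊤)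
    ρ-data = injection (_∈? S) (λ _ → yes tt) (λ _ → fzero)
      (≤-reflexive (trans (trans (#-∈ S) ∣S∣) (sym #-full)))
    ρ : Fin v → Fin n
    ρ x = lookup A (proj₁ ρ-data x)
    contra : {Γ : Fin n → Fin n → Set} → (∀ u w → Γ u w → Γ w u) → (∃ λ u → ∃ λ w → Γ u w) →
      (∀ u w → Γ u w → (Z : Vec (Fin n) v) → ∃ λ u′ → Γ u u′ × (∀ q → u′ ≢ lookup Z q)) →
      (∀ u w → Γ u w → Emb (Tied u w) A ⊎ Emb (Tied w u) A) → Contains F H
    contra {Γ} sy st@(u₀ , w₀ , g₀) nb sub = embed-rich-triples F uniformF v≤n ρ
      (λ x y p q e → proj₁ (proj₂ ρ-data) x y p q (A-inj (sub u₀ w₀ g₀) e)) {Γ}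
      (record { symmetric = sy ; start = st ; neighbour = nb ; irreflexive = λ u w g → irr (sub u w g) })
      λ x _ u w g → rich (proj₁ ρ-data x) (sub u w g)
      where
      A-inj : ∀ {i j u w} → Emb (Tied u w) A ⊎ Emb (Tied w u) A → lookup A i ≡ lookup A j → i ≡ j
      A-inj (inj₁ h) = Emb-inj A h _ _
      A-inj (inj₂ h) = Emb-inj A h _ _
      irr : ∀ {u w} → Emb (Tied u w) A ⊎ Emb (Tied w u) A → u ≢ w
      irr (inj₁ h) = proj₁ (proj₂ (Emb-∈ A h fzero))
      irr (inj₂ h) = proj₁ (proj₂ (Emb-∈ A h fzero)) ∘ sym
      rich : ∀ {u w} q → Emb (Tied u w) A ⊎ Emb (Tied w u) A → Rich F v (lookup A q) u w
      rich q (inj₁ h) = proj₂ (proj₂ (Emb-∈ A h q))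
      rich q (inj₂ h) = Rich-swap F (proj₂ (proj₂ (Emb-∈ A h q)))

  -- A pair with more than t tied centres is tied to all entries of some (t + 1)-tuple of distinct
  -- big vertices. These tuples are bounded in number, and `common-sparse` bounds the pairs of each.
  few-over : .{{_ : NonZero n}} → ∑ (λ u → # (Over? u)) ≤ (N * (2 * v)) ^ suc t * (2 * v * n)
  few-over = begin
    ∑ (λ u → # (Over? u))
      ≤⟨ ∑-mono (λ u → ∑-mono λ w → 𝟙≤ (Over? u w) λ h → ≤-trans (ff-pos (# (Tied? u w)) (suc t) h)
           (≤-reflexive (sym (#-Emb (suc t) (Tied? u w))))) ⟩
    ∑ (λ u → ∑ (λ w → # (Emb? {k = suc t} (Tied? u w))))
      ≡⟨ ∑-cong (λ u → ∑-swap (λ w A → 𝟙 (Emb? {k = suc t} (Tied? u w) A))) ⟩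
    ∑ (λ u → ∑ (λ A → # (λ w → Emb? {k = suc t} (Tied? u w) A)))
      ≡⟨ ∑-swap (λ u A → # (λ w → Emb? {k = suc t} (Tied? u w) A)) ⟩
    ∑ (λ A → ∑ (λ u → # (λ w → Emb? {k = suc t} (Tied? u w) A)))
      ≤⟨ ∑-mono each ⟩
    ∑ (λ A → 𝟙 (Emb? {k = suc t} Big? A) * (2 * v * n))
      ≡⟨ ∑-*ʳ (λ A → 𝟙 (Emb? {k = suc t} Big? A)) (2 * v * n) ⟩
    # (Emb? {k = suc t} Big?) * (2 * v * n)
      ≤⟨ *-monoˡ-≤ (2 * v * n) (≤-trans (≤-reflexive (#-Emb (suc t) Big?))
           (≤-trans (ff≤^ (# Big?) (suc t)) (^-monoˡ-≤ (suc t) #Big))) ⟩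
    (N * (2 * v)) ^ suc t * (2 * v * n) ∎
    where
    open ≤-Reasoning
    each : ∀ A → ∑ (λ u → # (λ w → Emb? {k = suc t} (Tied? u w) A)) ≤ 𝟙 (Emb? {k = suc t} Big? A) * (2 * v * n)
    each A with Emb? {k = suc t} Big? A
    ... | p@(yes h) rewrite 𝟙-yes p h = ≤-trans (common-sparse A) (≤-reflexive (sym (+-identityʳ _)))
    ... | no ¬h = ≤-trans (≤-reflexive (trans (∑-cong λ u → #-none (λ w → Emb? (Tied? u w) A)
            λ w h → ¬h (Emb-mono A (λ _ → proj₁) h)) ∑-0)) z≤n

  listed⇒tied : ∀ y c → Listed y c → ∀ i j → i ≢ j → Tied (lookup y i) (lookup y j) c
  listed⇒tied y c (big , i , (c∈ , rich) , _ , h) p q p≢q = big , (λ e → p≢q (Emb-inj y h p q e)) ,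
    rich _ (proj₁ (Emb-∈ y h p)) _ (proj₁ (Emb-∈ y h q))

-- Constants and averaging for the stability argument

opaque
  -- The factor pays for the two errors in `few-bad`: `2 * v` for centres of small degree, 1 for all
  -- terms of order n^(r-2).
  scale : ℕ → ℕ → ℕ
  scale v N′ = (1 + 2 * v) * N′

  scale-≡ : ∀ v N′ → scale v N′ ≡ (1 + 2 * v) * N′
  scale-≡ v N′ = refl

  -- In units of n^(r-2): the undominated edges, and t times the gap between n^(r-1) and the falling
  -- factorial of n - t.
  lower-loss : ℕ → ℕ → ℕ → ℕ
  lower-loss v r′ t = branching v (2 + r′) * cost v (2 + r′) (4 + r′) + t * ((3 + r′) * (t + (3 + r′)))

  lower-loss-≡ : ∀ v r′ t → lower-loss v r′ t ≡
    branching v (2 + r′) * cost v (2 + r′) (4 + r′) + t * ((3 + r′) * (t + (3 + r′)))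
  lower-loss-≡ v r′ t = refl

  over-bound : ℕ → ℕ → ℕ → ℕ
  over-bound v t N = (N * (2 * v)) ^ suc t * (2 * v)

  over-bound-≡ : ∀ v t N → over-bound v t N ≡ (N * (2 * v)) ^ suc t * (2 * v)
  over-bound-≡ v t N = refl

  -- Beyond this n all terms of order n^(r-2), multiplied by `N`, are at most n^(r-1).
  stability-threshold : ℕ → ℕ → ℕ → ℕ → ℕ
  stability-threshold v r′ t N′ = N * (lower-loss v r′ t + N * (2 * v) * over-bound v t N + 3 * over-bound v t N)
    where
    N : ℕ
    N = scale v N′

  stability-threshold-≡ : ∀ v r′ t N′ → stability-threshold v r′ t N′ ≡
    scale v N′ * (lower-loss v r′ t + scale v N′ * (2 * v) * over-bound v t (scale v N′) + 3 * over-bound v t (scale v N′))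
  stability-threshold-≡ v r′ t N′ = refl

-- Here x is the length of a list of centres, at most t unless the first pair of the tuple is over
-- (`p`), and less than t when the tuple is low (`q`). Summed over tuples, this turns an average
-- length near t into a bound on low tuples.
surplus : {P Q : Set} (p : Dec P) (q : Dec Q) {x t K : ℕ} → (Q → x < t) → (¬ P → x ≤ t) → x ≤ K →
          x + 𝟙 q ≤ t + 𝟙 p * K
surplus p q@(yes y) {x} {t} below _ _ = ≤-trans (+-monoʳ-≤ x (𝟙≤1 q))
  (≤-trans (≤-reflexive (+-comm x 1)) (≤-trans (below y) (m≤m+n t _)))
surplus p@(yes h) q@(no n) {x} {t} {K} _ _ x≤K rewrite 𝟙-no q n | 𝟙-yes p h | +-identityʳ x | +-identityʳ K =
  ≤-trans x≤K (m≤n+m K t)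
surplus p@(no h) q@(no n) {x} {t} _ x≤t _ rewrite 𝟙-no q n | +-identityʳ x = ≤-trans (x≤t h) (m≤m+n t _)

some-≥1 : ∀ a b c d → 1 ≤ a ⊎ 1 ≤ b ⊎ 1 ≤ c ⊎ 1 ≤ d → 1 ≤ a + (b + (c + d))
some-≥1 a b c d (inj₁ h) = ≤-trans h (m≤m+n a _)
some-≥1 a b c d (inj₂ (inj₁ h)) = ≤-trans (≤-trans h (m≤m+n b _)) (m≤n+m _ a)
some-≥1 a b c d (inj₂ (inj₂ (inj₁ h))) = ≤-trans (≤-trans (≤-trans h (m≤m+n c d)) (m≤n+m _ b)) (m≤n+m _ a)
some-≥1 a b c d (inj₂ (inj₂ (inj₂ h))) = ≤-trans (≤-trans (≤-trans h (m≤n+m d c)) (m≤n+m _ b)) (m≤n+m _ a)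

𝟙-≥1 : {P : Set} (p : Dec P) → P → 1 ≤ 𝟙 p
𝟙-≥1 p h = ≤-reflexive (sym (𝟙-yes p h))

𝟙-⊎⁴ : {P Q R T : Set} (p : Dec P) (q : Dec Q) (r : Dec R) (s : Dec T) →
        𝟙 (p ⊎-dec q ⊎-dec r ⊎-dec s) ≤ 𝟙 p + (𝟙 q + (𝟙 r + 𝟙 s))
𝟙-⊎⁴ p q r s = 𝟙≤ (p ⊎-dec q ⊎-dec r ⊎-dec s) λ b → some-≥1 _ _ _ _
  (Sum.map (𝟙-≥1 p) (Sum.map (𝟙-≥1 q) (Sum.map (𝟙-≥1 r) (𝟙-≥1 s))) b)

module _ {n k : ℕ} (1≤n : 1 ≤ n) where

  private
    x₀ : Fin n
    x₀ = fromℕ< 1≤n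

    instance
      n≢0 : NonZero n
      n≢0 = >-nonZero 1≤n

  average-Fin : (f : Fin n → ℕ) → ∃ λ x → n * f x ≤ ∑ f
  average-Fin f = let (x , h) = average f x₀ in x , subst (λ s → s * f x ≤ ∑ f) (size-Fin n) h

  average-Vec : (f : Vec (Fin n) k → ℕ) → ∃ λ τ → n ^ k * f τ ≤ ∑ f
  average-Vec f = let (τ , h) = average f (replicate k x₀) in τ , subst (λ s → s * f τ ≤ ∑ f) (size-Vec n k) h

  module _ (N : ℕ) (f : Fin n → Fin n → Fin n → Vec (Fin n) k → ℕ)
    (small : N * ∑ (λ u → ∑ (λ w → ∑ (λ z → ∑ (f u w z)))) ≤ n ^ (3 + k)) where

    private
      by-tail : Fin n → Vec (Fin n) k → ℕ
      by-tail u τ = ∑ (λ w → ∑ (λ z → f u w z τ))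

      regroup : ∀ u → ∑ (λ w → ∑ (λ z → ∑ (f u w z))) ≡ ∑ (by-tail u)
      regroup u = trans (∑-cong λ w → ∑-swap (λ z τ → f u w z τ)) (∑-swap (λ w τ → ∑ (λ z → f u w z τ)))

      pairs-bound : ∀ u τ → n * ∑ (λ w → ∑ (λ z → ∑ (f u w z))) ≤ ∑ (λ u → ∑ (λ w → ∑ (λ z → ∑ (f u w z)))) →
        n ^ k * by-tail u τ ≤ ∑ (by-tail u) → N * by-tail u τ ≤ n * n
      pairs-bound u τ hu hτ = *-cancelˡ-≤ (n * n ^ k) {{m*n≢0 n (n ^ k) {{n≢0}} {{m^n≢0 n k}}}} (begin
        n * n ^ k * (N * by-tail u τ)      ≡⟨ rearrange n (n ^ k) N (by-tail u τ) ⟩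
        N * (n * (n ^ k * by-tail u τ))    ≤⟨ *-monoʳ-≤ N (*-monoʳ-≤ n (≤-trans hτ (≤-reflexive (sym (regroup u))))) ⟩
        N * (n * ∑ (λ w → ∑ (λ z → ∑ (f u w z)))) ≤⟨ *-monoʳ-≤ N hu ⟩
        N * ∑ (λ u → ∑ (λ w → ∑ (λ z → ∑ (f u w z)))) ≤⟨ small ⟩
        n * (n * (n * n ^ k))              ≡⟨ rearrange′ n (n ^ k) ⟩
        n * n ^ k * (n * n)                ∎)
        where
        open ≤-Reasoning
        rearrange : ∀ n x N b → n * x * (N * b) ≡ N * (n * (x * b))
        rearrange = solve-∀
        rearrange′ : ∀ n x → n * (n * (n * x)) ≡ n * x * (n * n)
        rearrange′ = solve-∀

      row-bound : ∀ u τ y → N * by-tail u τ ≤ n * n → n * ∑ (λ z → f u y z τ) ≤ by-tail u τ → N * ∑ (λ z → f u y z τ) ≤ n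
      row-bound u τ y hu hy = *-cancelˡ-≤ n (begin
        n * (N * ∑ (λ z → f u y z τ)) ≡⟨ rearrange n N _ ⟩
        N * (n * ∑ (λ z → f u y z τ)) ≤⟨ *-monoʳ-≤ N hy ⟩
        N * by-tail u τ               ≤⟨ hu ⟩
        n * n                         ∎)
        where
        open ≤-Reasoning
        rearrange : ∀ n N b → n * (N * b) ≡ N * (n * b)
        rearrange = solve-∀

    -- Three averagings in turn: over `u`, over the tail `τ` for this `u`, and over `y` for both.
    -- Hence the two bounds refer to the same `u` and `τ`.
    typical : ∃ λ u → ∃ λ y → ∃ λ τ → N * ∑ (λ w → ∑ (λ z → f u w z τ)) ≤ n * n × N * ∑ (λ z → f u y z τ) ≤ n
    typical =
      let (u , hu) = average-Fin (λ u → ∑ (λ w → ∑ (λ z → ∑ (f u w z))))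
          (τ , hτ) = average-Vec (by-tail u)
          (y , hy) = average-Fin (λ y → ∑ (λ z → f u y z τ))
          pairs    = pairs-bound u τ hu hτ
      in u , y , τ , pairs , row-bound u τ y pairs hy

module Stability {v r′ : ℕ} (H : Hypergraph v) (uniformH : Uniform H (4 + r′))
  (tree : IsTreeOrdering H) (reducible : Reducible H (2 + r′))
  (S : Subset v) (cross : CrossCut H S)
  {n : ℕ} (F : Hypergraph n) (uniformF : Uniform F (4 + r′)) (v≤n : v ≤ n)
  (H⊈F : ¬ Contains F H) (simple : Simple F) (t : ℕ) (∣S∣ : ∣ S ∣ ≡ suc t) (N′ : ℕ)
  (1≤n : 1 ≤ n) (t≤n : t ≤ n) (large : (n C (4 + r′)) ∸ ((n ∸ t) C (4 + r′)) ≤ m F) where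

  N : ℕ
  N = scale v N′

  open Heavy H uniformH tree reducible S cross F uniformF v≤n H⊈F simple t ∣S∣ N public

  private
    a = 3 + r′
    instance
      n≢0 : NonZero n
      n≢0 = >-nonZero 1≤n

    lists : ℕ
    lists = ∑ (λ y → # (Listed? y))

    outside : ℕ
    outside = ∑ (λ c → 𝟙 (¬? (Big? c)) * # (Pointed? c))

    C₃ : ℕ
    C₃ = lower-loss v r′ t

    overs : ℕ
    overs = over-bound v t N

  -- By `C-difference` there are at least t C(n - t, r - 1) edges. All but O(n^(r-2)) are dominated,
  -- and each of these yields at least (r - 1)! pointed tuples.
  lists-lower : t * n ^ a ≤ lists + outside + C₃ * n ^ (2 + r′)
  lists-lower = begin
    t * n ^ a
      ≤⟨ *-monoʳ-≤ t (ff-lower n t (2 + r′)) ⟩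
    t * (ff (n ∸ t) a + a * (t + a) * M)
      ≡⟨ distribute t (ff (n ∸ t) a) (a * (t + a)) M ⟩
    t * ff (n ∸ t) a + t * (a * (t + a)) * M
      ≤⟨ +-monoˡ-≤ _ edges ⟩
    lists + outside + B * M + t * (a * (t + a)) * M
      ≡⟨ trans (+-assoc (lists + outside) _ _) (cong (lists + outside +_)
           (trans (sym (*-distribʳ-+ M B (t * (a * (t + a))))) (cong (_* M) (sym (lower-loss-≡ v r′ t))))) ⟩
    lists + outside + C₃ * M ∎
    where
    open ≤-Reasoning
    M = n ^ (2 + r′)
    B = branching v (2 + r′) * cost v (2 + r′) r
    distribute : ∀ t f x y → t * (f + x * y) ≡ t * f + t * x * y
    distribute = solve-∀
    a!≤r! : ff a a ≤ ff r r
    a!≤r! = ≤-trans (m≤m+n (ff a a) (a * ff a a)) (≤-reflexive (sym (ff-suc r a)))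
    edges : t * ff (n ∸ t) a ≤ lists + outside + B * M
    edges = begin
      t * ff (n ∸ t) a
        ≡⟨ trans (cong (t *_) (sym (C-ff (n ∸ t) a))) (trans (sym (*-assoc t _ _)) (*-comm (t * ((n ∸ t) C a)) (ff a a))) ⟩
      ff a a * (t * ((n ∸ t) C a))
        ≤⟨ *-monoʳ-≤ (ff a a) (≤-trans (C-difference n t a t≤n) large) ⟩
      ff a a * m F
        ≡⟨ cong (ff a a *_) (trans (sym #-full)
             (trans (#-split (λ _ → yes tt) Dominated?) (cong₂ _+_ (#-cong _ Dominated? (λ _ → proj₂) (λ _ → tt ,_))
               (#-cong _ (λ i → ¬? (Dominated? i)) (λ _ → proj₂) (λ _ → tt ,_))))) ⟩
      ff a a * (# Dominated? + # (λ i → ¬? (Dominated? i)))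
        ≡⟨ *-distribˡ-+ (ff a a) (# Dominated?) _ ⟩
      ff a a * # Dominated? + ff a a * # (λ i → ¬? (Dominated? i))
        ≤⟨ +-mono-≤ (≤-trans many-pointed (≤-reflexive pointed-split))
             (≤-trans (*-monoˡ-≤ (# (λ i → ¬? (Dominated? i))) a!≤r!) (few-undominated simple)) ⟩
      lists + outside + B * M ∎

  Low : Vec (Fin n) a → Set
  Low y = # (Listed? y) < t

  opaque
    Low? : ∀ y → Dec (Low y)
    Low? y = # (Listed? y) <? t

  private
    over₀₁? : ∀ (y : Vec (Fin n) a) → Dec (Over (lookup y fzero) (lookup y (fsuc fzero)))
    over₀₁? y = Over? (lookup y fzero) (lookup y (fsuc fzero))

  list-upper : ∀ y → # (Listed? y) + 𝟙 (Low? y) ≤ t + 𝟙 (over₀₁? y) * (N * (2 * v))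
  list-upper y = surplus (over₀₁? y) (Low? y) (λ l → l)
    (λ h → ≤-trans (#-mono (Listed? y) (Tied? (lookup y fzero) (lookup y (fsuc fzero)))
        (λ c l → listed⇒tied y c l fzero (fsuc fzero) λ ())) (≮⇒≥ h))
    (≤-trans (#-mono (Listed? y) Big? (λ _ → proj₁)) #Big)

  private
    pairs₀₁ : ∑ (λ u → ∑ (λ w → ∑ {Fin n} (λ z → ∑ {Vec (Fin n) r′} (λ τ → 𝟙 (Over? u w))))) ≤ overs * n ^ (2 + r′)
    pairs₀₁ = begin
      ∑ (λ u → ∑ (λ w → ∑ {Fin n} (λ z → ∑ {Vec (Fin n) r′} (λ τ → 𝟙 (Over? u w)))))
        ≡⟨ ∑-cong (λ u → ∑-cong λ w → trans (∑-cong λ z → ∑-Vec {n} {r′} (𝟙 (Over? u w))) (∑-Fin {n} (n ^ r′ * 𝟙 (Over? u w)))) ⟩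
      ∑ (λ u → ∑ (λ w → n * (n ^ r′ * 𝟙 (Over? u w))))
        ≡⟨ ∑-cong (λ u → trans (∑-* n (λ w → n ^ r′ * 𝟙 (Over? u w))) (cong (n *_) (∑-* (n ^ r′) (λ w → 𝟙 (Over? u w))))) ⟩
      ∑ (λ u → n * (n ^ r′ * # (Over? u)))
        ≡⟨ trans (∑-* n (λ u → n ^ r′ * # (Over? u))) (cong (n *_) (∑-* (n ^ r′) (λ u → # (Over? u)))) ⟩
      n * (n ^ r′ * ∑ (λ u → # (Over? u)))
        ≤⟨ *-monoʳ-≤ n (*-monoʳ-≤ (n ^ r′) few-over) ⟩
      n * (n ^ r′ * ((N * (2 * v)) ^ suc t * (2 * v * n)))
        ≡⟨ trans (rearrange n (n ^ r′) ((N * (2 * v)) ^ suc t) (2 * v))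
             (cong (_* n ^ (2 + r′)) (sym (over-bound-≡ v t N))) ⟩
      overs * n ^ (2 + r′) ∎
      where
      open ≤-Reasoning
      rearrange : ∀ n x y z → n * (x * (y * (z * n))) ≡ y * z * (n * (n * x))
      rearrange = solve-∀

    pairs₀₂ : ∑ (λ u → ∑ {Fin n} (λ w → ∑ (λ z → ∑ {Vec (Fin n) r′} (λ τ → 𝟙 (Over? u z))))) ≤ overs * n ^ (2 + r′)
    pairs₀₂ = ≤-trans (≤-reflexive (∑-cong λ u → ∑-swap (λ w z → ∑ (λ τ → 𝟙 (Over? u z))))) pairs₀₁

    pairs₁₂ : ∑ {Fin n} (λ u → ∑ (λ w → ∑ (λ z → ∑ {Vec (Fin n) r′} (λ τ → 𝟙 (Over? w z))))) ≤ overs * n ^ (2 + r′)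
    pairs₁₂ = ≤-trans (≤-reflexive (trans (∑-swap (λ u w → ∑ (λ z → ∑ (λ τ → 𝟙 (Over? w z)))))
      (∑-cong λ w → ∑-swap (λ u z → ∑ (λ τ → 𝟙 (Over? w z)))))) pairs₀₁

  lists-upper : lists + # Low? ≤ t * n ^ a + N * (2 * v) * overs * n ^ (2 + r′)
  lists-upper = begin
    lists + # Low?
      ≡⟨ ∑-+ (λ y → # (Listed? y)) (λ y → 𝟙 (Low? y)) ⟨
    ∑ (λ y → # (Listed? y) + 𝟙 (Low? y))
      ≤⟨ ∑-mono list-upper ⟩
    ∑ (λ y → t + 𝟙 (over₀₁? y) * (N * (2 * v)))
      ≡⟨ trans (∑-+ (λ y → t) (λ y → 𝟙 (over₀₁? y) * (N * (2 * v)))) (cong₂ _+_ (trans (∑-Vec {n} {a} t) (*-comm (n ^ a) t))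
           (∑-*ʳ (λ y → 𝟙 (over₀₁? y)) (N * (2 * v)))) ⟩
    t * n ^ a + # over₀₁? * (N * (2 * v))
      ≤⟨ +-monoʳ-≤ (t * n ^ a) (*-monoˡ-≤ (N * (2 * v)) (≤-trans (≤-reflexive (∑-∷₃ (λ y → 𝟙 (over₀₁? y)))) pairs₀₁)) ⟩
    t * n ^ a + overs * n ^ (2 + r′) * (N * (2 * v))
      ≡⟨ cong (t * n ^ a +_) (rearrange overs (n ^ (2 + r′)) (N * (2 * v))) ⟩
    t * n ^ a + N * (2 * v) * overs * n ^ (2 + r′) ∎
    where
    open ≤-Reasoning
    rearrange : ∀ x y z → x * y * z ≡ z * x * y
    rearrange = solve-∀

  -- Only pairs among the first three entries are watched; these carry the list of one tuple over to
  -- another one through a common pair.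
  Bad : Fin n → Fin n → Fin n → Vec (Fin n) r′ → Set
  Bad u w z τ = Low (u ∷ w ∷ z ∷ τ) ⊎ Over u w ⊎ Over u z ⊎ Over w z

  opaque
    Bad? : ∀ u w z τ → Dec (Bad u w z τ)
    Bad? u w z τ = Low? (u ∷ w ∷ z ∷ τ) ⊎-dec Over? u w ⊎-dec Over? u z ⊎-dec Over? w z

  bads : ℕ
  bads = ∑ (λ u → ∑ (λ w → ∑ (λ z → # (Bad? u w z))))

  private
    ∑⁴ : (Fin n → Fin n → Fin n → Vec (Fin n) r′ → ℕ) → ℕ
    ∑⁴ f = ∑ (λ u → ∑ (λ w → ∑ (λ z → ∑ (λ τ → f u w z τ))))

    ∑⁴-+ : ∀ f g → ∑⁴ (λ u w z τ → f u w z τ + g u w z τ) ≡ ∑⁴ f + ∑⁴ g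
    ∑⁴-+ f g = trans (∑-cong λ u → trans (∑-cong λ w → trans (∑-cong λ z → ∑-+ (f u w z) (g u w z))
      (∑-+ _ _)) (∑-+ _ _)) (∑-+ _ _)

  bads-upper : bads ≤ # Low? + 3 * overs * n ^ (2 + r′)
  bads-upper = begin
    bads
      ≤⟨ (∑-mono λ u → ∑-mono λ w → ∑-mono λ z → ∑-mono λ τ → ≤-trans
           (𝟙-mono (Bad? u w z τ) (Low? (u ∷ w ∷ z ∷ τ) ⊎-dec Over? u w ⊎-dec Over? u z ⊎-dec Over? w z) id)
           (𝟙-⊎⁴ (Low? (u ∷ w ∷ z ∷ τ)) (Over? u w) (Over? u z) (Over? w z))) ⟩
    ∑⁴ (λ u w z τ → 𝟙 (Low? (u ∷ w ∷ z ∷ τ)) + (𝟙 (Over? u w) + (𝟙 (Over? u z) + 𝟙 (Over? w z))))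
      ≡⟨ trans (∑⁴-+ _ _) (cong (low +_) (trans (∑⁴-+ _ _) (cong (o₀₁ +_) (∑⁴-+ _ _)))) ⟩
    low + (o₀₁ + (o₀₂ + o₁₂))
      ≤⟨ +-mono-≤ (≤-reflexive (sym (∑-∷₃ (λ y → 𝟙 (Low? y))))) (+-mono-≤ pairs₀₁ (+-mono-≤ pairs₀₂ pairs₁₂)) ⟩
    # Low? + (x + (x + x))
      ≡⟨ cong (# Low? +_) (rearrange overs (n ^ (2 + r′))) ⟩
    # Low? + 3 * overs * n ^ (2 + r′) ∎
    where
    open ≤-Reasoning
    x = overs * n ^ (2 + r′)
    low = ∑⁴ (λ u w z τ → 𝟙 (Low? (u ∷ w ∷ z ∷ τ)))
    o₀₁ = ∑⁴ (λ u w z τ → 𝟙 (Over? u w))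
    o₀₂ = ∑⁴ (λ u w z τ → 𝟙 (Over? u z))
    o₁₂ = ∑⁴ (λ u w z τ → 𝟙 (Over? w z))
    rearrange : ∀ o y → o * y + (o * y + o * y) ≡ 3 * o * y
    rearrange = solve-∀

  threshold : ℕ
  threshold = stability-threshold v r′ t N′

  -- The lists have average length almost t, while over pairs apart none is longer, so few are
  -- shorter: `lists` cancels between its two bounds.
  few-bad : threshold ≤ n → N′ * bads ≤ n ^ a
  few-bad big = *-cancelˡ-≤ (1 + 2 * v) (begin
    (1 + 2 * v) * (N′ * bads)
      ≡⟨ trans (sym (*-assoc (1 + 2 * v) N′ bads)) (cong (_* bads) (sym (scale-≡ v N′))) ⟩
    N * bads
      ≤⟨ *-monoʳ-≤ N (combine (t * n ^ a) lists outside (# Low?) bads C₃ (N * (2 * v) * overs) (3 * overs) (n ^ (2 + r′))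
           lists-lower lists-upper bads-upper) ⟩
    N * (outside + (C₃ + N * (2 * v) * overs + 3 * overs) * n ^ (2 + r′))
      ≡⟨ trans (*-distribˡ-+ N outside _) (cong (N * outside +_)
           (trans (sym (*-assoc N _ (n ^ (2 + r′)))) (cong (_* n ^ (2 + r′)) (sym (stability-threshold-≡ v r′ t N′))))) ⟩
    N * outside + threshold * n ^ (2 + r′)
      ≤⟨ +-mono-≤ pointed-at-small (*-monoˡ-≤ (n ^ (2 + r′)) big) ⟩
    2 * v * n ^ a + n ^ a
      ≡⟨ +-comm _ (n ^ a) ⟩
    (1 + 2 * v) * n ^ a ∎)
    where
    open ≤-Reasoning
    combine : ∀ T l X Lo b c₃ c₇ c₈ M → T ≤ l + X + c₃ * M → l + Lo ≤ T + c₇ * M → b ≤ Lo + c₈ * M →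
              b ≤ X + (c₃ + c₇ + c₈) * M
    combine T l X Lo b c₃ c₇ c₈ M h₁ h₂ h₃ = begin
      b                               ≤⟨ h₃ ⟩
      Lo + c₈ * M                     ≤⟨ +-monoˡ-≤ (c₈ * M) (+-cancelˡ-≤ l Lo (X + c₃ * M + c₇ * M) (begin
          l + Lo                        ≤⟨ h₂ ⟩
          T + c₇ * M                    ≤⟨ +-monoˡ-≤ (c₇ * M) h₁ ⟩
          l + X + c₃ * M + c₇ * M       ≡⟨ assoc l X (c₃ * M) (c₇ * M) ⟩
          l + (X + c₃ * M + c₇ * M)     ∎)) ⟩
      X + c₃ * M + c₇ * M + c₈ * M    ≡⟨ collect X c₃ c₇ c₈ M ⟩
      X + (c₃ + c₇ + c₈) * M          ∎
      where
      assoc : ∀ a b c d → a + b + c + d ≡ a + (b + c + d)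
      assoc = solve-∀
      collect : ∀ X a b c M → X + a * M + b * M + c * M ≡ X + (a + b + c) * M
      collect = solve-∀

  private
    tied-same : ∀ u w z τ → ¬ Bad u w z τ →
      t ≤ # (Listed? (u ∷ w ∷ z ∷ τ)) × # (Tied? u w) ≤ t × # (Tied? u z) ≤ t × # (Tied? w z) ≤ t
    tied-same u w z τ ¬b = ≮⇒≥ (¬b ∘ inj₁) , ≮⇒≥ (λ h → ¬b (inj₂ (inj₁ h))) , ≮⇒≥ (λ h → ¬b (inj₂ (inj₂ (inj₁ h)))) ,
      ≮⇒≥ (λ h → ¬b (inj₂ (inj₂ (inj₂ h))))

    list⊆₀₁ : ∀ u w z τ c → Listed (u ∷ w ∷ z ∷ τ) c → Tied u w c
    list⊆₀₁ u w z τ c h = listed⇒tied (u ∷ w ∷ z ∷ τ) c h fzero (fsuc fzero) λ ()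

    list⊆₀₂ : ∀ u w z τ c → Listed (u ∷ w ∷ z ∷ τ) c → Tied u z c
    list⊆₀₂ u w z τ c h = listed⇒tied (u ∷ w ∷ z ∷ τ) c h fzero (fsuc (fsuc fzero)) λ ()

    list⊆₁₂ : ∀ u w z τ c → Listed (u ∷ w ∷ z ∷ τ) c → Tied w z c
    list⊆₁₂ u w z τ c h = listed⇒tied (u ∷ w ∷ z ∷ τ) c h (fsuc fzero) (fsuc (fsuc fzero)) λ ()

  Poor : (Fin n → Bool) → Fin n → Fin n → Set
  Poor L w z = ∃ λ c → c ∈ᶠ L × ¬ Rich F v c w z

  opaque
    Poor? : ∀ L w z → Dec (Poor L w z)
    Poor? L w z = ∃? λ c → (c ∈ᶠ? L) ×-dec ¬? (Rich? F v c w z)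

  module Typical (2≤N′ : 2 ≤ N′) (u y : Fin n) (τ : Vec (Fin n) r′)
    (pairs-bound : N′ * ∑ (λ w → # (λ z → Bad? u w z τ)) ≤ n * n)
    (row-bound : N′ * # (λ z → Bad? u y z τ) ≤ n) where

    private
      row : ℕ
      row = # (λ z → Bad? u y z τ)

      pairs : ℕ
      pairs = ∑ (λ w → # (λ z → Bad? u w z τ))

      -- At most n / N′ ≤ n / 2 of the vertices `z` are bad in the row of `y`.
      good : ∃ λ z → ¬ Bad u y z τ
      good with ∃? (λ z → ¬? (Bad? u y z τ))
      ... | yes h = h
      ... | no none = ⊥-elim (<⇒≱ (begin-strict
            n        <⟨ m<m+n n 1≤n ⟩
            n + n    ≡⟨ cong (n +_) (+-identityʳ n) ⟨
            2 * n    ≤⟨ *-monoˡ-≤ n 2≤N′ ⟩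
            N′ * n   ≡⟨ cong (N′ *_) (trans (sym (size-Fin n)) (sym (#-all (λ z → Bad? u y z τ) all))) ⟩
            N′ * row ∎) row-bound)
        where
        open ≤-Reasoning
        all : ∀ z → Bad u y z τ
        all z with Bad? u y z τ
        ... | yes b = b
        ... | no ¬b = ⊥-elim (none (z , ¬b))

    L : Fin n → Bool
    L = ⟦ Tied? u y ⟧

    private
      L⇒ : ∀ c → c ∈ᶠ L → Tied u y c
      L⇒ c = does⇒ (Tied? u y c)
      ⇒L : ∀ c → Tied u y c → c ∈ᶠ L
      ⇒L c = ⇒does (Tied? u y c)

    #L : # (_∈ᶠ? L) ≡ t
    #L = let (z , ¬b) = good ; (lo , hi , _) = tied-same u y z τ ¬b in
      trans (#-cong (_∈ᶠ? L) (Tied? u y) L⇒ ⇒L)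
        (≤-antisym hi (≤-trans lo (#-mono (Listed? (u ∷ y ∷ z ∷ τ)) (Tied? u y) (list⊆₀₁ u y z τ))))

    missing? : ∀ w z → Dec (Poor L w z)
    missing? = Poor? L

    private
      -- A list of at least t centres inside at most t tied ones equals them. So `L` is the list of
      -- `u ∷ y ∷ z ∷ τ`, whose members are tied to `u`, `z`; these form the list of
      -- `u ∷ w ∷ z ∷ τ`, whose members are tied to `w`, `z`.
      both-good : ∀ w z → ¬ Bad u w z τ → ¬ Bad u y z τ → ∀ c → c ∈ᶠ L → Rich F v c w z
      both-good w z ¬b ¬b′ c c∈ with tied-same u w z τ ¬b | tied-same u y z τ ¬b′
      ... | lo , _ , hi , _ | lo′ , hi′ , _ , _ = proj₂ (proj₂ (list⊆₁₂ u w z τ c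
            (#-⊆-≡ (Listed? (u ∷ w ∷ z ∷ τ)) (Tied? u z) (list⊆₀₂ u w z τ) (≤-trans hi lo) c
              (list⊆₀₂ u y z τ c
                (#-⊆-≡ (Listed? (u ∷ y ∷ z ∷ τ)) (Tied? u y) (list⊆₀₁ u y z τ) (≤-trans hi′ lo′) c (L⇒ c c∈))))))

    few-missing : N′ * ∑ (λ w → # (missing? w)) ≤ 2 * (n * n)
    few-missing = begin
      N′ * ∑ (λ w → # (missing? w))
        ≤⟨ *-monoʳ-≤ N′ (∑-mono λ w → #-⊎ (missing? w) (λ z → Bad? u w z τ) (λ z → Bad? u y z τ) (one w)) ⟩
      N′ * ∑ (λ w → # (λ z → Bad? u w z τ) + row)
        ≡⟨ cong (N′ *_) (trans (∑-+ (λ w → # (λ z → Bad? u w z τ)) (λ _ → row)) (cong (pairs +_) (∑-Fin {n} row))) ⟩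
      N′ * (pairs + n * row)
        ≡⟨ rearrange N′ (pairs) n row ⟩
      N′ * pairs + n * (N′ * row)
        ≤⟨ +-mono-≤ pairs-bound (*-monoʳ-≤ n row-bound) ⟩
      n * n + n * n
        ≡⟨ cong (n * n +_) (+-identityʳ (n * n)) ⟨
      2 * (n * n) ∎
      where
      open ≤-Reasoning
      rearrange : ∀ N b n r → N * (b + n * r) ≡ N * b + n * (N * r)
      rearrange = solve-∀
      one : ∀ w z → Poor L w z → Bad u w z τ ⊎ Bad u y z τ
      one w z (c , c∈ , ¬rich) with Bad? u w z τ | Bad? u y z τ
      ... | yes b | _ = inj₁ b
      ... | no _ | yes b = inj₂ b
      ... | no ¬b | no ¬b′ = ⊥-elim (¬rich (both-good w z ¬b ¬b′ c c∈))

  centre-set : 2 ≤ N′ → threshold ≤ n → ∃ λ L → # (_∈ᶠ? L) ≡ t × N′ * ∑ (λ w → # (Poor? L w)) ≤ 2 * (n * n)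
  centre-set 2≤N′ big =
    let (u , y , τ , pairs , row) = typical 1≤n N′ (λ u w z τ → 𝟙 (Bad? u w z τ)) (few-bad big)
    in Typical.L 2≤N′ u y τ pairs row , Typical.#L 2≤N′ u y τ pairs row , Typical.few-missing 2≤N′ u y τ pairs row

-- Embedding with a prescribed star

first-edge : ∀ {v} (H : Hypergraph v) x j → x ∈ edge H j → ∃ λ i → FirstEdge H x i
first-edge H x j p = go (toℕ j) j ≤-refl p
  where
  go : ∀ b j → toℕ j ≤ b → x ∈ edge H j → ∃ λ i → FirstEdge H x i
  go b j le p with ∃? (λ i → (toℕ i <? toℕ j) ×-dec (x ∈? edge H i))
  ... | no none = j , p , λ i q → ≮⇒≥ (λ lt → none (i , lt , q))
  go zero j le p | yes (i , lt , q) = ⊥-elim (<⇒≱ lt (≤-trans le z≤n))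
  go (suc b) j le p | yes (i , lt , q) = go b i (≤-pred (≤-trans lt le)) q

third-element : ∀ {A : Set} ⦃ _ : Enum A ⦄ {P : A → Set} (P? : ∀ x → Dec (P x)) (u u′ : A) → P u → P u′ → u ≢ u′ →
  3 ≤ # P? → ∃ λ c → P c × c ≢ u × c ≢ u′
third-element P? u u′ p p′ ne three =
  let (c , (q , h) , h′) = #-pos (λ c → (P? c ×-dec ¬? (c ≟ᴱ u)) ×-dec ¬? (c ≟ᴱ u′)) (≤-pred (≤-pred (≤-trans three (≤-reflexive
        (trans (#-remove P? u p) (cong suc (#-remove (λ c → P? c ×-dec ¬? (c ≟ᴱ u)) u′ (p′ , ne ∘ sym))))))))
  in c , q , h , h′

three-elements : ∀ {A : Set} ⦃ _ : Enum A ⦄ {P : A → Set} (P? : ∀ x → Dec (P x)) (a b c : A) → P a → P b → P c →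
  b ≢ a → c ≢ a → b ≢ c → 3 ≤ # P?
three-elements P? a b c p q r b≢a c≢a b≢c = ≤-trans (s≤s (≤-trans (s≤s
    (pos-# (λ z → (P? z ×-dec ¬? (z ≟ᴱ a)) ×-dec ¬? (z ≟ᴱ b)) c ((r , c≢a) , b≢c ∘ sym)))
    (≤-reflexive (sym (#-remove (λ z → P? z ×-dec ¬? (z ≟ᴱ a)) b (q , b≢a))))))
  (≤-reflexive (sym (#-remove P? a p)))

module StarEmbedding {v r′ : ℕ} (H : Hypergraph v) (uniformH : Uniform H (4 + r′))
  (tree : IsTreeOrdering H) (reducible : Reducible H (2 + r′))
  (S : Subset v) (cross : CrossCut H S) {t p : ℕ} (∣S∣ : ∣ S ∣ ≡ suc t)
  (w : Fin v) (last : IncludedLast H S w) (star : StarIsLinear H w p)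
  {n : ℕ} (F : Hypergraph n) (uniformF : Uniform F (4 + r′)) (v≤n : v ≤ n) where

  open TreeStructure H uniformH tree reducible S cross

  private
    E : Fin (m H) → Subset v
    E = edge H

    w∈S = proj₁ last
    i₀ = proj₁ (proj₂ last)
    w∈E₀ = proj₁ (proj₁ (proj₂ (proj₂ last)))

  linear : ∀ i j x → i ≢ j → w ∈ E i → w ∈ E j → x ∈ E i → x ∈ E j → x ≡ w
  linear i j x ne wi wj xi xj = Subset.x∈⁅y⁆⇒x≡y w (subst (x ∈_) (proj₂ star i j ne wi wj) (x∈p∩q⁺ (xi , xj)))

  -- For j ≠ i₀ the tree order pulls a common vertex of E k and E j back to an earlier E k that still
  -- avoids w, until k < j; there the parent of E j contains both that vertex and w.
  star-contact : ∀ k j x → ¬ w ∈ E k → w ∈ E j → x ∈ E k → x ∈ E j → x ∈ E i₀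
  star-contact k j x w∉k w∈j x∈k x∈j with j ≟ᴱ i₀
  ... | yes refl = x∈j
  ... | no ne = ⊥-elim (go (toℕ k) k ≤-refl w∉k x∈k)
    where
    i₀<j : toℕ i₀ < toℕ j
    i₀<j = ≤∧≢⇒< (proj₂ (proj₁ (proj₂ (proj₂ last))) j w∈j) (λ e → ne (sym (Fin.toℕ-injective e)))
    go : ∀ b k → toℕ k ≤ b → ¬ w ∈ E k → x ∈ E k → ⊥
    go b k le w∉k x∈k with <-cmp (toℕ k) (toℕ j)
    ... | tri≈ _ e _ = w∉k (subst (λ i → w ∈ E i) (sym (Fin.toℕ-injective e)) w∈j)
    ... | tri< k<j _ _ =
      let (a , a<j , parent) = tree j (≤-<-trans z≤n k<j)
          x≡w = linear a j x (λ e → <-irrefl (cong toℕ e) a<j) (parent w w∈j (i₀ , i₀<j , w∈E₀)) w∈j (parent x x∈j (k , k<j , x∈k)) x∈j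
      in w∉k (subst (_∈ E k) x≡w x∈k)
    go zero k le w∉k x∈k | tri> _ _ j<k = ⊥-elim (<⇒≱ j<k (≤-trans le z≤n))
    go (suc b) k le w∉k x∈k | tri> _ _ j<k =
      let (y , y∈k , y∈S) = cut k
          (f , first) = first-edge H y k y∈k
          f<k = ≤-<-trans (proj₂ (proj₂ (proj₂ last)) y y∈S f first) (<-trans i₀<j j<k)
          (a , a<k , parent) = tree k (≤-<-trans z≤n j<k)
          y∈a = parent y y∈k (f , f<k , proj₁ first)
          x∈a = parent x x∈k (j , j<k , x∈j)
          w∉a = λ w∈a → w∉k (subst (_∈ E k) (cut-unique a y w y∈a y∈S w∈a w∈S) y∈k)
      in go b a (≤-pred (≤-trans a<k le)) w∉a x∈a

  private
    #star : # (λ j → w ∈? E j) ≡ p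
    #star = trans (sym (degree-# w)) (proj₁ star)

  Safe : (Fin n → Bool) → Fin n → Fin n → Set
  Safe L u u′ = ∀ c → c ∈ᶠ L → Rich F v c u u′

  Safe-sym : ∀ {L u u′} → Safe L u u′ → Safe L u′ u
  Safe-sym h c c∈ = Rich-swap F (h c c∈)

  -- `Good` and `spread` abstract low Q-degree: there is always a new good vertex that is safe with
  -- all good ones among v given vertices. `free` provides room in a star edge for the vertices of
  -- `E i₀` that meet the rest of `H`.
  module _ (L : Fin n → Bool) (#L : # (_∈ᶠ? L) ≡ t) {Good : Fin n → Set}
    (spread : ∀ (φ : Fin v → Fin n) → ∃ λ u → Good u × (∀ x → φ x ≢ u) × (∀ x → Good (φ x) → Safe L (φ x) u))
    (D : Fin p → Fin (m F)) (d : Fin n) (d∈D : ∀ i → d ∈ edge F (D i))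
    (D-linear : ∀ i j → i ≢ j → ∀ x → x ∈ edge F (D i) → x ∈ edge F (D j) → x ≡ d)
    (D∉L : ∀ i x → x ∈ edge F (D i) → ¬ x ∈ᶠ L)
    (free : ∀ i → ∃ λ u → ∃ λ u′ → u ≢ u′ × (u ∈ edge F (D i) × u′ ∈ edge F (D i)) × (Good u × Good u′) × Safe L u u′) where

    open Embedding H F uniformH uniformF private-vertex v≤n

    private
      β-data : ∃ λ (β : Fin (m H) → Fin p) → InjOn (λ j → w ∈ E j) β × (∀ j → w ∈ E j → ⊤)
      β-data = injection (λ j → w ∈? E j) (λ _ → yes tt)
        (λ _ → fromℕ< (≤-trans (pos-# (λ j → w ∈? E j) i₀ w∈E₀) (≤-reflexive #star)))
        (≤-reflexive (trans #star (sym #-full)))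

      β = proj₁ β-data
      D′ : Fin (m H) → Subset n
      D′ j = edge F (D (β j))

      D′-linear : ∀ i j → i ≢ j → w ∈ E i → w ∈ E j → ∀ x → x ∈ D′ i → x ∈ D′ j → x ≡ d
      D′-linear i j ne wi wj = D-linear (β i) (β j) (λ e → ne (proj₁ (proj₂ β-data) i j wi wj e))

    -- The images of those vertices of `E i₀` that may meet other edges, fixed before the rest of
    -- the star. Only when another edge contains `w` must `w` go to `d`; otherwise two further
    -- contact vertices have to be accommodated.
    record Start : Set₁ where
      field
        Dom      : Fin v → Set
        Dom?     : ∀ x → Dec (Dom x)
        φ₀       : Fin v → Fin n
        w∈Dom    : Dom w
        Dom⊆E₀   : ∀ x → Dom x → x ∈ E i₀
        shared⊆  : ∀ x → Shared i₀ x → Dom x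
        inj      : InjOn Dom φ₀
        into     : ∀ x → Dom x → φ₀ x ∈ D′ i₀
        centre   : ∀ j → j ≢ i₀ → w ∈ E j → φ₀ w ≡ d
        good     : ∀ x → Dom x → x ≢ w → Good (φ₀ x)
        safe     : ∀ x y → Dom x → x ≢ w → Dom y → y ≢ w → x ≢ y → Safe L (φ₀ x) (φ₀ y)

    private
      FreePair : Set
      FreePair = ∃ λ u → ∃ λ u′ → u ≢ u′ × (u ∈ D′ i₀ × u′ ∈ D′ i₀) × (Good u × Good u′) × Safe L u u′

      CoverPair : Set
      CoverPair = ∃ λ x → ∃ λ y → x ≢ y × (x ∈ E i₀ × ¬ x ∈ S) × (y ∈ E i₀ × ¬ y ∈ S) ×
        (∀ z → Shared i₀ z × ¬ z ∈ S → z ≡ x ⊎ z ≡ y)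

    -- The star is a single edge, and both vertices of the cover pair may be shared: they go to the
    -- free pair, and `w` to any third vertex of the edge.
    start-lonely : FreePair → CoverPair → ¬ (∃ λ j → j ≢ i₀ × w ∈ E j) → Start
    start-lonely (u , u′ , u≢u′ , (u∈ , u′∈) , (good-u , good-u′) , safe) (X , Y , X≢Y , (X∈ , X∉S) , (Y∈ , Y∉S) , cover) alone = record
      { Dom = λ x → x ≡ w ⊎ x ≡ X ⊎ x ≡ Y ; Dom? = λ x → (x ≟ᴱ w) ⊎-dec (x ≟ᴱ X) ⊎-dec (x ≟ᴱ Y) ; φ₀ = φ
      ; w∈Dom = inj₁ refl
      ; Dom⊆E₀ = λ { x (inj₁ refl) → w∈E₀ ; x (inj₂ (inj₁ refl)) → X∈ ; x (inj₂ (inj₂ refl)) → Y∈ }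
      ; shared⊆ = shared⊆
      ; inj = inj
      ; into = into
      ; centre = λ j ne wj → ⊥-elim (alone (j , ne , wj))
      ; good = λ { x (inj₁ e) ne → ⊥-elim (ne e) ; x (inj₂ (inj₁ refl)) _ → subst Good (sym φX) good-u
                 ; x (inj₂ (inj₂ refl)) _ → subst Good (sym φY) good-u′ }
      ; safe = λ { x y (inj₁ e) ne _ _ _ → ⊥-elim (ne e) ; x y (inj₂ _) _ (inj₁ e) ne _ → ⊥-elim (ne e)
                 ; x y (inj₂ (inj₁ refl)) _ (inj₂ (inj₁ refl)) _ ne → ⊥-elim (ne refl)
                 ; x y (inj₂ (inj₂ refl)) _ (inj₂ (inj₂ refl)) _ ne → ⊥-elim (ne refl)
                 ; x y (inj₂ (inj₁ refl)) _ (inj₂ (inj₂ refl)) _ _ → subst₂ (Safe L) (sym φX) (sym φY) safe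
                 ; x y (inj₂ (inj₂ refl)) _ (inj₂ (inj₁ refl)) _ _ → subst₂ (Safe L) (sym φY) (sym φX) (Safe-sym safe) }
      }
      where
      third : ∃ λ c → c ∈ D′ i₀ × c ≢ u × c ≢ u′
      third = third-element (_∈? D′ i₀) u u′ u∈ u′∈ u≢u′ (≤-trans (s≤s (s≤s (s≤s z≤n))) (≤-reflexive (sym (#F (D (β i₀))))))
      c = proj₁ third
      X≢w : X ≢ w
      X≢w e = X∉S (subst (_∈ S) (sym e) w∈S)
      Y≢w : Y ≢ w
      Y≢w e = Y∉S (subst (_∈ S) (sym e) w∈S)
      φ : Fin v → Fin n
      φ = ((λ _ → c) [ X ↦ u ]) [ Y ↦ u′ ]
      φw : φ w ≡ c
      φw = trans (upd-other ((λ _ → c) [ X ↦ u ]) Y u′ (Y≢w ∘ sym)) (upd-other (λ _ → c) X u (X≢w ∘ sym))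
      φX : φ X ≡ u
      φX = trans (upd-other ((λ _ → c) [ X ↦ u ]) Y u′ X≢Y) (upd-same (λ _ → c) X u)
      φY : φ Y ≡ u′
      φY = upd-same ((λ _ → c) [ X ↦ u ]) Y u′
      shared⊆ : ∀ x → Shared i₀ x → x ≡ w ⊎ x ≡ X ⊎ x ≡ Y
      shared⊆ x s with x ∈? S
      ... | yes x∈S = inj₁ (cut-unique i₀ x w (proj₁ s) x∈S w∈E₀ w∈S)
      ... | no x∉S = inj₂ (cover x (s , x∉S))
      into : ∀ x → x ≡ w ⊎ x ≡ X ⊎ x ≡ Y → φ x ∈ D′ i₀
      into x (inj₁ refl) = subst (_∈ D′ i₀) (sym φw) (proj₁ (proj₂ third))
      into x (inj₂ (inj₁ refl)) = subst (_∈ D′ i₀) (sym φX) u∈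
      into x (inj₂ (inj₂ refl)) = subst (_∈ D′ i₀) (sym φY) u′∈
      c≢u = proj₁ (proj₂ (proj₂ third))
      c≢u′ = proj₂ (proj₂ (proj₂ third))
      inj : InjOn (λ x → x ≡ w ⊎ x ≡ X ⊎ x ≡ Y) φ
      inj x y (inj₁ refl) (inj₁ refl) e = refl
      inj x y (inj₁ refl) (inj₂ (inj₁ refl)) e = ⊥-elim (c≢u (trans (sym φw) (trans e φX)))
      inj x y (inj₁ refl) (inj₂ (inj₂ refl)) e = ⊥-elim (c≢u′ (trans (sym φw) (trans e φY)))
      inj x y (inj₂ (inj₁ refl)) (inj₁ refl) e = ⊥-elim (c≢u (trans (sym φw) (trans (sym e) φX)))
      inj x y (inj₂ (inj₁ refl)) (inj₂ (inj₁ refl)) e = refl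
      inj x y (inj₂ (inj₁ refl)) (inj₂ (inj₂ refl)) e = ⊥-elim (u≢u′ (trans (sym φX) (trans e φY)))
      inj x y (inj₂ (inj₂ refl)) (inj₁ refl) e = ⊥-elim (c≢u′ (trans (sym φw) (trans (sym e) φY)))
      inj x y (inj₂ (inj₂ refl)) (inj₂ (inj₁ refl)) e = ⊥-elim (u≢u′ (trans (sym φX) (trans (sym e) φY)))
      inj x y (inj₂ (inj₂ refl)) (inj₂ (inj₂ refl)) e = refl

    -- Now `w` is one of the at most two shared vertices of `E i₀`, which leaves at most one other.
    -- It goes to a vertex of the free pair that differs from `d`.
    start-shared : FreePair → CoverPair → (∃ λ j → j ≢ i₀ × w ∈ E j) → Start
    start-shared (u , u′ , u≢u′ , (u∈ , u′∈) , (good-u , good-u′) , safe) (X , Y , X≢Y , (X∈ , X∉S) , (Y∈ , Y∉S) , cover) (j₁ , j₁≢i₀ , w∈j₁) = record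
      { Dom = λ x → x ≡ w ⊎ x ≡ X₁ ; Dom? = λ x → (x ≟ᴱ w) ⊎-dec (x ≟ᴱ X₁) ; φ₀ = φ
      ; w∈Dom = inj₁ refl
      ; Dom⊆E₀ = λ { x (inj₁ refl) → w∈E₀ ; x (inj₂ refl) → X₁∈ }
      ; shared⊆ = shared⊆
      ; inj = inj
      ; into = λ { x (inj₁ refl) → subst (_∈ D′ i₀) (sym φw) (d∈D (β i₀)) ; x (inj₂ refl) → subst (_∈ D′ i₀) (sym φX) u₁∈ }
      ; centre = λ _ _ _ → φw
      ; good = λ { x (inj₁ e) ne → ⊥-elim (ne e) ; x (inj₂ refl) _ → subst Good (sym φX) good-u₁ }
      ; safe = λ { x y (inj₁ e) ne _ _ _ → ⊥-elim (ne e) ; x y (inj₂ _) _ (inj₁ e) ne _ → ⊥-elim (ne e)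
                 ; x y (inj₂ refl) _ (inj₂ refl) _ ne → ⊥-elim (ne refl) }
      }
      where
      X≢w : X ≢ w
      X≢w e = X∉S (subst (_∈ S) (sym e) w∈S)
      Y≢w : Y ≢ w
      Y≢w e = Y∉S (subst (_∈ S) (sym e) w∈S)
      w-shared : Shared i₀ w
      w-shared = w∈E₀ , j₁ , j₁≢i₀ , w∈j₁
      ¬both : ¬ (Shared i₀ X × Shared i₀ Y)
      ¬both (sX , sY) = <⇒≱ (three-elements (Shared? i₀) w X Y w-shared sX sY X≢w Y≢w X≢Y) (#Shared i₀)
      contact : ∃ λ x → x ∈ E i₀ × x ≢ w × (∀ z → Shared i₀ z → z ≢ w → z ≡ x)
      contact = choose (Shared? i₀ X)
        where
        covered : ∀ z → Shared i₀ z → z ≢ w → z ≡ X ⊎ z ≡ Y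
        covered z s ne with z ∈? S
        ... | yes z∈S = ⊥-elim (ne (cut-unique i₀ z w (proj₁ s) z∈S w∈E₀ w∈S))
        ... | no z∉S = cover z (s , z∉S)
        choose : Dec (Shared i₀ X) → ∃ λ x → x ∈ E i₀ × x ≢ w × (∀ z → Shared i₀ z → z ≢ w → z ≡ x)
        choose (yes sX) = X , X∈ , X≢w , λ z s ne → case covered z s ne of λ
          { (inj₁ e) → e ; (inj₂ e) → ⊥-elim (¬both (sX , subst (Shared i₀) e s)) }
        choose (no ¬sX) = Y , Y∈ , Y≢w , λ z s ne → case covered z s ne of λ
          { (inj₁ e) → ⊥-elim (¬sX (subst (Shared i₀) e s)) ; (inj₂ e) → e }
      X₁ = proj₁ contact
      X₁∈ = proj₁ (proj₂ contact)
      X₁≢w = proj₁ (proj₂ (proj₂ contact))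
      shared⊆ : ∀ x → Shared i₀ x → x ≡ w ⊎ x ≡ X₁
      shared⊆ x s with x ≟ᴱ w
      ... | yes e = inj₁ e
      ... | no ne = inj₂ (proj₂ (proj₂ (proj₂ contact)) x s ne)
      off-centre : ∃ λ c → c ∈ D′ i₀ × Good c × c ≢ d
      off-centre with u ≟ᴱ d
      ... | no ne = u , u∈ , good-u , ne
      ... | yes e = u′ , u′∈ , good-u′ , λ e′ → u≢u′ (trans e (sym e′))
      u₁ = proj₁ off-centre
      u₁∈ = proj₁ (proj₂ off-centre)
      good-u₁ = proj₁ (proj₂ (proj₂ off-centre))
      u₁≢d = proj₂ (proj₂ (proj₂ off-centre))
      φ : Fin v → Fin n
      φ = (λ _ → d) [ X₁ ↦ u₁ ]
      φw : φ w ≡ d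
      φw = upd-other (λ _ → d) X₁ u₁ (X₁≢w ∘ sym)
      φX : φ X₁ ≡ u₁
      φX = upd-same (λ _ → d) X₁ u₁
      inj : InjOn (λ x → x ≡ w ⊎ x ≡ X₁) φ
      inj x y (inj₁ refl) (inj₁ refl) e = refl
      inj x y (inj₁ refl) (inj₂ refl) e = ⊥-elim (u₁≢d (trans (sym φX) (trans (sym e) φw)))
      inj x y (inj₂ refl) (inj₁ refl) e = ⊥-elim (u₁≢d (trans (sym φX) (trans e φw)))
      inj x y (inj₂ refl) (inj₂ refl) e = refl

    start : Start
    start = by-degree (∃? λ j → ¬? (j ≟ᴱ i₀) ×-dec (w ∈? E j))
      where
      by-degree : Dec (∃ λ j → j ≢ i₀ × w ∈ E j) → Start
      by-degree (yes h) = start-shared (free (β i₀)) (pair i₀) h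
      by-degree (no h)  = start-lonely (free (β i₀)) (pair i₀) h

    module FromStart (st : Start) where
      open Start st

      private
        V : ℕ → Fin v → Set
        V k x = Dom x ⊎ ∃ λ j → toℕ j < k × w ∈ E j × x ∈ E j

        V? : ∀ k x → Dec (V k x)
        V? k x = Dom? x ⊎-dec ∃? λ j → (toℕ j <? k) ×-dec (w ∈? E j) ×-dec (x ∈? E j)

        Partial : ℕ → Set
        Partial k = ∃ λ φ → (∀ x → Dom x → φ x ≡ φ₀ x) × InjOn (V k) φ ×
          (∀ j → toℕ j < k → w ∈ E j → ∀ x → x ∈ E j → φ x ∈ D′ j)

        centre′ : ∀ j j′ → j ≢ j′ → w ∈ E j → w ∈ E j′ → φ₀ w ≡ d
        centre′ j j′ ne wj wj′ with j ≟ᴱ i₀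
        ... | no h = centre j h wj
        ... | yes refl = centre j′ (ne ∘ sym) wj′

        step : ∀ k → k < m H → Partial k → Partial (suc k)
        step k k<m (φ , agree , inj-φ , image) = from (w ∈? E j)
          where
          j = fromℕ< k<m
          j≢ : ∀ {j′} → toℕ j′ < k → j ≢ j′
          j≢ lt e = <-irrefl (trans (sym (cong toℕ e)) (Fin.toℕ-fromℕ< k<m)) lt
          from : Dec (w ∈ E j) → Partial (suc k)
          from (no w∉) = φ , agree , (λ x y a b → inj-φ x y (shrink a) (shrink b)) , image′
            where
            shrink : ∀ {x} → V (suc k) x → V k x
            shrink (inj₁ h) = inj₁ h
            shrink (inj₂ (j′ , lt , wj , xj)) with earlier-or-last k<m j′ lt
            ... | inj₁ l = inj₂ (j′ , l , wj , xj)
            ... | inj₂ refl = ⊥-elim (w∉ wj)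
            image′ : ∀ j′ → toℕ j′ < suc k → w ∈ E j′ → ∀ x → x ∈ E j′ → φ x ∈ D′ j′
            image′ j′ lt wj with earlier-or-last k<m j′ lt
            ... | inj₁ l = image j′ l wj
            ... | inj₂ refl = ⊥-elim (w∉ wj)
          from (yes wj)
            with extend (V? k) (_∈? E j) (_∈? D′ j) φ (≤-reflexive (trans (#H j) (sym (#F (D (β j)))))) inj-φ fwd back
            where
            φw-in : φ₀ w ≡ d → φ w ∈ D′ j
            φw-in e = subst (_∈ D′ j) (sym (trans (agree w w∈Dom) e)) (d∈D (β j))
            fwd : ∀ x → x ∈ E j → V k x → φ x ∈ D′ j
            fwd x xj (inj₂ (j′ , lt , wj′ , xj′)) = subst (λ z → φ z ∈ D′ j)
              (sym (linear j j′ x (j≢ lt) wj wj′ xj xj′)) (φw-in (centre′ j j′ (j≢ lt) wj wj′))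
            fwd x xj (inj₁ dom) with j ≟ᴱ i₀
            ... | yes e = subst₂ (λ s i → s ∈ D′ i) (sym (agree x dom)) (sym e) (into x dom)
            ... | no ne = subst (λ z → φ z ∈ D′ j) (sym (linear j i₀ x ne wj w∈E₀ xj (Dom⊆E₀ x dom))) (φw-in (centre j ne wj))
            -- By linearity of the image star, the only value in `D′ j` that an earlier star edge
            -- can have taken is `d`, and by injectivity only `w` takes it.
            is-w : ∀ x → V k x → φ₀ w ≡ d → φ x ≡ d → x ∈ E j
            is-w x h e e′ = subst (_∈ E j) (sym (inj-φ x w h (inj₁ w∈Dom) (trans e′ (sym (trans (agree w w∈Dom) e))))) wj
            back : ∀ x → V k x → φ x ∈ D′ j → x ∈ E j
            back x h@(inj₂ (j′ , lt , wj′ , xj′)) q = is-w x h (centre′ j j′ (j≢ lt) wj wj′)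
              (D′-linear j j′ (j≢ lt) wj wj′ (φ x) q (image j′ lt wj′ x xj′))
            back x h@(inj₁ dom) q with j ≟ᴱ i₀
            ... | yes e = subst (λ i → x ∈ E i) (sym e) (Dom⊆E₀ x dom)
            ... | no ne = is-w x h (centre j ne wj)
                  (D′-linear j i₀ ne wj w∈E₀ (φ x) q (subst (_∈ D′ i₀) (sym (agree x dom)) (into x dom)))
          ... | φ′ , old , inj′ , into′ = φ′ , (λ x h → trans (old x (inj₁ h)) (agree x h)) ,
                (λ x y a b → inj′ x y (shrink a) (shrink b)) , image′
            where
            shrink : ∀ {x} → V (suc k) x → V k x ⊎ x ∈ E j
            shrink (inj₁ h) = inj₁ (inj₁ h)
            shrink (inj₂ (j′ , lt , wj′ , xj)) with earlier-or-last k<m j′ lt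
            ... | inj₁ l = inj₁ (inj₂ (j′ , l , wj′ , xj))
            ... | inj₂ refl = inj₂ xj
            image′ : ∀ j′ → toℕ j′ < suc k → w ∈ E j′ → ∀ x → x ∈ E j′ → φ′ x ∈ D′ j′
            image′ j′ lt wj′ x xj with earlier-or-last k<m j′ lt
            ... | inj₁ l = subst (_∈ D′ j′) (sym (old x (inj₂ (j′ , l , wj′ , xj)))) (image j′ l wj′ x xj)
            ... | inj₂ refl = into′ x xj

        partial : ∀ k → k ≤ m H → Partial k
        partial zero _ = φ₀ , (λ _ _ → refl) , (λ { x y (inj₁ a) (inj₁ b) → inj x y a b
                                                  ; x y (inj₂ (_ , () , _)) _ ; x y _ (inj₂ (_ , () , _)) }) , λ _ ()
        partial (suc k) le = step k le (partial k (≤-trans (n≤1+n k) le))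

      InStar : Fin v → Set
      InStar x = ∃ λ j → w ∈ E j × x ∈ E j

      InStar? : ∀ x → Dec (InStar x)
      InStar? x = ∃? λ j → (w ∈? E j) ×-dec (x ∈? E j)

      Cut′ : Fin v → Set
      Cut′ x = x ∈ S × x ≢ w

      Cut′? : ∀ x → Dec (Cut′ x)
      Cut′? x = (x ∈? S) ×-dec ¬? (x ≟ᴱ w)

      StarMap : (Fin v → Fin n) → Set
      StarMap φ = (∀ x → Dom x → φ x ≡ φ₀ x) × (∀ j → w ∈ E j → ∀ x → x ∈ E j → φ x ∈ D′ j) ×
        (∀ x → Cut′ x → φ x ∈ᶠ L)

      -- Both `S` without `w` and `L` have t elements. No cut vertex other than `w` lies in a star
      -- edge, which already contains `w`, and the image star avoids `L`, so the two parts do not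
      -- interfere.
      with-cut : ∃ λ φ → StarMap φ × InjOn (λ x → InStar x ⊎ Cut′ x) φ
      with-cut with partial (m H) ≤-refl
      ... | φ , agree , inj-φ , image
        with extend InStar? Cut′? (_∈ᶠ? L) φ
               (≤-reflexive (trans (suc-injective (trans (sym (#-remove (_∈? S) w w∈S)) (trans (#-∈ S) ∣S∣))) (sym #L)))
               (λ x y a b → inj-φ x y (in-V a) (in-V b))
               (λ { x (s , ne) (j , wj , xj) → ⊥-elim (ne (cut-unique j x w xj s wj w∈S)) })
               (λ { x (j , wj , xj) q → ⊥-elim (D∉L (β j) (φ x) (image j (Fin.toℕ<n j) wj x xj) q) })
        where
        in-V : ∀ {x} → InStar x → V (m H) x
        in-V (j , wj , xj) = inj₂ (j , Fin.toℕ<n j , wj , xj)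
      ... | φ′ , old , inj′ , into′ = φ′ , ((λ x h → trans (old x (i₀ , w∈E₀ , Dom⊆E₀ x h)) (agree x h)) ,
              (λ j wj x xj → subst (_∈ D′ j) (sym (old x (j , wj , xj))) (image j (Fin.toℕ<n j) wj x xj)) , into′) , inj′

      private
        X Y : Fin (m H) → Fin v
        X j = proj₁ (pair j)
        Y j = proj₁ (proj₂ (pair j))
        X≢Y : ∀ j → X j ≢ Y j
        X≢Y j = proj₁ (proj₂ (proj₂ (pair j)))
        X∈ : ∀ j → X j ∈ E j × ¬ X j ∈ S
        X∈ j = proj₁ (proj₂ (proj₂ (proj₂ (pair j))))
        Y∈ : ∀ j → Y j ∈ E j × ¬ Y j ∈ S
        Y∈ j = proj₁ (proj₂ (proj₂ (proj₂ (proj₂ (pair j)))))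
        cover : ∀ j z → Shared j z × ¬ z ∈ S → z ≡ X j ⊎ z ≡ Y j
        cover j = proj₂ (proj₂ (proj₂ (proj₂ (proj₂ (pair j)))))

      Core : Fin v → Set
      Core x = ∃ λ k → ¬ w ∈ E k × (x ≡ X k ⊎ x ≡ Y k)

      Core? : ∀ x → Dec (Core x)
      Core? x = ∃? λ k → ¬? (w ∈? E k) ×-dec ((x ≟ᴱ X k) ⊎-dec (x ≟ᴱ Y k))

      private
        core-in : ∀ {x k} → x ≡ X k ⊎ x ≡ Y k → x ∈ E k × ¬ x ∈ S
        core-in {k = k} (inj₁ refl) = X∈ k
        core-in {k = k} (inj₂ refl) = Y∈ k

        Base : Fin v → Set
        Base x = InStar x ⊎ Cut′ x

        -- By `star-contact`, a vertex common to a star edge and an edge avoiding `w` lies in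
        -- `E i₀`; it is shared there, hence in `Dom`.
        core-base : ∀ x → Core x → Base x → Dom x × x ≢ w
        core-base x (k , w∉k , h) (inj₂ (s , _)) = ⊥-elim (proj₂ (core-in h) s)
        core-base x (k , w∉k , h) (inj₁ (j , wj , xj)) =
          shared⊆ x (star-contact k j x w∉k wj (proj₁ (core-in h)) xj , k , (λ e → w∉k (subst (λ i → w ∈ E i) (sym e) w∈E₀)) , proj₁ (core-in h)) ,
          λ e → w∉k (subst (_∈ E k) e (proj₁ (core-in h)))

        U : ℕ → Fin v → Set
        U l x = Base x ⊎ (toℕ x < l × Core x)

        U? : ∀ l x → Dec (U l x)
        U? l x = (InStar? x ⊎-dec Cut′? x) ⊎-dec ((toℕ x <? l) ×-dec Core? x)

        G : ℕ → Fin v → Set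
        G l x = (Dom x × x ≢ w) ⊎ (toℕ x < l × Core x)

        Whole : ℕ → Set
        Whole l = ∃ λ φ → StarMap φ × InjOn (U l) φ × (∀ x → G l x → Good (φ x)) ×
          (∀ x y → G l x → G l y → x ≢ y → Safe L (φ x) (φ y))

        -- A new core vertex is made safe with all earlier ones, whether or not they share an edge,
        -- so the vertices can be taken by index.
        grow : ∀ l → l < v → Whole l → Whole (suc l)
        grow l l<v (φ , sm@(agree , image , cuts) , inj-φ , good-φ , safe-φ) = from (Core? x₁) (U? l x₁)
          where
          x₁ = fromℕ< l<v
          older : ∀ {x} → toℕ x < suc l → toℕ x < l ⊎ x ≡ x₁
          older {x} = earlier-or-last l<v x
          keep : (Core x₁ → U l x₁) → Whole (suc l)
          keep h = φ , sm , (λ x y a b → inj-φ x y (shrink a) (shrink b)) , (λ x g → good-φ x (shrinkG g)) ,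
                   (λ x y a b → safe-φ x y (shrinkG a) (shrinkG b))
            where
            shrink : ∀ {x} → U (suc l) x → U l x
            shrink (inj₁ b) = inj₁ b
            shrink (inj₂ (lt , c)) with older lt
            ... | inj₁ lt′ = inj₂ (lt′ , c)
            ... | inj₂ refl = h c
            shrinkG : ∀ {x} → G (suc l) x → G l x
            shrinkG (inj₁ b) = inj₁ b
            shrinkG (inj₂ (lt , c)) with older lt
            ... | inj₁ lt′ = inj₂ (lt′ , c)
            ... | inj₂ refl with h c
            ... | inj₁ b = inj₁ (core-base _ c b)
            ... | inj₂ q = inj₂ q
          from : Dec (Core x₁) → Dec (U l x₁) → Whole (suc l)
          from (no ¬c) _ = keep (⊥-elim ∘ ¬c)
          from (yes _) (yes u) = keep (λ _ → u)
          from (yes c) (no ¬u) with spread φ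
          ... | u , good-u , avoids , safe-u with extend-by-one φ x₁ u inj-φ ¬u (λ x _ → avoids x)
          ... | φ′ , old , new , inj′ = φ′ ,
                ((λ x h → trans (old x (inj₁ (inj₁ (i₀ , w∈E₀ , Dom⊆E₀ x h)))) (agree x h)) ,
                 (λ j wj x xj → subst (_∈ D′ j) (sym (old x (inj₁ (inj₁ (j , wj , xj))))) (image j wj x xj)) ,
                 (λ x h → trans (cong L (old x (inj₁ (inj₂ h)))) (cuts x h))) ,
                (λ x y a b → inj′ x y (shrink a) (shrink b)) , good′ , safe′
            where
            shrink : ∀ {x} → U (suc l) x → U l x ⊎ x ≡ x₁
            shrink (inj₁ b) = inj₁ (inj₁ b)
            shrink (inj₂ (lt , c)) with older lt
            ... | inj₁ lt′ = inj₁ (inj₂ (lt′ , c))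
            ... | inj₂ e = inj₂ e
            oldG : ∀ {x} → G l x → φ′ x ≡ φ x
            oldG (inj₁ (h , _)) = old _ (inj₁ (inj₁ (i₀ , w∈E₀ , Dom⊆E₀ _ h)))
            oldG (inj₂ q) = old _ (inj₂ q)
            shrinkG : ∀ {x} → G (suc l) x → G l x ⊎ x ≡ x₁
            shrinkG (inj₁ b) = inj₁ (inj₁ b)
            shrinkG (inj₂ (lt , c)) with older lt
            ... | inj₁ lt′ = inj₁ (inj₂ (lt′ , c))
            ... | inj₂ e = inj₂ e
            good′ : ∀ x → G (suc l) x → Good (φ′ x)
            good′ x g with shrinkG g
            ... | inj₁ h = subst Good (sym (oldG h)) (good-φ x h)
            ... | inj₂ refl = subst Good (sym new) good-u
            safe′ : ∀ x y → G (suc l) x → G (suc l) y → x ≢ y → Safe L (φ′ x) (φ′ y)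
            safe′ x y a b ne with shrinkG a | shrinkG b
            ... | inj₁ h | inj₁ h′ = subst₂ (Safe L) (sym (oldG h)) (sym (oldG h′)) (safe-φ x y h h′ ne)
            ... | inj₁ h | inj₂ refl = subst₂ (Safe L) (sym (oldG h)) (sym new) (safe-u x (good-φ x h))
            ... | inj₂ refl | inj₁ h′ = Safe-sym (subst₂ (Safe L) (sym (oldG h′)) (sym new) (safe-u y (good-φ y h′)))
            ... | inj₂ refl | inj₂ refl = ⊥-elim (ne refl)

        whole : ∀ l → l ≤ v → Whole l
        whole zero _ = let (φ , sm@(agree , _) , inj-φ) = with-cut in φ , sm ,
          (λ { x y (inj₁ a) (inj₁ b) → inj-φ x y a b ; x y (inj₂ (() , _)) _ ; x y _ (inj₂ (() , _)) }) ,
          (λ { x (inj₁ (h , ne)) → subst Good (sym (agree x h)) (good x h ne) ; x (inj₂ (() , _)) }) ,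
          (λ { x y (inj₁ (h , ne)) (inj₁ (h′ , ne′)) x≢y → subst₂ (Safe L) (sym (agree x h)) (sym (agree y h′)) (safe x y h ne h′ ne′ x≢y)
             ; x y (inj₂ (() , _)) _ ; x y (inj₁ _) (inj₂ (() , _)) })
        whole (suc l) le = grow l le (whole l (≤-trans (n≤1+n l) le))

      star⇒contains : Contains F H
      star⇒contains with whole v ≤-refl
      ... | φ , (agree , image , cuts) , inj-φ , good-φ , safe-φ = fill (U? v) φ inj-φ shared supply
        where
        core : ∀ {x} → Core x → U v x
        core {x} c = inj₂ (Fin.toℕ<n x , c)
        shared : ∀ x j j′ → j ≢ j′ → x ∈ E j → x ∈ E j′ → U v x
        shared x j j′ ne xj xj′ with w ∈? E j | x ∈? S
        ... | yes wj | _ = inj₁ (inj₁ (j , wj , xj))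
        ... | no w∉ | yes s = inj₁ (inj₂ (s , λ e → w∉ (subst (_∈ E j) e xj)))
        ... | no w∉ | no x∉S = core (j , w∉ , cover j x ((xj , j′ , ne ∘ sym , xj′) , x∉S))
        supply : ∀ j → Placed (U v) φ j ⊎ Kernel (U v) φ j
        supply j with w ∈? E j
        ... | yes wj = inj₁ ((λ x xj → inj₁ (inj₁ (j , wj , xj))) , D (β j) , image j wj)
        ... | no w∉ = inj₂ (z , X j , Y j , (z∈ , proj₁ (X∈ j) , proj₁ (Y∈ j)) ,
              (inj₁ (inj₂ z-cut) , core (j , w∉ , inj₁ refl) , core (j , w∉ , inj₂ refl)) , covered ,
              safe-φ (X j) (Y j) (inj₂ (Fin.toℕ<n _ , j , w∉ , inj₁ refl)) (inj₂ (Fin.toℕ<n _ , j , w∉ , inj₂ refl)) (X≢Y j) (φ z) (cuts z z-cut))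
          where
          z = proj₁ (cut j)
          z∈ = proj₁ (proj₂ (cut j))
          z∈S = proj₂ (proj₂ (cut j))
          z-cut : Cut′ z
          z-cut = z∈S , λ e → w∉ (subst (_∈ E j) e z∈)
          by-cut : ∀ x → x ∈ E j → Shared j x → x ≡ z ⊎ x ≡ X j ⊎ x ≡ Y j
          by-cut x xj sh with x ∈? S
          ... | yes s = inj₁ (cut-unique j x z xj s z∈ z∈S)
          ... | no x∉S = inj₂ (cover j x (sh , x∉S))
          covered : ∀ x → x ∈ E j → U v x → x ≡ z ⊎ x ≡ X j ⊎ x ≡ Y j
          covered x xj (inj₁ (inj₁ (j′ , wj′ , xj′))) = by-cut x xj (xj , j′ , (λ e → w∉ (subst (λ i → w ∈ E i) e wj′)) , xj′)
          covered x xj (inj₁ (inj₂ (s , _))) = inj₁ (cut-unique j x z xj s z∈ z∈S)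
          covered x xj (inj₂ (_ , k , w∉k , h)) with k ≟ᴱ j
          ... | yes refl = inj₂ h
          ... | no ne = by-cut x xj (xj , k , ne , proj₁ (core-in h))

    star-embeds : Contains F H
    star-embeds = FromStart.star⇒contains start

#-surj : ∀ {A B : Set} ⦃ _ : Enum A ⦄ ⦃ _ : Enum B ⦄ {P : A → Set} {Q : B → Set}
  (P? : ∀ x → Dec (P x)) (Q? : ∀ y → Dec (Q y)) (f : A → B) →
  (∀ y → Q y → ∃ λ x → P x × f x ≡ y) → # Q? ≤ # P?
#-surj P? Q? f onto = ≮⇒≥ λ lt → let (y , q , h) = missed P? Q? f lt ; (x , p , e) = onto y q in h x p e

#-complement : ∀ {n} {P : Fin n → Set} (P? : ∀ x → Dec (P x)) → # P? + # (λ x → ¬? (P? x)) ≡ n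
#-complement {n} P? = trans (cong₂ _+_ (#-cong P? (λ x → yes tt ×-dec P? x) (λ _ p → tt , p) (λ _ → proj₂))
    (#-cong (λ x → ¬? (P? x)) (λ x → yes tt ×-dec ¬? (P? x)) (λ _ p → tt , p) (λ _ → proj₂)))
  (trans (sym (#-split (λ _ → yes tt) P?)) #-full)

-- Triangles of a sparse graph: a vertex of low degree spans few pairs, one of high degree
-- is charged to its degree, so that the total is small compared with n times the number of edges.
module Triangles {n : ℕ} {R : Fin n → Fin n → Set} (R? : ∀ a b → Dec (R a b)) where

  pairs : ℕ
  pairs = ∑ (λ a → # (R? a))

  Triangle? : ∀ a b c → Dec (R a b × R a c × R b c)
  Triangle? a b c = R? a b ×-dec R? a c ×-dec R? b c

  triangles : ℕ
  triangles = ∑ (λ a → ∑ (λ b → # (Triangle? a b)))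

  private
    at : Fin n → ℕ
    at a = ∑ (λ b → # (Triangle? a b))

    at≤square : ∀ a → at a ≤ # (R? a) * # (R? a)
    at≤square a = begin
      at a                                     ≤⟨ ∑-mono (λ b → ∑-mono λ c → ≤-trans
                                                    (𝟙-mono (Triangle? a b c) (R? a b ×-dec R? a c) (λ { (x , y , _) → x , y }))
                                                    (≤-reflexive (𝟙-× (R? a b) (R? a c)))) ⟩
      ∑ (λ b → ∑ (λ c → 𝟙 (R? a b) * 𝟙 (R? a c))) ≡⟨ ∑-cong (λ b → ∑-* (𝟙 (R? a b)) (λ c → 𝟙 (R? a c))) ⟩
      ∑ (λ b → 𝟙 (R? a b) * # (R? a))          ≡⟨ ∑-*ʳ (λ b → 𝟙 (R? a b)) (# (R? a)) ⟩
      # (R? a) * # (R? a)                      ∎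
      where open ≤-Reasoning

    at≤pairs : ∀ a → at a ≤ pairs
    at≤pairs a = ∑-mono λ b → #-mono (Triangle? a b) (R? b) λ { c (_ , _ , z) → z }

    charge : ∀ N a → N * n * at a ≤ n * n * # (R? a) + N * N * pairs * # (R? a)
    charge N a with N * # (R? a) ≤? n
    ... | yes low = begin
      N * n * at a                    ≤⟨ *-monoʳ-≤ (N * n) (at≤square a) ⟩
      N * n * (# (R? a) * # (R? a))   ≡⟨ rearrange N n (# (R? a)) ⟩
      n * (N * # (R? a)) * # (R? a)   ≤⟨ *-monoˡ-≤ (# (R? a)) (*-monoʳ-≤ n low) ⟩
      n * n * # (R? a)                ≤⟨ m≤m+n _ _ ⟩
      n * n * # (R? a) + N * N * pairs * # (R? a) ∎
      where
      open ≤-Reasoning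
      rearrange : ∀ N n x → N * n * (x * x) ≡ n * (N * x) * x
      rearrange = solve-∀
    ... | no high = begin
      N * n * at a                    ≤⟨ *-mono-≤ (*-monoʳ-≤ N (<⇒≤ (≰⇒> high))) (at≤pairs a) ⟩
      N * (N * # (R? a)) * pairs      ≡⟨ rearrange N (# (R? a)) pairs ⟩
      N * N * pairs * # (R? a)        ≤⟨ m≤n+m _ _ ⟩
      n * n * # (R? a) + N * N * pairs * # (R? a) ∎
      where
      open ≤-Reasoning
      rearrange : ∀ N x p → N * (N * x) * p ≡ N * N * p * x
      rearrange = solve-∀

  few-triangles : .{{_ : NonZero n}} → ∀ N → N * N * pairs ≤ n * n → N * triangles ≤ 2 * n * pairs
  few-triangles N small = *-cancelˡ-≤ n (begin
    n * (N * triangles)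
      ≡⟨ rearrange n N triangles ⟩
    N * n * triangles
      ≡⟨ ∑-* (N * n) at ⟨
    ∑ (λ a → N * n * at a)
      ≤⟨ ∑-mono (charge N) ⟩
    ∑ (λ a → n * n * # (R? a) + N * N * pairs * # (R? a))
      ≡⟨ trans (∑-+ (λ a → n * n * # (R? a)) (λ a → N * N * pairs * # (R? a)))
           (cong₂ _+_ (∑-* (n * n) (λ a → # (R? a))) (∑-* (N * N * pairs) (λ a → # (R? a)))) ⟩
    n * n * pairs + N * N * pairs * pairs
      ≤⟨ +-monoʳ-≤ (n * n * pairs) (*-monoˡ-≤ pairs small) ⟩
    n * n * pairs + n * n * pairs
      ≡⟨ double n pairs ⟩
    n * (2 * n * pairs) ∎)
    where
    open ≤-Reasoning
    rearrange : ∀ n N t → n * (N * t) ≡ N * n * t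
    rearrange = solve-∀
    double : ∀ n p → n * n * p + n * n * p ≡ n * (2 * n * p)
    double = solve-∀

-- Linear stars, and restriction to the complement of a set

lookup-removeAt : ∀ {A : Set} {k} (e : Vec A (suc k)) j q → lookup (removeAt e j) q ≡ lookup e (punchIn j q)
lookup-removeAt e j q = subst (λ s → lookup (removeAt e j) s ≡ lookup e (punchIn j q)) (Fin.punchOut-punchIn j)
  (Vec.removeAt-punchOut e (Fin.punchInᵢ≢i j q ∘ sym))

module LinearStars (r′ p : ℕ) where

  private
    k = 3 + r′

  private
    member : Fin p → Fin (suc (p * k)) → Bool
    member i x = (toℕ x ≡ᵇ 0) ∨ ((toℕ i * k <ᵇ toℕ x) ∧ (toℕ x ≤ᵇ suc (toℕ i) * k))

    ∨-∧-split : ∀ a b c → (a ∨ (b ∧ c)) ≡ true → a ≡ true ⊎ (b ≡ true × c ≡ true)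
    ∨-∧-split true  b    c    h = inj₁ refl
    ∨-∧-split false true true h = inj₂ (refl , refl)

    holds : ∀ {b} → b ≡ true → True b
    holds refl = tt

  star-edge : ∀ (i : Fin p) x → x ∈ edge (LinearStar (4 + r′) p) i →
    toℕ x ≡ 0 ⊎ (toℕ i * k < toℕ x × toℕ x ≤ suc (toℕ i) * k)
  star-edge i x x∈ with ∨-∧-split (toℕ x ≡ᵇ 0) (toℕ i * k <ᵇ toℕ x) (toℕ x ≤ᵇ suc (toℕ i) * k)
                          (trans (sym (Vec.lookup∘tabulate (member i) x)) (Vec.[]=⇒lookup x∈))
  ... | inj₁ h = inj₁ (≡ᵇ⇒≡ (toℕ x) 0 (holds h))
  ... | inj₂ (h , h′) = inj₂ (<ᵇ⇒< (toℕ i * k) (toℕ x) (holds h) , ≤ᵇ⇒≤ (toℕ x) (suc (toℕ i) * k) (holds h′))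

  centre-in : ∀ (i : Fin p) → fzero ∈ edge (LinearStar (4 + r′) p) i
  centre-in i = Vec.lookup⇒[]= fzero _ refl

  private
    disjoint : ∀ {i j x} → i < j → x ≤ suc i * k → j * k < x → ⊥
    disjoint {i} {j} i<j x≤ <x = <⇒≱ <x (≤-trans x≤ (*-monoˡ-≤ k i<j))

  centre-only : ∀ (i j : Fin p) x → i ≢ j → x ∈ edge (LinearStar (4 + r′) p) i → x ∈ edge (LinearStar (4 + r′) p) j → x ≡ fzero
  centre-only i j x i≢j xi xj with star-edge i x xi | star-edge j x xj
  ... | inj₁ e | _ = Fin.toℕ-injective e
  ... | inj₂ _ | inj₁ e = Fin.toℕ-injective e
  ... | inj₂ (l , h) | inj₂ (l′ , h′) with <-cmp (toℕ i) (toℕ j)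
  ... | tri< lt _ _ = ⊥-elim (disjoint lt h l′)
  ... | tri≈ _ e _ = ⊥-elim (i≢j (Fin.toℕ-injective e))
  ... | tri> _ _ gt = ⊥-elim (disjoint gt h′ l)

-- The extremal number of the star concerns hypergraphs on `Fin (n ∸ t)`, so edges disjoint from `L`
-- are transported along an injection onto its complement.
module Restriction {n r t : ℕ} (F : Hypergraph n) (uniformF : Uniform F r) (simple : Simple F)
  {L : Fin n → Set} (L? : ∀ x → Dec (L x)) (#L : # L? ≡ t)
  {P : Fin (m F) → Set} (P? : ∀ i → Dec (P i)) (P-avoids : ∀ i → P i → ∀ x → x ∈ edge F i → ¬ L x) where

  private
    #¬L : # (λ x → ¬? (L? x)) ≡ n ∸ t
    #¬L = sym (trans (cong (_∸ t) (sym (#-complement L?))) (trans (cong (λ s → s + # (λ x → ¬? (L? x)) ∸ t) #L) (m+n∸m≡n t _)))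

    ι-data : ∃ λ (ι : Fin (n ∸ t) → Fin n) → InjOn (λ _ → ⊤) ι × (∀ x → ⊤ → ¬ L (ι x))
    ι-data = injection (λ _ → yes tt) (λ x → ¬? (L? x)) (λ x → inject≤ x (m∸n≤m n t))
      (≤-reflexive (trans #-full (sym #¬L)))

    ν-data : ∃ λ (ν : Fin (# P?) → Fin (m F)) → InjOn (λ _ → ⊤) ν × (∀ x → ⊤ → P (ν x))
    ν-data = injection (λ _ → yes tt) P? (λ x → inject≤ x (≤-trans (#≤size P?) (≤-reflexive (size-Fin (m F)))))
      (≤-reflexive #-full)

  ι : Fin (n ∸ t) → Fin n
  ι = proj₁ ι-data

  ν : Fin (# P?) → Fin (m F)
  ν = proj₁ ν-data

  ι-inj : ∀ x y → ι x ≡ ι y → x ≡ y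
  ι-inj x y = proj₁ (proj₂ ι-data) x y tt tt

  ν-inj : ∀ x y → ν x ≡ ν y → x ≡ y
  ν-inj x y = proj₁ (proj₂ ν-data) x y tt tt

  ν-P : ∀ i → P (ν i)
  ν-P i = proj₂ (proj₂ ν-data) i tt

  ι-onto : ∀ x → ¬ L x → ∃ λ y → ι y ≡ x
  ι-onto x h with injective⇒surjective (λ _ → yes tt) (λ x → ¬? (L? x)) ι (proj₂ (proj₂ ι-data)) (proj₁ (proj₂ ι-data))
       (≤-reflexive (trans #¬L (sym #-full))) x h
  ... | y , _ , e = y , e

  G : Hypergraph (n ∸ t)
  G = record { m = # P? ; edge = λ i → tabulate (λ y → does (ι y ∈? edge F (ν i))) }

  G⇒ : ∀ i y → y ∈ edge G i → ι y ∈ edge F (ν i)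
  G⇒ i y h = does⇒ (ι y ∈? edge F (ν i)) (trans (sym (Vec.lookup∘tabulate _ y)) (Vec.[]=⇒lookup h))

  ⇒G : ∀ i y → ι y ∈ edge F (ν i) → y ∈ edge G i
  ⇒G i y h = Vec.lookup⇒[]= y _ (trans (Vec.lookup∘tabulate _ y) (⇒does (ι y ∈? edge F (ν i)) h))

  preimage : ∀ i x → x ∈ edge F (ν i) → ∃ λ y → y ∈ edge G i × ι y ≡ x
  preimage i x h with ι-onto x (P-avoids (ν i) (ν-P i) x h)
  ... | y , refl = y , ⇒G i y h , refl

  G-uniform : Uniform G r
  G-uniform i = trans (sym (#-∈ (edge G i))) (trans (≤-antisym
      (#-inj (_∈? edge G i) (_∈? edge F (ν i)) ι (G⇒ i) (λ x y _ _ → ι-inj x y))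
      (#-surj (_∈? edge G i) (_∈? edge F (ν i)) ι (preimage i)))
    (trans (#-∈ (edge F (ν i))) (uniformF (ν i))))

  G-simple : Simple G
  G-simple {i} {j} e = ν-inj i j (simple (Subset.⊆-antisym (sub i j e) (sub j i (sym e))))
    where
    sub : ∀ i j → edge G i ≡ edge G j → ∀ {x} → x ∈ edge F (ν i) → x ∈ edge F (ν j)
    sub i j e {x} h with preimage i x h
    ... | y , y∈ , refl = G⇒ j y (subst (y ∈_) e y∈)

-- The exact bound

module Final {v r′ : ℕ} (H : Hypergraph v) (uniformH : Uniform H (4 + r′))
  (tree : IsTreeOrdering H) (reducible : Reducible H (2 + r′))
  (S : Subset v) (cross : CrossCut H S) {t p : ℕ} (∣S∣ : ∣ S ∣ ≡ suc t)
  (w : Fin v) (last : IncludedLast H S w) (star : StarIsLinear H w p)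
  {n : ℕ} (F : Hypergraph n) (uniformF : Uniform F (4 + r′)) (simple : Simple F) (H⊈F : ¬ Contains F H)
  (v≤n : v ≤ n) (t≤n : t ≤ n) (1≤n : 1 ≤ n) (L : Fin n → Bool) (#L : # (_∈ᶠ? L) ≡ t)
  (N₂ N₃ N′ : ℕ) (4v≡ : 4 * v ≡ N₂) (N₃≡ : 8 * v * (4 + r′) * (1 + 2 * N₂) ≡ N₃)
  (N₂≤ : 8 * N₂ ≤ N′) (N₃≤ : 2 * (N₃ * N₃ * (1 + 2 * N₂)) ≤ N′)
  (n-large : 2 * (t + v) < n) (n-large′ : 2 * (suc r′ * (3 + v + suc r′)) ≤ n) where

  open HFree H uniformH tree reducible S cross F uniformF v≤n H⊈F

  private
    instance
      n≢0 : NonZero n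
      n≢0 = >-nonZero 1≤n

  1≤v : 1 ≤ v
  1≤v = ≤-trans (s≤s z≤n) (Fin.toℕ<n w)

  Poor : Fin n → Fin n → Set
  Poor u z = ∃ λ c → c ∈ᶠ L × ¬ Rich F v c u z

  -- Staying outside `L` keeps both vertices distinct from the witness `c` in `L`, as needed when
  -- absent tuples are built on them.
  Q : Fin n → Fin n → Set
  Q u z = (¬ u ∈ᶠ L × ¬ z ∈ᶠ L) × u ≢ z × Poor u z

  opaque
    Poor? : ∀ u z → Dec (Poor u z)
    Poor? u z = ∃? λ c → (c ∈ᶠ? L) ×-dec ¬? (Rich? F v c u z)

    Q? : ∀ u z → Dec (Q u z)
    Q? u z = (¬? (u ∈ᶠ? L) ×-dec ¬? (z ∈ᶠ? L)) ×-dec ¬? (u ≟ᴱ z) ×-dec Poor? u z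

  q : ℕ
  q = ∑ (λ u → # (Q? u))

  -- With N₂ = 4v, any v vertices that are not hubs have together at most n / 4 neighbours in `Q`.
  Hub : Fin n → Set
  Hub u = n ≤ N₂ * # (Q? u)

  opaque
    Hub? : ∀ u → Dec (Hub u)
    Hub? u = n ≤? N₂ * # (Q? u)

  hubs : ℕ
  hubs = # Hub?

  hubs*n : hubs * n ≤ N₂ * q
  hubs*n = begin
    hubs * n                     ≡⟨ ∑-*ʳ (λ u → 𝟙 (Hub? u)) n ⟨
    ∑ (λ u → 𝟙 (Hub? u) * n)     ≤⟨ ∑-mono (λ u → 𝟙*≤ (Hub? u) id) ⟩
    ∑ (λ u → N₂ * # (Q? u))      ≡⟨ ∑-* N₂ (λ u → # (Q? u)) ⟩
    N₂ * q                       ∎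
    where open ≤-Reasoning

  -- Hubs are joined to everything, so distinct vertices outside `L` that are not joined are both
  -- good and form a safe pair. By `hubs*n` the number of pairs stays O(q).
  Q′ : Fin n → Fin n → Set
  Q′ u z = Q u z ⊎ Hub u ⊎ Hub z

  opaque
    Q′? : ∀ u z → Dec (Q′ u z)
    Q′? u z = Q? u z ⊎-dec Hub? u ⊎-dec Hub? z

  open Triangles Q′? renaming (pairs to q′)

  q′≤ : q′ ≤ (1 + 2 * N₂) * q
  q′≤ = begin
    q′
      ≤⟨ ∑-mono (λ u → ∑-mono λ z → 𝟙≤ (Q′? u z) (one u z)) ⟩
    ∑ (λ u → ∑ (λ z → 𝟙 (Q? u z) + (𝟙 (Hub? u) + 𝟙 (Hub? z))))
      ≡⟨ trans (∑-cong λ u → trans (∑-+ (λ z → 𝟙 (Q? u z)) _) (cong (# (Q? u) +_) (trans (∑-+ (λ _ → 𝟙 (Hub? u)) (λ z → 𝟙 (Hub? z)))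
           (cong (_+ hubs) (∑-Fin {n} (𝟙 (Hub? u))))))) (trans (∑-+ (λ u → # (Q? u)) _)
           (cong (q +_) (trans (∑-+ (λ u → n * 𝟙 (Hub? u)) (λ _ → hubs)) (cong₂ _+_ (∑-* n (λ u → 𝟙 (Hub? u))) (∑-Fin {n} hubs))))) ⟩
    q + (n * hubs + n * hubs)
      ≡⟨ cong (λ x → q + (x + x)) (*-comm n hubs) ⟩
    q + (hubs * n + hubs * n)
      ≤⟨ +-monoʳ-≤ q (+-mono-≤ hubs*n hubs*n) ⟩
    q + (N₂ * q + N₂ * q)
      ≡⟨ collect q N₂ ⟩
    (1 + 2 * N₂) * q ∎
    where
    open ≤-Reasoning
    collect : ∀ q N → q + (N * q + N * q) ≡ (1 + 2 * N) * q
    collect = solve-∀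
    one : ∀ u z → Q′ u z → 1 ≤ 𝟙 (Q? u z) + (𝟙 (Hub? u) + 𝟙 (Hub? z))
    one u z (inj₁ h) = ≤-trans (𝟙-≥1 (Q? u z) h) (m≤m+n _ _)
    one u z (inj₂ (inj₁ h)) = ≤-trans (≤-trans (𝟙-≥1 (Hub? u) h) (m≤m+n _ (𝟙 (Hub? z)))) (m≤n+m _ (𝟙 (Q? u z)))
    one u z (inj₂ (inj₂ h)) = ≤-trans (≤-trans (𝟙-≥1 (Hub? z) h) (m≤n+m _ (𝟙 (Hub? u)))) (m≤n+m _ (𝟙 (Q? u z)))

  module _ (few-poor : N′ * ∑ (λ u → # (Poor? u)) ≤ 2 * (n * n)) where

    q-small : N′ * q ≤ 2 * (n * n)
    q-small = ≤-trans (*-monoʳ-≤ N′ (∑-mono λ u → #-mono (Q? u) (Poor? u) λ z → proj₂ ∘ proj₂)) few-poor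

    few-hubs : 4 * hubs ≤ n
    few-hubs = *-cancelʳ-≤ (4 * hubs) n n (*-cancelˡ-≤ 2 (begin
      2 * (4 * hubs * n)     ≡⟨ shuffle hubs n ⟩
      8 * (hubs * n)         ≤⟨ *-monoʳ-≤ 8 hubs*n ⟩
      8 * (N₂ * q)           ≡⟨ *-assoc 8 N₂ q ⟨
      8 * N₂ * q             ≤⟨ *-monoˡ-≤ q N₂≤ ⟩
      N′ * q                 ≤⟨ q-small ⟩
      2 * (n * n)            ∎))
      where
      open ≤-Reasoning
      shuffle : ∀ h n → 2 * (4 * h * n) ≡ 8 * (h * n)
      shuffle = solve-∀

    Good : Fin n → Set
    Good u = ¬ Hub u × ¬ u ∈ᶠ L

    Good? : ∀ u → Dec (Good u)
    Good? u = ¬? (Hub? u) ×-dec ¬? (u ∈ᶠ? L)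

    ¬Q⇒safe : ∀ {u z} → ¬ Q u z → ¬ u ∈ᶠ L → ¬ z ∈ᶠ L → u ≢ z → ∀ c → c ∈ᶠ L → Rich F v c u z
    ¬Q⇒safe {u} {z} ¬q a b ne c c∈ with Rich? F v c u z
    ... | yes h = h
    ... | no ¬h = ⊥-elim (¬q ((a , b) , ne , c , c∈ , ¬h))

    -- At most a quarter of the vertices are hubs, at most another quarter is joined by Q to one
    -- of the v given vertices, and the others are at most t + v.
    spread : ∀ (φ : Fin v → Fin n) → ∃ λ u → Good u × (∀ x → φ x ≢ u) ×
             (∀ x → Good (φ x) → ∀ c → c ∈ᶠ L → Rich F v c (φ x) u)
    spread φ = found (∃? λ u → Good? u ×-dec ∀? (λ x → ¬? (φ x ≟ᴱ u)) ×-dec ∀? (λ x → ¬? (near? x u)))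
      where
      near? : ∀ x u → Dec (Good (φ x) × Q (φ x) u)
      near? x u = Good? (φ x) ×-dec Q? (φ x) u
      near-bound : ∀ x → N₂ * # (near? x) ≤ n
      near-bound x with Good? (φ x)
      ... | yes g = ≤-trans (*-monoʳ-≤ N₂ (#-mono (λ u → yes g ×-dec Q? (φ x) u) (Q? (φ x)) λ u → proj₂)) (<⇒≤ (≰⇒> (proj₁ g)))
      ... | no ¬g = ≤-trans (≤-reflexive (trans (cong (N₂ *_) (#-none (λ u → no ¬g ×-dec Q? (φ x) u) λ u h → ¬g (proj₁ h))) (*-zeroʳ N₂))) z≤n
      nears : ℕ
      nears = ∑ (λ x → # (near? x))
      nears-bound : 4 * nears ≤ n
      nears-bound = *-cancelˡ-≤ v {{>-nonZero 1≤v}} (begin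
        v * (4 * nears)               ≡⟨ trans (sym (*-assoc v 4 nears)) (cong (_* nears) (trans (*-comm v 4) 4v≡)) ⟩
        N₂ * nears                    ≡⟨ ∑-* N₂ (λ x → # (near? x)) ⟨
        ∑ (λ x → N₂ * # (near? x))    ≤⟨ ∑-mono near-bound ⟩
        ∑ {Fin v} (λ _ → n)           ≡⟨ ∑-Fin {v} n ⟩
        v * n                         ∎)
        where open ≤-Reasoning
      found : Dec (∃ λ u → Good u × (∀ x → φ x ≢ u) × (∀ x → ¬ (Good (φ x) × Q (φ x) u))) → _
      found (yes (u , g , fr , far)) = u , g , fr , λ x gx → ¬Q⇒safe (λ h → far x (gx , h)) (proj₂ gx) (proj₂ g) (fr x)
      found (no none) = ⊥-elim (<⇒≱ n-large (final n hubs t v nears few-hubs nears-bound all))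
        where
        final : ∀ n h t v s → 4 * h ≤ n → 4 * s ≤ n → n ≤ h + (t + (v + s)) → n ≤ 2 * (t + v)
        final n h t v s a b c = *-cancelˡ-≤ 2 (+-cancelˡ-≤ (n + n) (2 * n) (2 * (2 * (t + v))) (begin
          n + n + 2 * n                 ≡⟨ e₁ n ⟩
          4 * n                         ≤⟨ *-monoʳ-≤ 4 c ⟩
          4 * (h + (t + (v + s)))       ≡⟨ e₂ h t v s ⟩
          4 * h + 4 * s + 2 * (2 * (t + v)) ≤⟨ +-monoˡ-≤ _ (+-mono-≤ a b) ⟩
          n + n + 2 * (2 * (t + v))     ∎))
          where
          open ≤-Reasoning
          e₁ : ∀ n → n + n + 2 * n ≡ 4 * n
          e₁ = solve-∀
          e₂ : ∀ h t v s → 4 * (h + (t + (v + s))) ≡ 4 * h + 4 * s + 2 * (2 * (t + v))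
          e₂ = solve-∀
        hit? : ∀ u → Dec (∃ λ x → φ x ≡ u)
        hit? u = ∃? λ x → φ x ≟ᴱ u
        near-some? : ∀ u → Dec (∃ λ x → Good (φ x) × Q (φ x) u)
        near-some? u = ∃? λ x → near? x u
        cases : ∀ u → Hub u ⊎ u ∈ᶠ L ⊎ (∃ λ x → φ x ≡ u) ⊎ (∃ λ x → Good (φ x) × Q (φ x) u)
        cases u with Hub? u | u ∈ᶠ? L | hit? u | near-some? u
        ... | yes h | _ | _ | _ = inj₁ h
        ... | no _ | yes h | _ | _ = inj₂ (inj₁ h)
        ... | no _ | no _ | yes h | _ = inj₂ (inj₂ (inj₁ h))
        ... | no _ | no _ | no _ | yes h = inj₂ (inj₂ (inj₂ h))
        ... | no a | no b | no c | no d = ⊥-elim (none (u , (a , b) , (λ x e → c (x , e)) , λ x h → d (x , h)))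
        all : n ≤ hubs + (t + (v + nears))
        all = begin
          n
            ≡⟨ #-full ⟨
          # {A = Fin n} (λ _ → yes tt)
            ≤⟨ #-⊎ (λ _ → yes tt) Hub? (λ u → (u ∈ᶠ? L) ⊎-dec hit? u ⊎-dec near-some? u) (λ u _ → cases u) ⟩
          hubs + # (λ u → (u ∈ᶠ? L) ⊎-dec hit? u ⊎-dec near-some? u)
            ≤⟨ +-monoʳ-≤ hubs (#-⊎ (λ u → (u ∈ᶠ? L) ⊎-dec hit? u ⊎-dec near-some? u) (_∈ᶠ? L) (λ u → hit? u ⊎-dec near-some? u) (λ u → id)) ⟩
          hubs + (# (_∈ᶠ? L) + # (λ u → hit? u ⊎-dec near-some? u))
            ≤⟨ +-monoʳ-≤ hubs (+-mono-≤ (≤-reflexive #L) (#-⊎ (λ u → hit? u ⊎-dec near-some? u) hit? near-some? (λ u → id))) ⟩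
          hubs + (t + (# hit? + # near-some?))
            ≤⟨ +-monoʳ-≤ hubs (+-monoʳ-≤ t (+-mono-≤
                 (≤-trans (#-surj (λ _ → yes tt) hit? φ (λ { u (x , e) → x , tt , e })) (≤-reflexive #-full))
                 (#-∃ near-some? (λ u x → near? x u) (λ u h → h)))) ⟩
          hubs + (t + (v + nears)) ∎
          where open ≤-Reasoning

    Meets : Fin (m F) → Set
    Meets i = ∃ λ x → x ∈ edge F i × x ∈ᶠ L

    Meets? : ∀ i → Dec (Meets i)
    Meets? i = ∃? λ x → (x ∈? edge F i) ×-dec (x ∈ᶠ? L)

    Clique : Fin (m F) → Set
    Clique i = ∀ u → u ∈ edge F i → ∀ z → z ∈ edge F i → u ≢ z → Q′ u z

    Clique? : ∀ i → Dec (Clique i)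
    Clique? i = ∀? λ u → (u ∈? edge F i) →-dec ∀? λ z → (z ∈? edge F i) →-dec (¬? (u ≟ᴱ z) →-dec Q′? u z)

    Stuck : Fin (m F) → Set
    Stuck i = ¬ Meets i × Clique i

    Plain : Fin (m F) → Set
    Plain i = ¬ Meets i × ¬ Clique i

    opaque
      Stuck? : ∀ i → Dec (Stuck i)
      Stuck? i = ¬? (Meets? i) ×-dec Clique? i

      Plain? : ∀ i → Dec (Plain i)
      Plain? i = ¬? (Meets? i) ×-dec ¬? (Clique? i)

    edges-split : m F ≤ # Meets? + (# Stuck? + # Plain?)
    edges-split = begin
      m F                                                     ≡⟨ #-full ⟨
      # {A = Fin (m F)} (λ _ → yes tt)                        ≤⟨ #-⊎ (λ _ → yes tt) Meets? (λ i → Stuck? i ⊎-dec Plain? i) cases ⟩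
      # Meets? + # (λ i → Stuck? i ⊎-dec Plain? i)            ≤⟨ +-monoʳ-≤ (# Meets?) (#-⊎ (λ i → Stuck? i ⊎-dec Plain? i) Stuck? Plain? (λ _ → id)) ⟩
      # Meets? + (# Stuck? + # Plain?)                        ∎
      where
      open ≤-Reasoning
      cases : ∀ i → ⊤ → Meets i ⊎ (Stuck i ⊎ Plain i)
      cases i _ with Meets? i | Clique? i
      ... | yes a | _ = inj₁ a
      ... | no a | yes b = inj₂ (inj₁ (a , b))
      ... | no a | no b = inj₂ (inj₂ (a , b))

    free-pair : ∀ i → Plain i → ∃ λ u → ∃ λ z → u ≢ z × (u ∈ edge F i × z ∈ edge F i) × (Good u × Good z) ×
                (∀ c → c ∈ᶠ L → Rich F v c u z)
    free-pair i (¬meets , ¬clique) = from (∃? λ u → (u ∈? edge F i) ×-dec ∃? λ z → (z ∈? edge F i) ×-dec ¬? (u ≟ᴱ z) ×-dec ¬? (Q′? u z))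
      where
      off : ∀ x → x ∈ edge F i → ¬ x ∈ᶠ L
      off x x∈ h = ¬meets (x , x∈ , h)
      from : Dec (∃ λ u → u ∈ edge F i × ∃ λ z → z ∈ edge F i × u ≢ z × ¬ Q′ u z) → _
      from (yes (u , u∈ , z , z∈ , ne , ¬q)) = u , z , ne , (u∈ , z∈) ,
        (((λ h → ¬q (inj₂ (inj₁ h))) , off u u∈) , ((λ h → ¬q (inj₂ (inj₂ h))) , off z z∈)) ,
        ¬Q⇒safe (¬q ∘ inj₁) (off u u∈) (off z z∈) ne
      from (no none) = ⊥-elim (¬clique λ u u∈ z z∈ ne → case Q′? u z of λ
        { (yes h) → h ; (no h) → ⊥-elim (none (u , u∈ , z , z∈ , ne , h)) })

    module R = Restriction {t = t} F uniformF simple (_∈ᶠ? L) #L Plain? (λ i pl x x∈ h → proj₁ pl (x , x∈ , h))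
    open LinearStars r′ p

    plain-free : ¬ Contains R.G (LinearStar (4 + r′) p)
    plain-free (φ , φ-inj , ψ , ψ-inj , h) = H⊈F (StarEmbedding.star-embeds H uniformH tree reducible S cross ∣S∣ w last star F uniformF v≤n
      L #L {Good} spread D (R.ι (φ fzero)) centre-D D-linear
      (λ i x x∈ l → proj₁ (R.ν-P (ψ i)) (x , x∈ , l)) (λ i → free-pair (D i) (R.ν-P (ψ i))))
      where
      D : Fin p → Fin (m F)
      D i = R.ν (ψ i)
      centre-D : ∀ i → R.ι (φ fzero) ∈ edge F (D i)
      centre-D i = R.G⇒ (ψ i) (φ fzero) (proj₁ (h i) fzero (centre-in i))
      D-linear : ∀ i j → i ≢ j → ∀ x → x ∈ edge F (D i) → x ∈ edge F (D j) → x ≡ R.ι (φ fzero)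
      D-linear i j ne x xi xj =
        let (y , y∈ , ιy) = R.preimage (ψ i) x xi
            (y′ , y′∈ , ιy′) = R.preimage (ψ j) x xj
            (a , a∈ , φa) = proj₂ (h i) y y∈
            (b , b∈ , φb) = proj₂ (h j) y′ y′∈
            a≡b = φ-inj (trans φa (trans (R.ι-inj y y′ (trans ιy (sym ιy′))) (sym φb)))
            a≡0 = centre-only i j a ne a∈ (subst (λ s → s ∈ edge (LinearStar (4 + r′) p) j) (sym a≡b) b∈)
        in trans (sym ιy) (cong R.ι (trans (sym φa) (cong φ a≡0)))

    plain-bound : ∀ {e} → IsEx (4 + r′) (n ∸ t) (LinearStar (4 + r′) p) e → # Plain? ≤ e
    plain-bound (_ , max) = max R.G (R.G-uniform , R.G-simple , plain-free)

    opaque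
      stuck-tuple? : ∀ (e : Vec (Fin n) r) → Dec (∃ λ i → Stuck i × Enumerates i e)
      stuck-tuple? e = ∃? λ i → Stuck? i ×-dec Enumerates? i e

    -- Deleting one entry of a stuck tuple leaves r - 1 ≥ 3 pairwise joined vertices: the first
    -- three form a triangle, and the other r - 4 are estimated trivially.
    stuck-bound : ff r r * # Stuck? ≤ 2 * v * (r * (triangles * n ^ r′))
    stuck-bound = begin
      ff r r * # Stuck?
        ≤⟨ #-tuples uniformF simple Stuck? ⟩
      _ ≤⟨ #-mono (λ e → ∃? λ i → Stuck? i ×-dec Enumerates? i e) (_∈ᶠ? T) (λ e → ⇒does (stuck-tuple? e)) ⟩
      # (_∈ᶠ? T)
        ≤⟨ small-family {T} T⊆ (triangles * n ^ r′) shadow-bound ⟩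
      2 * v * (r * (triangles * n ^ r′)) ∎
      where
      open ≤-Reasoning
      T : Family
      T = ⟦ stuck-tuple? ⟧
      T⇒ : ∀ e → e ∈ᶠ T → ∃ λ i → Stuck i × Enumerates i e
      T⇒ e = does⇒ (stuck-tuple? e)
      T⊆ : EdgeFamily T
      T⊆ e h = let (i , _ , g) = T⇒ e h in i , g
      first-triangle? : ∀ (y : Vec (Fin n) (3 + r′)) → _
      first-triangle? y = Triangle? (lookup y fzero) (lookup y (fsuc fzero)) (lookup y (fsuc (fsuc fzero)))
      joined : ∀ j e → e ∈ᶠ T → ∀ a b → a ≢ b → Q′ (lookup (removeAt e j) a) (lookup (removeAt e j) b)
      joined j e h a b ne = let (i , (_ , clique) , g) = T⇒ e h in
        subst₂ Q′ (sym (lookup-removeAt e j a)) (sym (lookup-removeAt e j b))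
          (clique _ (Emb-∈ e g (punchIn j a)) _ (Emb-∈ e g (punchIn j b))
            (λ eq → ne (Fin.punchIn-injective j a b (Emb-inj e g _ _ eq))))
      shadow-bound : ∀ j → shadow (single j) T ≤ triangles * n ^ r′
      shadow-bound j = begin
        shadow (single j) T
          ≤⟨ #-mono _ first-triangle? (λ { y (e , h , refl) →
               joined j e h _ _ (λ ()) , joined j e h _ _ (λ ()) , joined j e h _ _ (λ ()) }) ⟩
        # first-triangle?
          ≡⟨ ∑-∷₃ (λ y → 𝟙 (first-triangle? y)) ⟩
        ∑ (λ a → ∑ (λ b → ∑ (λ c → ∑ {Vec (Fin n) r′} (λ τ → 𝟙 (Triangle? a b c)))))
          ≡⟨ (∑-cong λ a → trans (∑-cong λ b → trans (∑-cong λ c → trans (∑-Vec {n} {r′} (𝟙 (Triangle? a b c))) (*-comm (n ^ r′) _))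
               (∑-*ʳ (λ c → 𝟙 (Triangle? a b c)) (n ^ r′))) (∑-*ʳ (λ b → # (Triangle? a b)) (n ^ r′))) ⟩
        ∑ (λ a → ∑ (λ b → # (Triangle? a b)) * n ^ r′)
          ≡⟨ ∑-*ʳ (λ a → ∑ (λ b → # (Triangle? a b))) (n ^ r′) ⟩
        triangles * n ^ r′ ∎

    Any? : ∀ (x : Fin n) → Dec ⊤
    Any? _ = yes tt

    -- What `F` lacks compared with all r-sets meeting `L`; ordering a vertex of `L` first allows
    -- counting from a poor pair and its witness.
    Absent : Vec (Fin n) r → Set
    Absent e = lookup e fzero ∈ᶠ L × Emb (λ _ → ⊤) e × ¬ (∃ λ i → Enumerates i e)

    opaque
      Absent? : ∀ e → Dec (Absent e)
      Absent? e = (lookup e fzero ∈ᶠ? L) ×-dec Emb? Any? e ×-dec ¬? (∃? λ i → Enumerates? i e)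

    private
      #-avoid : ∀ {P : Fin n → Set} (P? : ∀ x → Dec (P x)) {k} (Z : Vec (Fin n) k) →
        # P? ≤ # (λ x → P? x ×-dec ∀? (λ i → ¬? (x ≟ᴱ lookup Z i))) + k
      #-avoid P? {k} Z = begin
        # P?
          ≤⟨ #-⊎ P? (λ x → P? x ×-dec ∀? (λ i → ¬? (x ≟ᴱ lookup Z i))) (λ x → ∃? λ i → lookup Z i ≟ᴱ x) cases ⟩
        _ ≤⟨ +-monoʳ-≤ _ (≤-trans (#-surj (λ _ → yes tt) (λ x → ∃? λ i → lookup Z i ≟ᴱ x) (lookup Z) (λ { x (i , e) → i , tt , e }))
               (≤-reflexive #-full)) ⟩
        # (λ x → P? x ×-dec ∀? (λ i → ¬? (x ≟ᴱ lookup Z i))) + k ∎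
        where
        open ≤-Reasoning
        cases : ∀ x → _ → (_ × (∀ i → x ≢ lookup Z i)) ⊎ (∃ λ i → lookup Z i ≡ x)
        cases x h with ∃? (λ i → lookup Z i ≟ᴱ x)
        ... | yes e = inj₂ e
        ... | no ne = inj₁ (h , λ i e → ne (i , sym e))

    -- A triple that is not rich has a list `Z` such that every edge through the triple contains an
    -- entry of `Z` outside it. Hence any completion avoiding `Z` is absent, and at most 3 + v
    -- vertices are excluded from it.
    absent-through : ∀ c u z → c ∈ᶠ L → u ≢ c → z ≢ c → z ≢ u → ¬ Rich F v c u z →
      ff (n ∸ (3 + v)) (suc r′) ≤ # (λ τ → Absent? (c ∷ u ∷ z ∷ τ))
    absent-through c u z c∈ u≢c z≢c z≢u ¬rich = from (∃? λ Z → ¬? (Escapes? F c u z Z))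
      where
      from : Dec (∃ λ (Z : Vec (Fin n) v) → ¬ Escapes F c u z Z) → ff (n ∸ (3 + v)) (suc r′) ≤ # (λ τ → Absent? (c ∷ u ∷ z ∷ τ))
      from (no none) = ⊥-elim (¬rich λ Z → case Escapes? F c u z Z of λ { (yes h) → h ; (no ¬h) → ⊥-elim (none (Z , ¬h)) })
      from (yes (Z , ¬h)) = begin
        ff (n ∸ (3 + v)) (suc r′)
          ≤⟨ ff-mono (suc r′) (m≤n+o⇒m∸n≤o n (3 + v) enough) ⟩
        ff (# off?) (suc r′)
          ≡⟨ #-Emb (suc r′) off? ⟨
        # (Emb? {k = suc r′} off?)
          ≤⟨ #-mono (Emb? {k = suc r′} off?) (λ τ → Absent? (c ∷ u ∷ z ∷ τ)) (λ τ g → c∈ ,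
               (tt , (tt , u≢c) , ((tt , z≢c) , z≢u) , Emb-mono τ (λ { x (a , b , _) → a , b }) g) , λ { (i , en) → uncovered τ g i en }) ⟩
        # (λ τ → Absent? (c ∷ u ∷ z ∷ τ)) ∎
        where
        open ≤-Reasoning
        Off′ : Fin n → Set
        Off′ x = ((⊤ × x ≢ c) × x ≢ u) × x ≢ z × (∀ i → x ≢ lookup Z i)
        off? : ∀ x → Dec (Off′ x)
        off? x = ((yes tt ×-dec ¬? (x ≟ᴱ c)) ×-dec ¬? (x ≟ᴱ u)) ×-dec ¬? (x ≟ᴱ z) ×-dec ∀? (λ i → ¬? (x ≟ᴱ lookup Z i))
        enough : n ≤ 3 + v + # off?
        enough = begin
          n ≡⟨ #-full ⟨
          # Any? ≤⟨ #-avoid Any? (c ∷ u ∷ z ∷ Z) ⟩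
          # (λ x → yes tt ×-dec ∀? (λ i → ¬? (x ≟ᴱ lookup (c ∷ u ∷ z ∷ Z) i))) + (3 + v)
            ≤⟨ +-monoˡ-≤ (3 + v) (#-mono _ off? λ x g →
                 ((tt , proj₂ g fzero) , proj₂ g (fsuc fzero)) , proj₂ g (fsuc (fsuc fzero)) , λ i → proj₂ g (fsuc (fsuc (fsuc i)))) ⟩
          # off? + (3 + v) ≡⟨ +-comm (# off?) (3 + v) ⟩
          3 + v + # off? ∎
        uncovered : ∀ τ → Emb Off′ τ → ∀ i → Enumerates i (c ∷ u ∷ z ∷ τ) → ⊥
        uncovered τ g i en = ¬h (i , (Emb-∈ (c ∷ u ∷ z ∷ τ) en fzero , Emb-∈ (c ∷ u ∷ z ∷ τ) en (fsuc fzero) , Emb-∈ (c ∷ u ∷ z ∷ τ) en (fsuc (fsuc fzero))) ,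
          λ k z∈ → at k (enumerates-surj uniformF i (c ∷ u ∷ z ∷ τ) en _ z∈))
          where
          at : ∀ k → (∃ λ s → lookup (c ∷ u ∷ z ∷ τ) s ≡ lookup Z k) → lookup Z k ≡ c ⊎ lookup Z k ≡ u ⊎ lookup Z k ≡ z
          at k (fzero , e) = inj₁ (sym e)
          at k (fsuc fzero , e) = inj₂ (inj₁ (sym e))
          at k (fsuc (fsuc fzero) , e) = inj₂ (inj₂ (sym e))
          at k (fsuc (fsuc (fsuc s)) , e) = ⊥-elim (proj₂ (proj₂ (Emb-∈ τ g s)) k e)

    absent-bound : q * ff (n ∸ (3 + v)) (suc r′) ≤ # Absent?
    absent-bound = begin
      q * f
        ≡⟨ trans (sym (∑-*ʳ (λ u → # (Q? u)) f)) (∑-cong λ u → sym (∑-*ʳ (λ z → 𝟙 (Q? u z)) f)) ⟩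
      ∑ (λ u → ∑ (λ z → 𝟙 (Q? u z) * f))
        ≤⟨ ∑-mono (λ u → ∑-mono λ z → 𝟙*≤ (Q? u z) (one u z)) ⟩
      ∑ (λ u → ∑ (λ z → ∑ (λ c → # (λ τ → Absent? (c ∷ u ∷ z ∷ τ)))))
        ≡⟨ trans (∑-cong λ u → ∑-swap (λ z c → # (λ τ → Absent? (c ∷ u ∷ z ∷ τ)))) (∑-swap (λ u c → ∑ (λ z → # (λ τ → Absent? (c ∷ u ∷ z ∷ τ))))) ⟩
      ∑ (λ c → ∑ (λ u → ∑ (λ z → # (λ τ → Absent? (c ∷ u ∷ z ∷ τ)))))
        ≡⟨ ∑-∷₃ (λ e → 𝟙 (Absent? e)) ⟨
      # Absent? ∎
      where
      open ≤-Reasoning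
      f = ff (n ∸ (3 + v)) (suc r′)
      one : ∀ u z → Q u z → f ≤ ∑ (λ c → # (λ τ → Absent? (c ∷ u ∷ z ∷ τ)))
      one u z ((u∉ , z∉) , ne , c , c∈ , ¬rich) = ≤-trans
        (absent-through c u z c∈ (λ e → u∉ (trans (cong L e) c∈)) (λ e → z∉ (trans (cong L e) c∈)) (ne ∘ sym) ¬rich)
        (∑-≥ (λ c → # (λ τ → Absent? (c ∷ u ∷ z ∷ τ))) c)

    half-power : n ^ suc r′ ≤ 2 * ff (n ∸ (3 + v)) (suc r′)
    half-power = +-cancelʳ-≤ (n ^ suc r′) _ _ (begin
      n ^ suc r′ + n ^ suc r′
        ≡⟨ cong (n ^ suc r′ +_) (+-identityʳ (n ^ suc r′)) ⟨
      2 * n ^ suc r′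
        ≤⟨ *-monoʳ-≤ 2 (ff-lower n (3 + v) r′) ⟩
      2 * (ff (n ∸ (3 + v)) (suc r′) + suc r′ * (3 + v + suc r′) * n ^ r′)
        ≡⟨ distribute (ff (n ∸ (3 + v)) (suc r′)) (suc r′ * (3 + v + suc r′)) (n ^ r′) ⟩
      2 * ff (n ∸ (3 + v)) (suc r′) + 2 * (suc r′ * (3 + v + suc r′)) * n ^ r′
        ≤⟨ +-monoʳ-≤ (2 * ff (n ∸ (3 + v)) (suc r′)) (*-monoˡ-≤ (n ^ r′) n-large′) ⟩
      2 * ff (n ∸ (3 + v)) (suc r′) + n ^ suc r′ ∎)
      where
      open ≤-Reasoning
      distribute : ∀ f c x → 2 * (f + c * x) ≡ 2 * f + 2 * c * x
      distribute = solve-∀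

    private
      -- `N₃` collects the losses: 2 v r from the shadow bound, 2 from counting triangles, 1 + 2 N₂
      -- from the hubs, and 2 from replacing a power of n by the falling factorial.
      generic : ∀ v r N₂ N₃ q q′ tri X n f miss → 1 ≤ v → 1 ≤ r → 8 * v * r * (1 + 2 * N₂) ≡ N₃ →
        q′ ≤ (1 + 2 * N₂) * q → N₃ * tri ≤ 2 * n * q′ → n * X ≤ 2 * f → q * f ≤ miss →
        2 * v * (r * (tri * X)) ≤ miss
      generic v r N₂ N₃ q q′ tri X n f miss 1≤v 1≤r eq h₁ h₂ h₃ h₄ = ≤-trans (*-cancelˡ-≤ (2 * N₃) {{>-nonZero 1≤2N₃}} (begin
        2 * N₃ * (2 * v * (r * (tri * X)))          ≡⟨ e₁ v r N₃ tri X ⟩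
        4 * v * r * X * (N₃ * tri)                  ≤⟨ *-monoʳ-≤ (4 * v * r * X) h₂ ⟩
        4 * v * r * X * (2 * n * q′)                ≤⟨ *-monoʳ-≤ (4 * v * r * X) (*-monoʳ-≤ (2 * n) h₁) ⟩
        4 * v * r * X * (2 * n * ((1 + 2 * N₂) * q)) ≡⟨ e₂ v r X n N₂ q ⟩
        8 * v * r * (1 + 2 * N₂) * (q * (n * X))    ≡⟨ cong (_* (q * (n * X))) eq ⟩
        N₃ * (q * (n * X))                          ≤⟨ *-monoʳ-≤ N₃ (*-monoʳ-≤ q h₃) ⟩
        N₃ * (q * (2 * f))                          ≡⟨ e₃ N₃ q f ⟩
        2 * N₃ * (q * f)                            ∎)) h₄
        where
        open ≤-Reasoning
        1≤N₃ : 1 ≤ N₃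
        1≤N₃ = subst (1 ≤_) eq (*-mono-≤ (*-mono-≤ (*-mono-≤ (s≤s (z≤n {7})) 1≤v) 1≤r) (s≤s (z≤n {2 * N₂})))
        1≤2N₃ : 1 ≤ 2 * N₃
        1≤2N₃ = *-mono-≤ (s≤s (z≤n {1})) 1≤N₃
        e₁ : ∀ v r N t X → 2 * N * (2 * v * (r * (t * X))) ≡ 4 * v * r * X * (N * t)
        e₁ = solve-∀
        e₂ : ∀ v r X n N q → 4 * v * r * X * (2 * n * ((1 + 2 * N) * q)) ≡ 8 * v * r * (1 + 2 * N) * (q * (n * X))
        e₂ = solve-∀
        e₃ : ∀ N q f → N * (q * (2 * f)) ≡ 2 * N * (q * f)
        e₃ = solve-∀

    q′-small : N₃ * N₃ * q′ ≤ n * n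
    q′-small = *-cancelˡ-≤ 2 (begin
      2 * (N₃ * N₃ * q′)                        ≤⟨ *-monoʳ-≤ 2 (*-monoʳ-≤ (N₃ * N₃) q′≤) ⟩
      2 * (N₃ * N₃ * ((1 + 2 * N₂) * q))        ≡⟨ rearrange (N₃ * N₃) (1 + 2 * N₂) q ⟩
      2 * (N₃ * N₃ * (1 + 2 * N₂)) * q          ≤⟨ *-monoˡ-≤ q N₃≤ ⟩
      N′ * q                                    ≤⟨ q-small ⟩
      2 * (n * n)                               ∎)
      where
      open ≤-Reasoning
      rearrange : ∀ x y q → 2 * (x * (y * q)) ≡ 2 * (x * y) * q
      rearrange = solve-∀

    stuck≤absent : ff r r * # Stuck? ≤ # Absent?
    stuck≤absent = ≤-trans stuck-bound (generic v r N₂ N₃ q q′ triangles (n ^ r′) n (ff (n ∸ (3 + v)) (suc r′)) (# Absent?)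
      1≤v (s≤s z≤n) N₃≡ q′≤ (few-triangles N₃ q′-small) half-power absent-bound)

    private
      meet-tuple? : ∀ (e : Vec (Fin n) r) → Dec (∃ λ i → Meets i × Enumerates i e)
      meet-tuple? e = ∃? λ i → Meets? i ×-dec Enumerates? i e

      off-L? : ∀ x → Dec (¬ x ∈ᶠ L)
      off-L? x = ¬? (x ∈ᶠ? L)

      ≤1 : {P Q R T : Set} (p : Dec P) (q : Dec Q) (r : Dec R) (s : Dec T) →
        (P → T) → (Q → T) → (R → T) → (P → Q → ⊥) → (P → R → ⊥) → (Q → R → ⊥) → 𝟙 p + (𝟙 q + 𝟙 r) ≤ 𝟙 s
      ≤1 p@(yes a) q r s f g h pq pr qr rewrite 𝟙-yes p a | 𝟙-no q (pq a) | 𝟙-no r (pr a) = 𝟙-≥1 s (f a)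
      ≤1 p@(no ¬a) q@(yes b) r s f g h pq pr qr rewrite 𝟙-no p ¬a | 𝟙-yes q b | 𝟙-no r (qr b) = 𝟙-≥1 s (g b)
      ≤1 p@(no ¬a) q@(no ¬b) r s f g h pq pr qr rewrite 𝟙-no p ¬a | 𝟙-no q ¬b = 𝟙-mono r s h

    -- Enumerations of edges meeting `L`, absent tuples, and tuples outside `L` are three disjoint
    -- kinds of tuples with distinct entries.
    meets-bound : ff r r * # Meets? + (# Absent? + ff (n ∸ t) r) ≤ ff n r
    meets-bound = begin
      ff r r * # Meets? + (# Absent? + ff (n ∸ t) r)
        ≤⟨ +-mono-≤ (#-tuples uniformF simple Meets?) (+-monoʳ-≤ (# Absent?) (≤-reflexive (trans (cong (λ s → ff s r) (sym #off)) (sym (#-Emb r off-L?))))) ⟩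
      # meet-tuple? + (# Absent? + # (Emb? {k = r} off-L?))
        ≡⟨ trans (cong (# meet-tuple? +_) (sym (∑-+ (λ e → 𝟙 (Absent? e)) (λ e → 𝟙 (Emb? {k = r} off-L? e)))))
             (sym (∑-+ (λ e → 𝟙 (meet-tuple? e)) (λ e → 𝟙 (Absent? e) + 𝟙 (Emb? {k = r} off-L? e)))) ⟩
      ∑ (λ e → 𝟙 (meet-tuple? e) + (𝟙 (Absent? e) + 𝟙 (Emb? {k = r} off-L? e)))
        ≤⟨ ∑-mono (λ e → ≤1 (meet-tuple? e) (Absent? e) (Emb? off-L? e) (Emb? Any? e)
             (λ { (i , _ , en) → Emb-mono e (λ _ _ → tt) en }) (λ a → proj₁ (proj₂ a)) (Emb-mono e (λ _ _ → tt))
             (λ { (i , _ , en) (_ , _ , none) → none (i , en) }) (meet-off e) (λ a off → Emb-∈ e off fzero (proj₁ a))) ⟩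
      # (Emb? {k = r} Any?)
        ≡⟨ trans (#-Emb r Any?) (cong (λ s → ff s r) #-full) ⟩
      ff n r ∎
      where
      open ≤-Reasoning
      #off : # off-L? ≡ n ∸ t
      #off = sym (trans (cong (_∸ t) (sym (#-complement (_∈ᶠ? L)))) (trans (cong (λ s → s + # off-L? ∸ t) #L) (m+n∸m≡n t _)))
      meet-off : ∀ e → (∃ λ i → Meets i × Enumerates i e) → Emb (λ x → ¬ x ∈ᶠ L) e → ⊥
      meet-off e (i , (x , x∈ , l) , en) off =
        let (s , eq) = enumerates-surj uniformF i e en x x∈ in Emb-∈ e off s (subst (_∈ᶠ L) (sym eq) l)

    edge-bound : ∀ {e} → IsEx (4 + r′) (n ∸ t) (LinearStar (4 + r′) p) e → m F ≤ (n C r) ∸ ((n ∸ t) C r) + e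
    edge-bound {e} ex = conclude (n C r) ((n ∸ t) C r) (m F) e (*-cancelˡ-≤ (ff r r) {{>-nonZero (ff-pos r r ≤-refl)}} (begin
      ff r r * (m F + ((n ∸ t) C r))
        ≡⟨ trans (*-distribˡ-+ (ff r r) (m F) _) (cong (ff r r * m F +_) (trans (*-comm (ff r r) _) (C-ff (n ∸ t) r))) ⟩
      ff r r * m F + ff (n ∸ t) r
        ≤⟨ +-monoˡ-≤ (ff (n ∸ t) r) (*-monoʳ-≤ (ff r r) edges-split) ⟩
      ff r r * (# Meets? + (# Stuck? + # Plain?)) + ff (n ∸ t) r
        ≡⟨ expand (ff r r) (# Meets?) (# Stuck?) (# Plain?) (ff (n ∸ t) r) ⟩
      ff r r * # Meets? + (ff r r * # Stuck? + ff (n ∸ t) r) + ff r r * # Plain?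
        ≤⟨ +-mono-≤ (+-monoʳ-≤ (ff r r * # Meets?) (+-monoˡ-≤ (ff (n ∸ t) r) stuck≤absent)) (*-monoʳ-≤ (ff r r) (plain-bound ex)) ⟩
      ff r r * # Meets? + (# Absent? + ff (n ∸ t) r) + ff r r * e
        ≤⟨ +-monoˡ-≤ (ff r r * e) meets-bound ⟩
      ff n r + ff r r * e
        ≡⟨ trans (cong (_+ ff r r * e) (trans (sym (C-ff n r)) (*-comm (n C r) _))) (sym (*-distribˡ-+ (ff r r) (n C r) e)) ⟩
      ff r r * ((n C r) + e) ∎))
      where
      open ≤-Reasoning
      expand : ∀ f a b c x → f * (a + (b + c)) + x ≡ f * a + (f * b + x) + f * c
      expand = solve-∀
      -- If B exceeded A, the truncated difference would be 0, and the hypothesis gives x ≤ e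
      -- directly.
      conclude : ∀ A B x e → x + B ≤ A + e → x ≤ A ∸ B + e
      conclude A B x e h with B ≤? A
      ... | yes B≤A = ≤-trans (m+n≤o⇒m≤o∸n x h) (≤-reflexive (trans (cong (_∸ B) (+-comm A e)) (trans (+-∸-assoc e B≤A) (+-comm e (A ∸ B)))))
      ... | no B≰A = ≤-trans (≤-trans (m+n≤o⇒m≤o∸n x h) (≤-trans (∸-monoʳ-≤ (A + e) (<⇒≤ (≰⇒> B≰A))) (≤-reflexive (m+n∸m≡n A e)))) (m≤n+m e (A ∸ B))

-- Choice of the constants

module _ {v r′ : ℕ} (H : Hypergraph v) (uniformH : Uniform H (4 + r′))
  (tree : IsTreeOrdering H) (reducible : Reducible H (2 + r′))
  (S : Subset v) (cross : CrossCut H S) {t p : ℕ} (∣S∣ : ∣ S ∣ ≡ suc t)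
  (w : Fin v) (last : IncludedLast H S w) (star : StarIsLinear H w p) where

  upper-bound : ∀ (N₂ N₃ N′ : ℕ) → 4 * v ≡ N₂ → 8 * v * (4 + r′) * (1 + 2 * N₂) ≡ N₃ →
    8 * N₂ ≤ N′ → 2 * (N₃ * N₃ * (1 + 2 * N₂)) ≤ N′ → 2 ≤ N′ →
    ∀ {n} → v ≤ n → t ≤ n → 1 ≤ n → stability-threshold v r′ t N′ ≤ n → 2 * (t + v) < n → 2 * (suc r′ * (3 + v + suc r′)) ≤ n →
    ∀ {e} → IsEx (4 + r′) (n ∸ t) (LinearStar (4 + r′) p) e → ∀ (F : Hypergraph n) → Free (4 + r′) n H F →
    m F ≤ (n C (4 + r′)) ∸ ((n ∸ t) C (4 + r′)) + e
  upper-bound N₂ N₃ N′ N₂≡ N₃≡ N₂≤ N₃≤ 2≤N′ {n} v≤n t≤n 1≤n stable large large′ {e} ex F (uniformF , simple , H⊈F)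
    with (n C (4 + r′)) ∸ ((n ∸ t) C (4 + r′)) ≤? m F
  -- With fewer edges than there are r-sets meeting a t-set the bound is immediate; otherwise
  -- stability applies.
  ... | no few = ≤-trans (<⇒≤ (≰⇒> few)) (m≤m+n _ e)
  ... | yes many = F.edge-bound few-poor ex
    where
    module St = Stability H uniformH tree reducible S cross F uniformF v≤n H⊈F simple t ∣S∣ N′ 1≤n t≤n many
    centres : ∃ λ L → # (_∈ᶠ? L) ≡ t × N′ * ∑ (λ u → # (St.Poor? L u)) ≤ 2 * (n * n)
    centres = St.centre-set 2≤N′ stable
    module F = Final H uniformH tree reducible S cross {t} {p} ∣S∣ w last star F uniformF simple H⊈F v≤n t≤n 1≤n
      (proj₁ centres) (proj₁ (proj₂ centres)) N₂ N₃ N′ N₂≡ N₃≡ N₂≤ N₃≤ large large′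
    few-poor : N′ * ∑ (λ u → # (F.Poor? u)) ≤ 2 * (n * n)
    few-poor = ≤-trans (*-monoʳ-≤ N′ (∑-mono λ u → #-mono (F.Poor? u) (St.Poor? (proj₁ centres) u) λ z → id)) (proj₂ (proj₂ centres))

  LargeEnough : Set
  LargeEnough = ∃[ n₁ ] 0 < n₁ × (∀ n → n₁ ≤ n → ∀ e → IsEx (4 + r′) (n ∸ t) (LinearStar (4 + r′) p) e →
    ∀ (F : Hypergraph n) → Free (4 + r′) n H F → m F ≤ (n C (4 + r′)) ∸ ((n ∸ t) C (4 + r′)) + e)

  large-enough : LargeEnough
  large-enough = from (4 * v) (8 * v * (4 + r′) * (1 + 2 * (4 * v))) _ refl refl ≤-refl
    where
    from : ∀ N₂ N₃ N′ → 4 * v ≡ N₂ → 8 * v * (4 + r′) * (1 + 2 * N₂) ≡ N₃ →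
      8 * N₂ + (2 * (N₃ * N₃ * (1 + 2 * N₂)) + 2) ≤ N′ → LargeEnough
    -- The successor makes n positive and `2 * (t + v) < n` strict.
    from N₂ N₃ N′ N₂≡ N₃≡ N′≥ = suc (a + (b + c)) , s≤s z≤n , λ n n₁≤n e ex F free →
      upper-bound N₂ N₃ N′ N₂≡ N₃≡ (≤-trans (m≤m+n _ _) N′≥) (≤-trans (≤-trans (m≤m+n _ 2) (m≤n+m _ (8 * N₂))) N′≥)
        (≤-trans (≤-trans (m≤n+m 2 _) (m≤n+m _ (8 * N₂))) N′≥)
        (≤-trans (≤-trans (≤-trans (m≤n+m v t) (≤-trans (m≤m+n (t + v) _) (m≤m+n a (b + c)))) (n≤1+n _)) n₁≤n)
        (≤-trans (≤-trans (≤-trans (m≤m+n t v) (≤-trans (m≤m+n (t + v) _) (m≤m+n a (b + c)))) (n≤1+n _)) n₁≤n)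
        (≤-trans (s≤s z≤n) n₁≤n)
        (≤-trans (≤-trans (≤-trans (m≤m+n b c) (m≤n+m (b + c) a)) (n≤1+n _)) n₁≤n)
        (≤-trans (s≤s (m≤m+n a (b + c))) n₁≤n)
        (≤-trans (≤-trans (≤-trans (m≤n+m c b) (m≤n+m (b + c) a)) (n≤1+n _)) n₁≤n)
        ex F free
      where
      a = 2 * (t + v)
      b = stability-threshold v r′ t N′
      c = 2 * (suc r′ * (3 + v + suc r′))

theorem4p5 : ∀ (r : ℕ) → 4 ≤ r → ∀ (t p v : ℕ) (H : Hypergraph v) →
    Uniform H r → IsTreeOrdering H → Reducible H (r ∸ 2) →
    ∀ (S : Subset v) → MinCrossCut H S → ∣ S ∣ ≡ suc t →
    ∀ (w : Fin v) → IncludedLast H S w → StarIsLinear H w p →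
    ∃[ n₁ ] 0 < n₁ × (∀ n → n₁ ≤ n → ∀ e → IsEx r (n ∸ t) (LinearStar r p) e →
    ∀ (F : Hypergraph n) → Free r n H F →
    m F ≤ (n C r) ∸ ((n ∸ t) C r) + e)
theorem4p5 (suc (suc (suc (suc r′)))) (s≤s (s≤s (s≤s (s≤s z≤n)))) t p v H uniformH tree reducible S (cross , _) ∣S∣ w last star =
  large-enough H uniformH tree reducible S cross ∣S∣ w last star
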